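{- Let $d\ge2$ be an integer, let $f:\mathbb{N}\to\mathbb{N}$ be a function of subexponential growth, and let $\mathcal{P}\subset\mathrm{Graph}_d$ be a union-closed monotone graph property. Then $\zeta(G)=d_e(G,\mathcal{P})$ is a continuous graph parameter on $\mathrm{Graph}_d^f$; that is, $\lim_{n\to\infty}d_e(G_n,\mathcal{P})$ exists for every weakly convergent sequence $\{G_n\}_{n=1}^\infty\subset\mathrm{Graph}_d^f$.
   Context: $\mathrm{Graph}_d$ is the set of finite simple graphs (up to isomorphism) in which every vertex has degree at most $d$. For a vertex $x$ of a graph, $B_r(x)$ is the ball of radius $r$ around $x$ (the vertices at graph distance at most $r$ from $x$ with the induced graph structure, rooted at $x$). A function $f:\mathbb{N}\to\mathbb{N}$ has subexponential growth if for every $\delta>0$ there is $C_\delta>0$ such that $f(n)\le C_\delta(1+\delta)^n$ for all $n\ge1$. $\mathrm{Graph}_d^f$ is the class of graphs $G\in\mathrm{Graph}_d$ such that $|B_r(x)|\le f(r)$ for each $x\in V(G)$ and each $r\ge 1$. For $r\ge1$, $U^{r,d}$ is the finite set of rooted isomorphism classes of finite simple connected rooted graphs of maximum degree at most $d$ in which every vertex is at distance at most $r$ from the root. For $\alpha\in U^{r,d}$ and $G\in \mathrm{Graph}_d$, $p_G(\alpha)=|T(G,\alpha)|/|V(G)|$, where $T(G,\alpha)$ is the set of $x\in V(G)$ such that $B_r(x)$ is rooted isomorphic to $\alpha$. A sequence $\{G_n\}\subset\mathrm{Graph}_d$ with $|V(G_n)|\to\infty$ is weakly convergent if $\lim_{n\to\infty}p_{G_n}(\alpha)$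 exists for every $r\ge1$ and $\alpha\in U^{r,d}$. A graph parameter is a real function on finite simple graphs invariant under isomorphism; it is continuous on $\mathrm{Graph}_d^f$ if $\lim_{n\to\infty}\phi(G_n)$ exists for every weakly convergent sequence $\{G_n\}\subset\mathrm{Graph}_d^f$. A class $\mathcal{P}\subset\mathrm{Graph}_d$ is a union-closed monotone graph property if: (i) every $A$ with $|E(A)|=0$ belongs to $\mathcal{P}$; (ii) if $A\in\mathcal{P}$ and $B\subset A$ is a spanning subgraph ($V(B)=V(A)$), then $B\in\mathcal{P}$; (iii) if $A,B\in\mathcal{P}$, then the disjoint union of $A$ and $B$ is in $\mathcal{P}$. For finite graphs $G,H$ on the same vertex set $V$, $d_e(G,H)=|E(G)\triangle E(H)|/|V|$. The edit-distance from $\mathcal{P}$ is $d_e(G,\mathcal{P})=\inf\{d_e(G,H): V(H)=V(G),\ H\in\mathcal{P}\}$. -}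

module Defs where

open import Axiom.ExcludedMiddle using (ExcludedMiddle)
open import Data.Bool using (Bool; true; false; T; T?; _xor_)
open import Data.Fin using (Fin; _<?_)
open import Data.Integer using (+_)
open import Data.Irrelevant using ([_])
open import Data.List using (length; filter; cartesianProduct; allFin)
open import Data.Nat as ℕ using (ℕ; suc; NonZero)
open import Data.Product using (Σ-syntax; ∃-syntax; _×_; _,_; proj₁; proj₂)
open import Data.Rational as ℚ using (ℚ; 0ℚ; 1ℚ; _+_; _*_; _-_; _/_; ∣_∣; Positive)
open import Data.Rational.Properties using (+-*-rawSemiring; ≤-reflexive; ≤-trans; +-inverseʳ; nonNegative⁻¹; +-mono-≤; normalize-nonNeg)
open import Data.Refinement using (Refinement-syntax; value; _,_)
open import Data.Sum using (_⊎_; inj₁; inj₂)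
open import Function.Bundles using (_↔_; Inverse)
open import Level using (0ℓ)
open import Relation.Binary.PropositionalEquality using (_≡_; refl; cong)
open import Relation.Nullary.Decidable using (_×-dec_)
open import Relation.Unary using (Pred; _∈_)
open import Algebra.Definitions.RawSemiring +-*-rawSemiring using (_^_)

------------------------------------------------------------------------
-- Real numbers (regular Cauchy sequences, after Bishop)

record ℝ : Set where
  field
    approx  : ℕ → ℚ
    regular : ∀ m n → ∣ approx m - approx n ∣ ℚ.≤ + 1 / suc m + + 1 / suc n

open ℝ public

fromℚ : ℚ → ℝ
fromℚ q .approx _ = q
fromℚ q .regular m n = ≤-trans
  (≤-reflexive (cong ∣_∣ (+-inverseʳ q)))
  (+-mono-≤ (1/suc≥0 m) (1/suc≥0 n))
  where
  1/suc≥0 : ∀ k → 0ℚ ℚ.≤ + 1 / suc k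
  1/suc≥0 k = nonNegative⁻¹ (+ 1 / suc k) {{normalize-nonNeg 1 (suc k)}}

-- The n-th approximation is within 1/(n+1) of the number it represents, so a
-- non-strict inequality between two reals holds exactly when it holds between
-- all their n-th approximations with slack 2/(n+1).

infix 4 _≤ᴿ_ _≃ᴿ_

_≤ᴿ_ : ℝ → ℝ → Set
x ≤ᴿ y = ∀ n → approx x n ℚ.≤ approx y n + + 2 / suc n

_≃ᴿ_ : ℝ → ℝ → Set
x ≃ᴿ y = x ≤ᴿ y × y ≤ᴿ x

-- ∣ x - y ∣ ≤ ε
∣_-_∣≤_ : ℝ → ℝ → ℚ → Set
∣ x - y ∣≤ ε = ∀ n → ∣ approx x n - approx y n ∣ ℚ.≤ ε + + 2 / suc n

IsLimit : (ℕ → ℝ) → ℝ → Set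
IsLimit a L = ∀ (ε : ℚ) → Positive ε → ∃[ N ] ∀ n → N ℕ.≤ n → ∣ a n - L ∣≤ ε

HasLimit : (ℕ → ℝ) → Set
HasLimit a = ∃[ L ] IsLimit a L

IsInfimum : {I : Set} → (I → ℝ) → ℝ → Set
IsInfimum a x = (∀ i → x ≤ᴿ a i) × (∀ z → (∀ i → z ≤ᴿ a i) → z ≤ᴿ x)

-- Restricting δ and C to the rationals loses nothing: a smaller δ and a larger
-- C can always be taken rational.
Subexponential : (ℕ → ℕ) → Set
Subexponential f =
  ∀ (δ : ℚ) → Positive δ →
  Σ[ C ∈ ℚ ] Positive C × (∀ n → 1 ℕ.≤ n → + f n / 1 ℚ.≤ C * (1ℚ + δ) ^ n)

------------------------------------------------------------------------
-- Simple graphs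

record SimpleGraph (V : Set) : Set where
  field
    adj         : V → V → Bool
    symmetric   : ∀ u v → adj u v ≡ adj v u
    irreflexive : ∀ v → adj v v ≡ false

open SimpleGraph public

infix 4 _≅_ _⊆_
infixr 6 _⊎ᴳ_

record _≅_ {V W : Set} (G : SimpleGraph V) (H : SimpleGraph W) : Set where
  field
    bijection : V ↔ W
    preserves : ∀ u v → adj H (Inverse.to bijection u) (Inverse.to bijection v) ≡ adj G u v

open _≅_ public

_⊆_ : {V : Set} → SimpleGraph V → SimpleGraph V → Set
H ⊆ G = ∀ u v → T (adj H u v) → T (adj G u v)

_⊎ᴳ_ : {V W : Set} → SimpleGraph V → SimpleGraph W → SimpleGraph (V ⊎ W)
(G ⊎ᴳ H) .adj (inj₁ u) (inj₁ v) = adj G u v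
(G ⊎ᴳ H) .adj (inj₂ u) (inj₂ v) = adj H u v
(G ⊎ᴳ H) .adj (inj₁ _) (inj₂ _) = false
(G ⊎ᴳ H) .adj (inj₂ _) (inj₁ _) = false
(G ⊎ᴳ H) .symmetric (inj₁ u) (inj₁ v) = symmetric G u v
(G ⊎ᴳ H) .symmetric (inj₂ u) (inj₂ v) = symmetric H u v
(G ⊎ᴳ H) .symmetric (inj₁ _) (inj₂ _) = refl
(G ⊎ᴳ H) .symmetric (inj₂ _) (inj₁ _) = refl
(G ⊎ᴳ H) .irreflexive (inj₁ v) = irreflexive G v
(G ⊎ᴳ H) .irreflexive (inj₂ v) = irreflexive H v

induced : {V : Set} → SimpleGraph V → (P : Pred V 0ℓ) → SimpleGraph [ v ∈ V ∣ P v ]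
induced G P .adj u v         = adj G (value u) (value v)
induced G P .symmetric u v   = symmetric G (value u) (value v)
induced G P .irreflexive v   = irreflexive G (value v)

-- Within G r u v : v can be reached from u along at most r edges, i.e. the
-- graph distance from u to v is at most r.
data Within {V : Set} (G : SimpleGraph V) : ℕ → V → V → Set where
  here : ∀ {r u} → Within G r u u
  step : ∀ {r u v w} → T (adj G u v) → Within G r v w → Within G (suc r) u w

Connected : {V : Set} → SimpleGraph V → Set
Connected G = ∀ u v → ∃[ r ] Within G r u v

-- The irrelevance of the membership proof in a refinement type makes distinct
-- walks to the same vertex count as one element.
BallVertex : {V : Set} → SimpleGraph V → ℕ → V → Set
BallVertex {V} G r x = [ y ∈ V ∣ Within G r x y ]

ball : {V : Set} (G : SimpleGraph V) (r : ℕ) (x : V) → SimpleGraph (BallVertex G r x)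
ball G r x = induced G (Within G r x)

ballRoot : {V : Set} (G : SimpleGraph V) (r : ℕ) (x : V) → BallVertex G r x
ballRoot G r x = x , [ here ]

RootedIso : {V W : Set} → SimpleGraph V → V → SimpleGraph W → W → Set
RootedIso G x H y = Σ[ φ ∈ G ≅ H ] Inverse.to (bijection φ) x ≡ y

------------------------------------------------------------------------
-- Finite simple graphs

record FinGraph : Set where
  constructor ⟨_⟩
  field
    {order}    : ℕ
    .{{order≢0}} : NonZero order
    graph      : SimpleGraph (Fin order)

  Vertex : Set
  Vertex = Fin order

open FinGraph public

degree : ∀ {n} → SimpleGraph (Fin n) → Fin n → ℕ
degree {n} G u = length (filter (λ v → T? (adj G u v)) (allFin n))

-- The number of unordered pairs {u , v}, u ≠ v, satisfying a symmetric R.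
countPairs : ∀ {n} → (Fin n → Fin n → Bool) → ℕ
countPairs {n} R = length (filter
  (λ p → (proj₁ p <? proj₂ p) ×-dec T? (R (proj₁ p) (proj₂ p)))
  (cartesianProduct (allFin n) (allFin n)))

∣E_∣ : ∀ {n} → SimpleGraph (Fin n) → ℕ
∣E G ∣ = countPairs (adj G)

∣E_△E_∣ : ∀ {n} → SimpleGraph (Fin n) → SimpleGraph (Fin n) → ℕ
∣E G △E H ∣ = countPairs (λ u v → adj G u v xor adj H u v)

editDistance : ∀ {n} .{{_ : NonZero n}} → SimpleGraph (Fin n) → SimpleGraph (Fin n) → ℚ
editDistance {n} G H = + ∣E G △E H ∣ / n

Graph[_] : ℕ → Pred FinGraph 0ℓ
Graph[ d ] G = ∀ (v : Vertex G) → degree (graph G) v ℕ.≤ d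

record IsUnionClosedMonotone (d : ℕ) (P : Pred FinGraph 0ℓ) : Set where
  field
    bounded  : ∀ {G} → P G → Graph[ d ] G
    resp-≅   : ∀ {A B} → graph A ≅ graph B → P A → P B
    edgeless : ∀ A → ∣E graph A ∣ ≡ 0 → P A
    monotone : ∀ {n} .{{_ : NonZero n}} {A B : SimpleGraph (Fin n)} →
               B ⊆ A → P ⟨ A ⟩ → P ⟨ B ⟩
    union    : ∀ {A B} → P A → P B →
               ∀ C → graph C ≅ (graph A ⊎ᴳ graph B) → P C

-- The number is d_e(G , P), the infimum of the edit distances from G to the
-- members of P with the same vertex set.
IsEditDistanceFrom : Pred FinGraph 0ℓ → FinGraph → ℝ → Set
IsEditDistanceFrom P G = IsInfimum {I = Σ[ H ∈ SimpleGraph (Vertex G) ] P ⟨ H ⟩}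
  (λ (H , _) → fromℚ (editDistance (graph G) H))

record U (r d : ℕ) : Set where
  field
    shape     : FinGraph
    root      : Vertex shape
    bounded   : Graph[ d ] shape
    connected : Connected (graph shape)
    radius    : ∀ v → Within (graph shape) r root v

open U public using (shape; root)

IsGraphParameter : (FinGraph → ℝ) → Set
IsGraphParameter φ = ∀ G H → graph G ≅ graph H → φ G ≃ᴿ φ H

-- Cardinalities of subsets of a finite set given by arbitrary predicates are
-- taken classically.
module Classical (em : ExcludedMiddle 0ℓ) where

  card : ∀ {n} → Pred (Fin n) 0ℓ → ℕ
  card {n} P = length (filter (λ x → em {P x}) (allFin n))

  Graph[_]^_ : ℕ → (ℕ → ℕ) → Pred FinGraph 0ℓ
  (Graph[ d ]^ f) G =
    Graph[ d ] G × (∀ (x : Vertex G) r → 1 ℕ.≤ r → card (Within (graph G) r x) ℕ.≤ f r)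

  p : ∀ {r d} → FinGraph → U r d → ℚ
  p {r} G α = + card T[G,α] / order G
    where
    T[G,α] : Pred (Vertex G) 0ℓ
    T[G,α] x = RootedIso (ball (graph G) r x) (ballRoot (graph G) r x)
                         (graph (shape α)) (root α)

  record WeaklyConvergent (d : ℕ) (G : ℕ → FinGraph) : Set where
    field
      bounded   : ∀ n → Graph[ d ] (G n)
      order→∞   : ∀ K → ∃[ N ] ∀ n → N ℕ.≤ n → K ℕ.≤ order (G n)
      converges : ∀ r → 1 ℕ.≤ r → (α : U r d) → HasLimit (λ n → fromℚ (p (G n) α))

  ContinuousOn : ℕ → (ℕ → ℕ) → (FinGraph → ℝ) → Set
  ContinuousOn d f φ =
    ∀ (G : ℕ → FinGraph) → (∀ n → G n ∈ Graph[ d ]^ f) →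
    WeaklyConvergent d G → HasLimit (λ n → φ (G n))

{-# OPTIONS --safe #-}
-- Let D be the edit distance from P.  The limit exists because D(G′) ≤ D(G) + ε
-- whenever G and G′ have almost the same statistics of ρ-balls and G′ is much
-- larger than G.  To see this, let H in P be closest to G.  By subexponential
-- growth, ball carving deletes few vertices of G and of G′ and leaves pieces of
-- bounded radius, those of G′ far larger than those of G.  It also makes the
-- kernel μ_u(z), proportional to Σ_{r ≥ dist(u,z)} λ^r with λ < 1 close to 1,
-- almost constant in u on a piece of G′.  Let the piece with centre q choose a
-- vertex z′ of G′ with law μ_q, match z′ with a vertex z of G that has an
-- isomorphic ball, using every z equally often, and move the piece into G by the
-- isomorphism.  As the kernel is determined by the balls, a vertex of G is
-- covered |G′|/|G| times in expectation, up to a factor near 1, and a second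
-- moment argument fixes the choices.  Pulling H back gives a graph on V(G′) which,
-- up to few edges, lies in the disjoint union of |G′|/|G| copies of H and
-- isolated vertices, because most pieces of G are covered as a whole or not at all.
module Submission where

open import Defs
open import Axiom.ExcludedMiddle using (ExcludedMiddle)
open import Data.Bool using (Bool; true; false; T; T?; _xor_; if_then_else_)
open import Data.Empty using (⊥-elim)
open import Data.Fin as Fin using (Fin; zero; suc; combine; fromℕ<; funToFin; finToFun; inject≤)
import Data.Fin.Properties as Fin
open import Data.Integer as ℤ using (ℤ; +_; -[1+_]; +[1+_]; 0ℤ; _⊖_)
import Data.Integer.Properties as ℤ
import Data.Integer.Tactic.RingSolver as ℤ-Solver
open import Data.Irrelevant using ([_])
open import Data.List using (length; filter; cartesianProduct; allFin; tabulate; map; _++_)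
open import Data.List.Properties using (filter-++; filter-none; length-++; map-tabulate)
open import Data.List.Relation.Unary.All using (universal)
open import Data.Maybe as Maybe using (Maybe; just; nothing)
open import Data.Maybe.Properties using (just-injective)
open import Data.Nat
open import Data.Nat.Induction using (<-rec)
open import Data.Nat.Properties
open import Data.Nat.Tactic.RingSolver using (solve-∀)
open import Data.Product using (Σ-syntax; ∃; ∃-syntax; _×_; _,_; proj₁; proj₂)
open import Data.Rational as ℚ using (ℚ; mkℚ; 0ℚ; 1ℚ; Positive)
import Data.Rational.Properties as ℚ
open import Data.Rational.Unnormalised as ℚᵘ using (mkℚᵘ; *≤*)
import Data.Rational.Unnormalised.Properties as ℚᵘ
open import Data.Refinement using (value; _,_)
open import Data.Refinement.Properties using (value-injective)
open import Data.Sum using (_⊎_; inj₁; inj₂)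
open import Data.Sum.Function.Propositional using (_⊎-↔_)
open import Data.Sum.Properties using (inj₁-injective; inj₂-injective)
open import Data.Unit using (⊤)
open import Function using (_∘_; _↔_; Inverse; mk↔ₛ′; it)
open import Function.Properties.Inverse using (↔-refl; ↔-sym; ↔-trans)
open import Level using (0ℓ)
open import Relation.Binary using (tri<; tri≈; tri>)
open import Relation.Binary.PropositionalEquality
open import Relation.Nullary using (¬_; Dec; yes; no; does; recompute)
open import Relation.Nullary.Decidable using (_×-dec_)
open import Relation.Unary using (Pred)
import Algebra.Properties.Group ℚ.+-0-group as ℚ-Group
import Algebra.Properties.Semiring.Sum +-*-semiring as Sum
import Algebra.Properties.Semiring.Sum ℤ.+-*-semiring as ℤSum
open import Algebra.Definitions.RawSemiring ℚ.+-*-rawSemiring using () renaming (_^_ to _^ℚ_)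

-- Abstract, so that unification can read the summand off an equation between sums.
abstract
  ∑ : ∀ {n} → (Fin n → ℕ) → ℕ
  ∑ = Sum.sum

  ∑-empty : (f : Fin 0 → ℕ) → ∑ f ≡ 0
  ∑-empty f = refl

  ∑-suc : ∀ {n} (f : Fin (suc n) → ℕ) → ∑ f ≡ f zero + ∑ (f ∘ suc)
  ∑-suc f = refl

  ∑-cong : ∀ {n} {f g : Fin n → ℕ} → (∀ i → f i ≡ g i) → ∑ f ≡ ∑ g
  ∑-cong = Sum.sum-cong-≗

  ∑-comm : ∀ {m n} (f : Fin m → Fin n → ℕ) → ∑ (λ i → ∑ (f i)) ≡ ∑ (λ j → ∑ (λ i → f i j))
  ∑-comm = Sum.∑-comm

  ∑-distrib-+ : ∀ {n} (f g : Fin n → ℕ) → ∑ (λ i → f i + g i) ≡ ∑ f + ∑ g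
  ∑-distrib-+ = Sum.∑-distrib-+

  ∑-permute : ∀ {m n} (f : Fin n → ℕ) (π : Fin m ↔ Fin n) → ∑ f ≡ ∑ (f ∘ Inverse.to π)
  ∑-permute = Sum.∑-permute

  *-distribˡ-∑ : ∀ {n} c (f : Fin n → ℕ) → c * ∑ f ≡ ∑ (λ i → c * f i)
  *-distribˡ-∑ = Sum.*-distribˡ-sum

  *-distribʳ-∑ : ∀ {n} c (f : Fin n → ℕ) → ∑ f * c ≡ ∑ (λ i → f i * c)
  *-distribʳ-∑ = Sum.*-distribʳ-sum

  ∑-mono : ∀ {n} {f g : Fin n → ℕ} → (∀ i → f i ≤ g i) → ∑ f ≤ ∑ g
  ∑-mono {zero}  f≤g = z≤n
  ∑-mono {suc n} f≤g = +-mono-≤ (f≤g zero) (∑-mono (f≤g ∘ suc))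

  ∑-const : ∀ n c → ∑ {n} (λ _ → c) ≡ n * c
  ∑-const zero    c = refl
  ∑-const (suc n) c = cong (_+_ c) (∑-const n c)

  term≤∑ : ∀ {n} (f : Fin n → ℕ) i → f i ≤ ∑ f
  term≤∑ f zero    = m≤m+n (f zero) _
  term≤∑ f (suc i) = ≤-trans (term≤∑ (f ∘ suc) i) (m≤n+m _ (f zero))

∑-≤-const : ∀ {n} {f : Fin n → ℕ} {c} → (∀ i → f i ≤ c) → ∑ f ≤ n * c
∑-≤-const {n} f≤c = ≤-trans (∑-mono f≤c) (≤-reflexive (∑-const n _))

∑-zero : ∀ {n} {f : Fin n → ℕ} → (∀ i → f i ≡ 0) → ∑ f ≡ 0
∑-zero {n} f≡0 = n≤0⇒n≡0 (≤-trans (∑-≤-const (≤-reflexive ∘ f≡0)) (≤-reflexive (*-zeroʳ n)))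

module Indicators (em : ExcludedMiddle 0ℓ) where

  abstract
    χ : Set → ℕ
    χ A = if does (em {A}) then 1 else 0

    χ-true : ∀ {A : Set} → A → χ A ≡ 1
    χ-true {A} a with em {A}
    ... | yes _ = refl
    ... | no ¬a = ⊥-elim (¬a a)

    χ-false : ∀ {A : Set} → ¬ A → χ A ≡ 0
    χ-false {A} ¬a with em {A}
    ... | yes a = ⊥-elim (¬a a)
    ... | no _  = refl

    χ≤ : ∀ {A : Set} {m} → (A → 1 ≤ m) → χ A ≤ m
    χ≤ {A} A⇒ with em {A}
    ... | yes a = A⇒ a
    ... | no _  = z≤n

  χ≤1 : ∀ A → χ A ≤ 1
  χ≤1 A = χ≤ (λ _ → ≤-refl)

  χ*≤ : ∀ {A : Set} {m k} → (A → k ≤ m) → χ A * k ≤ m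
  χ*≤ {A} {m} {k} A⇒ with em {A}
  ... | yes a rewrite χ-true a | *-identityˡ k = A⇒ a
  ... | no ¬a rewrite χ-false ¬a = z≤n

  χ-mono : ∀ {A B : Set} → (A → B) → χ A ≤ χ B
  χ-mono A⇒B = χ≤ (λ a → ≤-reflexive (sym (χ-true (A⇒B a))))

  χ-cong : ∀ {A B : Set} → (A → B) → (B → A) → χ A ≡ χ B
  χ-cong f g = ≤-antisym (χ-mono f) (χ-mono g)

  χ-× : ∀ A B → χ (A × B) ≡ χ A * χ B
  χ-× A B with em {A} | em {B}
  ... | yes a | yes b rewrite χ-true a | χ-true b = χ-true (a , b)
  ... | yes a | no ¬b rewrite χ-true a | χ-false ¬b = χ-false (¬b ∘ proj₂)
  ... | no ¬a | _     rewrite χ-false ¬a = χ-false (¬a ∘ proj₁)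

  χ-⊎ : ∀ A B → χ (A ⊎ B) ≤ χ A + χ B
  χ-⊎ A B = χ≤ λ where
    (inj₁ a) → ≤-trans (≤-reflexive (sym (χ-true a))) (m≤m+n _ _)
    (inj₂ b) → ≤-trans (≤-reflexive (sym (χ-true b))) (m≤n+m _ _)

  χ-∃ : ∀ {n} (P : Fin n → Set) → χ (∃ P) ≤ ∑ (λ i → χ (P i))
  χ-∃ P = χ≤ λ (i , pi) → ≤-trans (≤-reflexive (sym (χ-true pi))) (term≤∑ _ i)

  # : ∀ {n} → (Fin n → Set) → ℕ
  # {n} P = ∑ (λ i → χ (P i))

  #-mono : ∀ {n} {P Q : Fin n → Set} → (∀ i → P i → Q i) → # P ≤ # Q
  #-mono P⇒Q = ∑-mono (λ i → χ-mono (P⇒Q i))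

  #-cong : ∀ {n} {P Q : Fin n → Set} → (∀ i → P i → Q i) → (∀ i → Q i → P i) → # P ≡ # Q
  #-cong f g = ≤-antisym (#-mono f) (#-mono g)

  #≤n : ∀ {n} (P : Fin n → Set) → # P ≤ n
  #≤n {n} P = ≤-trans (∑-≤-const (λ i → χ≤1 (P i))) (≤-reflexive (*-identityʳ n))

  #-all : ∀ {n} {P : Fin n → Set} → (∀ i → P i) → # P ≡ n
  #-all {n} all = trans (∑-cong (λ i → χ-true (all i))) (trans (∑-const n 1) (*-identityʳ n))

  #-none : ∀ {n} {P : Fin n → Set} → (∀ i → ¬ P i) → # P ≡ 0
  #-none none = ∑-zero (λ i → χ-false (none i))

  #-∪ : ∀ {n} {P Q R : Fin n → Set} → (∀ i → P i → Q i ⊎ R i) → # P ≤ # Q + # R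
  #-∪ {n} {P} {Q} {R} split = ≤-trans
    (∑-mono (λ i → ≤-trans (χ-mono (split i)) (χ-⊎ (Q i) (R i))))
    (≤-reflexive (∑-distrib-+ (λ i → χ (Q i)) (λ i → χ (R i))))

  #-split : ∀ {n} {P Q R : Fin n → Set} →
            (∀ i → Q i → P i) → (∀ i → R i → P i) → (∀ i → Q i → ¬ R i) → # Q + # R ≤ # P
  #-split {n} {P} {Q} {R} Q⇒P R⇒P disj = ≤-trans
    (≤-reflexive (sym (∑-distrib-+ (λ i → χ (Q i)) (λ i → χ (R i)))))
    (∑-mono pointwise)
    where
    pointwise : ∀ i → χ (Q i) + χ (R i) ≤ χ (P i)
    pointwise i with em {Q i}
    ... | yes q rewrite χ-true q | χ-false (disj i q) = ≤-reflexive (sym (χ-true (Q⇒P i q)))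
    ... | no ¬q rewrite χ-false ¬q = χ-mono (R⇒P i)

  #-witness : ∀ {n} {P : Fin n → Set} i → P i → 1 ≤ # P
  #-witness {P = P} i pi = ≤-trans (≤-reflexive (sym (χ-true pi))) (term≤∑ (λ j → χ (P j)) i)

  #-unique : ∀ {n} {P : Fin n → Set} → (∀ i j → P i → P j → i ≡ j) → # P ≤ χ (∃ P)
  #-unique {zero}  {P} unique rewrite ∑-empty (λ i → χ (P i)) = z≤n
  #-unique {suc n} {P} unique rewrite ∑-suc (λ i → χ (P i)) with em {P zero}
  ... | no ¬p rewrite χ-false ¬p = ≤-trans (#-unique (λ i j pi pj → Fin.suc-injective (unique (suc i) (suc j) pi pj)))
                        (χ-mono λ (i , pi) → suc i , pi)
  ... | yes p rewrite χ-true p = ≤-reflexive (trans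
    (cong suc (#-none (λ i pi → Fin.0≢1+n (unique zero (suc i) p pi))))
    (sym (χ-true (zero , p))))

  #-≡ : ∀ {n} (i : Fin n) → # (i ≡_) ≡ 1
  #-≡ i = ≤-antisym
    (≤-trans (#-unique (λ j k i≡j i≡k → trans (sym i≡j) i≡k)) (χ≤1 (∃ (i ≡_))))
    (#-witness i refl)

  #-injection : ∀ {m n} {P : Fin m → Set} {Q : Fin n → Set} (f : ∀ i → P i → Fin n) →
                (∀ i pi → Q (f i pi)) →
                (∀ i j pi pj → f i pi ≡ f j pj → i ≡ j) → # P ≤ # Q
  #-injection {m} {n} {P} {Q} f maps inj = begin
    # P ≤⟨ ∑-mono (λ i → ≤-trans (χ-mono (λ pi → f i pi , pi , refl)) (χ-∃ (R i))) ⟩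
    ∑ (λ i → ∑ (λ j → χ (R i j))) ≡⟨ ∑-comm (λ i j → χ (R i j)) ⟩
    ∑ (λ j → ∑ (λ i → χ (R i j))) ≤⟨ ∑-mono (λ j → ≤-trans (#-unique (unique j)) (χ-mono (image j))) ⟩
    # Q ∎
    where
    open ≤-Reasoning
    R : Fin m → Fin n → Set
    R i j = Σ[ pi ∈ P i ] f i pi ≡ j
    unique : ∀ j i i′ → R i j → R i′ j → i ≡ i′
    unique j i i′ (pi , e) (pi′ , e′) = inj i i′ pi pi′ (trans e (sym e′))
    image : ∀ j → ∃ (λ i → R i j) → Q j
    image j (i , pi , refl) = maps i pi

  #-bound : ∀ {m n} {A : Fin m → Set} {R : Fin m → Fin n → Set} {B : Fin n → Set} {c} →
            (∀ y → B y → ∃[ x ] A x × R x y) → (∀ x → A x → # (R x) ≤ c) → # B ≤ # A * c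
  #-bound {m} {n} {A} {R} {B} {c} cover fibre = begin
    # B ≤⟨ ∑-mono (λ y → ≤-trans (χ-mono (cover y)) (χ-∃ _)) ⟩
    ∑ (λ y → ∑ (λ x → χ (A x × R x y))) ≡⟨ ∑-comm (λ y x → χ (A x × R x y)) ⟩
    ∑ (λ x → ∑ (λ y → χ (A x × R x y))) ≤⟨ ∑-mono row ⟩
    ∑ (λ x → (χ (A x) * c)) ≡⟨ sym (*-distribʳ-∑ c (λ x → χ (A x))) ⟩
    # A * c ∎
    where
    open ≤-Reasoning
    row : ∀ x → # (λ y → A x × R x y) ≤ χ (A x) * c
    row x with em {A x}
    ... | yes a rewrite χ-true a | *-identityˡ c = ≤-trans (#-mono (λ y → proj₂)) (fibre x a)
    ... | no ¬a rewrite χ-false ¬a = ≤-reflexive (#-none (λ y → ¬a ∘ proj₁))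

  length-filter-tabulate : ∀ {n} {A : Set} (P : A → Set) (P? : ∀ a → Dec (P a)) (f : Fin n → A) →
    length (filter P? (tabulate f)) ≡ # (P ∘ f)
  length-filter-tabulate {zero}  P P? f = sym (∑-empty (λ i → χ (P (f i))))
  length-filter-tabulate {suc n} P P? f rewrite ∑-suc (λ i → χ (P (f i))) with P? (f zero)
  ... | yes p = trans (cong suc (length-filter-tabulate P P? (f ∘ suc))) (cong (_+ # (P ∘ f ∘ suc)) (sym (χ-true p)))
  ... | no ¬p = trans (length-filter-tabulate P P? (f ∘ suc)) (cong (_+ # (P ∘ f ∘ suc)) (sym (χ-false ¬p)))

  card≡# : ∀ {n} (P : Fin n → Set) → Classical.card em P ≡ # P
  card≡# P = length-filter-tabulate P (λ x → em) (λ i → i)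

  degree≡# : ∀ {n} (G : SimpleGraph (Fin n)) u → degree G u ≡ # (λ v → T (adj G u v))
  degree≡# G u = length-filter-tabulate (λ v → T (adj G u v)) _ (λ i → i)

adj-sym : ∀ {V : Set} (G : SimpleGraph V) {u v} → T (adj G u v) → T (adj G v u)
adj-sym G {u} {v} = subst T (symmetric G u v)

adj-irrefl : ∀ {V : Set} (G : SimpleGraph V) {v} → ¬ T (adj G v v)
adj-irrefl G {v} = subst T (irreflexive G v)

Within-mono : ∀ {V : Set} {G : SimpleGraph V} {r s u v} → r ≤ s → Within G r u v → Within G s u v
Within-mono r≤s       here       = here
Within-mono (s≤s r≤s) (step e w) = step e (Within-mono r≤s w)

Within-trans : ∀ {V : Set} {G : SimpleGraph V} {r s u v w} →
               Within G r u v → Within G s v w → Within G (r + s) u w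
Within-trans {r = r} {s} here q = Within-mono (m≤n+m s r) q
Within-trans (step e p)  q = step e (Within-trans p q)

Within-step : ∀ {V : Set} {G : SimpleGraph V} {r u v w} →
              Within G r u v → T (adj G v w) → Within G (suc r) u w
Within-step here       f = step f here
Within-step (step e p) f = step e (Within-step p f)

Within-sym : ∀ {V : Set} {G : SimpleGraph V} {r u v} → Within G r u v → Within G r v u
Within-sym here = here
Within-sym {G = G} (step e p) = Within-step (Within-sym p) (adj-sym G e)

Within-⊆ : ∀ {V : Set} {G H : SimpleGraph V} {r u v} → H ⊆ G → Within H r u v → Within G r u v
Within-⊆ H⊆G here                   = here
Within-⊆ H⊆G (step {u = u} {v} e p) = step (H⊆G u v e) (Within-⊆ H⊆G p)

module FromRelation (em : ExcludedMiddle 0ℓ) where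

  graphOf : {V : Set} (R : V → V → Set) → (∀ {u v} → R u v → R v u) → (∀ {v} → ¬ R v v) → SimpleGraph V
  graphOf R R-sym R-irrefl .adj u v = does (em {R u v})
  graphOf R R-sym R-irrefl .symmetric u v with em {R u v} | em {R v u}
  ... | yes _ | yes _ = refl
  ... | no _  | no _  = refl
  ... | yes r | no ¬r = ⊥-elim (¬r (R-sym r))
  ... | no ¬r | yes r = ⊥-elim (¬r (R-sym r))
  graphOf R R-sym R-irrefl .irreflexive v with em {R v v}
  ... | yes r = ⊥-elim (R-irrefl r)
  ... | no _  = refl

  from-does : ∀ {A : Set} → T (does (em {A})) → A
  from-does {A} t with em {A}
  ... | yes a = a

  to-does : ∀ {A : Set} → A → T (does (em {A}))
  to-does {A} a with em {A}
  ... | yes _ = _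
  ... | no ¬a = ¬a a

toℚᵘ-/ : ∀ a b → ℚ.toℚᵘ (+ a ℚ./ suc b) ℚᵘ.≃ mkℚᵘ (+ a) b
toℚᵘ-/ a b = ℚ.toℚᵘ-fromℚᵘ (mkℚᵘ (+ a) b)

/-mono-≤ : ∀ a b c d .{{_ : NonZero b}} .{{_ : NonZero d}} → a * d ≤ c * b → + a ℚ./ b ℚ.≤ + c ℚ./ d
/-mono-≤ a (suc b) c (suc d) ad≤cb = ℚ.toℚᵘ-cancel-≤
  (ℚᵘ.≤-respˡ-≃ (ℚᵘ.≃-sym (toℚᵘ-/ a b)) (ℚᵘ.≤-respʳ-≃ (ℚᵘ.≃-sym (toℚᵘ-/ c d))
    (*≤* (subst₂ ℤ._≤_ (ℤ.pos-* a (suc d)) (ℤ.pos-* c (suc b)) (ℤ.+≤+ ad≤cb)))))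

/-cancel-≤ : ∀ a b c d .{{_ : NonZero b}} .{{_ : NonZero d}} → + a ℚ./ b ℚ.≤ + c ℚ./ d → a * d ≤ c * b
/-cancel-≤ a (suc b) c (suc d) p = ℤ.drop‿+≤+
  (subst₂ ℤ._≤_ (sym (ℤ.pos-* a (suc d))) (sym (ℤ.pos-* c (suc b)))
    (ℚᵘ.drop-*≤* (ℚᵘ.≤-respˡ-≃ (toℚᵘ-/ a b) (ℚᵘ.≤-respʳ-≃ (toℚᵘ-/ c d) (ℚ.toℚᵘ-mono-≤ p)))))

/-+ : ∀ a b c d .{{_ : NonZero b}} .{{_ : NonZero d}} →
      + a ℚ./ b ℚ.+ + c ℚ./ d ≡ (+ (a * d + c * b) ℚ./ (b * d)) {{m*n≢0 b d}}
/-+ a (suc b) c (suc d) = ℚ.toℚᵘ-injective (ℚᵘ.≃-trans (ℚ.toℚᵘ-homo-+ (+ a ℚ./ suc b) (+ c ℚ./ suc d))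
  (ℚᵘ.≃-trans (ℚᵘ.+-cong (toℚᵘ-/ a b) (toℚᵘ-/ c d))
  (ℚᵘ.≃-trans (ℚᵘ.≃-reflexive (cong (λ z → mkℚᵘ z (d + b * suc d))
      (trans (cong₂ ℤ._+_ (sym (ℤ.pos-* a (suc d))) (sym (ℤ.pos-* c (suc b)))) (sym (ℤ.pos-+ (a * suc d) (c * suc b))))))
    (ℚᵘ.≃-sym (toℚᵘ-/ (a * suc d + c * suc b) (d + b * suc d))))))

/-* : ∀ a b c d .{{_ : NonZero b}} .{{_ : NonZero d}} →
      (+ a ℚ./ b) ℚ.* (+ c ℚ./ d) ≡ (+ (a * c) ℚ./ (b * d)) {{m*n≢0 b d}}
/-* a (suc b) c (suc d) = ℚ.toℚᵘ-injective (ℚᵘ.≃-trans (ℚ.toℚᵘ-homo-* (+ a ℚ./ suc b) (+ c ℚ./ suc d))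
  (ℚᵘ.≃-trans (ℚᵘ.*-cong (toℚᵘ-/ a b) (toℚᵘ-/ c d))
  (ℚᵘ.≃-trans (ℚᵘ.≃-reflexive (cong (λ z → mkℚᵘ z (d + b * suc d)) (sym (ℤ.pos-* a c))))
    (ℚᵘ.≃-sym (toℚᵘ-/ (a * c) (d + b * suc d))))))

/-cong-≡ : ∀ a b c d .{{_ : NonZero b}} .{{_ : NonZero d}} → a * d ≡ c * b → + a ℚ./ b ≡ + c ℚ./ d
/-cong-≡ a b c d eq = ℚ.≤-antisym (/-mono-≤ a b c d (≤-reflexive eq)) (/-mono-≤ c d a b (≤-reflexive (sym eq)))

≤-natural : ∀ p → ∃[ N ] p ℚ.≤ + N ℚ./ 1
≤-natural p@(mkℚ (+ n) d _) = n , subst (ℚ._≤ + n ℚ./ 1) (ℚ.↥p/↧p≡p p) (/-mono-≤ n (suc d) n 1 (*-monoʳ-≤ n (s≤s (z≤n {d}))))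
≤-natural p@(mkℚ -[1+ n ] d _) = 0 , ℚ.<⇒≤ (ℚ.negative⁻¹ p)

unit-fraction-≤ : ∀ p → Positive p → ∃[ t ] + 1 ℚ./ suc t ℚ.≤ p
unit-fraction-≤ p@(mkℚ +[1+ n ] d _) _ =
  d , subst (+ 1 ℚ./ suc d ℚ.≤_) (ℚ.↥p/↧p≡p p) (/-mono-≤ 1 (suc d) (suc n) (suc d) (*-monoˡ-≤ (suc d) (s≤s (z≤n {n}))))

unit-fraction-positive : ∀ t → Positive (+ 1 ℚ./ suc t)
unit-fraction-positive t = ℚ.normalize-pos 1 (suc t)

bernoulli : ∀ D r → D ^ r * (D + r) ≤ suc D ^ r * D
bernoulli D zero    = ≤-reflexive (cong (1 *_) (+-identityʳ D))
bernoulli D (suc r) = begin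
  D ^ suc r * (D + suc r) ≤⟨ m≤m+n _ (D ^ r * r) ⟩
  D ^ suc r * (D + suc r) + D ^ r * r ≡⟨ expand D (D ^ r) r ⟩
  suc D * (D ^ r * (D + r)) ≤⟨ *-monoʳ-≤ (suc D) (bernoulli D r) ⟩
  suc D * (suc D ^ r * D) ≡⟨ sym (*-assoc (suc D) (suc D ^ r) D) ⟩
  suc D ^ suc r * D ∎
  where
  open ≤-Reasoning
  expand : ∀ D x r → (D * x) * (D + (1 + r)) + x * r ≡ (1 + D) * (x * (D + r))
  expand = solve-∀

^-distribʳ-* : ∀ a b r → (a * b) ^ r ≡ a ^ r * b ^ r
^-distribʳ-* a b zero    = refl
^-distribʳ-* a b (suc r) = trans (cong (a * b *_) (^-distribʳ-* a b r)) (shuffle a b (a ^ r) (b ^ r))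
  where
  shuffle : ∀ a b x y → a * b * (x * y) ≡ a * x * (b * y)
  shuffle = solve-∀

1+1/n-^ : ∀ D r → (1ℚ ℚ.+ + 1 ℚ./ suc D) ^ℚ r ℚ.* (+ (suc D ^ r) ℚ./ 1) ≡ + (suc (suc D) ^ r) ℚ./ 1
1+1/n-^ D zero    = refl
1+1/n-^ D (suc r) = begin
  q ℚ.* q ^ℚ r ℚ.* (+ (suc D ^ suc r) ℚ./ 1) ≡⟨ cong (q ℚ.* q ^ℚ r ℚ.*_) (sym (/-* (suc D) 1 (suc D ^ r) 1)) ⟩
  q ℚ.* q ^ℚ r ℚ.* ((+ suc D ℚ./ 1) ℚ.* (+ (suc D ^ r) ℚ./ 1)) ≡⟨ shuffle q (q ^ℚ r) _ _ ⟩
  q ℚ.* (+ suc D ℚ./ 1) ℚ.* (q ^ℚ r ℚ.* (+ (suc D ^ r) ℚ./ 1)) ≡⟨ cong₂ ℚ._*_ head (1+1/n-^ D r) ⟩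
  (+ suc (suc D) ℚ./ 1) ℚ.* (+ (suc (suc D) ^ r) ℚ./ 1) ≡⟨ /-* (suc (suc D)) 1 (suc (suc D) ^ r) 1 ⟩
  + (suc (suc D) ^ suc r) ℚ./ 1 ∎
  where
  open ≡-Reasoning
  q = 1ℚ ℚ.+ + 1 ℚ./ suc D
  shuffle : ∀ a b c d → a ℚ.* b ℚ.* (c ℚ.* d) ≡ a ℚ.* c ℚ.* (b ℚ.* d)
  shuffle a b c d = trans (ℚ.*-assoc a b (c ℚ.* d)) (trans (cong (a ℚ.*_) (trans (sym (ℚ.*-assoc b c d))
    (trans (cong (ℚ._* d) (ℚ.*-comm b c)) (ℚ.*-assoc c b d)))) (sym (ℚ.*-assoc a c (b ℚ.* d))))
  head : q ℚ.* (+ suc D ℚ./ 1) ≡ + suc (suc D) ℚ./ 1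
  head = trans (cong (ℚ._* (+ suc D ℚ./ 1)) (/-+ 1 1 1 (suc D)))
    (trans (/-* (1 * suc D + 1 * 1) (1 * suc D) (suc D) 1) (/-cong-≡ ((1 * suc D + 1 * 1) * suc D) (1 * suc D * 1) (suc (suc D)) 1 {{m*n≢0 (1 * suc D) 1}} (collect D)))
    where
    collect : ∀ D → (1 * (1 + D) + 1 * 1) * (1 + D) * 1 ≡ (1 + (1 + D)) * (1 * (1 + D) * 1)
    collect = solve-∀

-- With δ = 1/(2A+1), the ratio of (A+1)/A to 1+δ is 1 + 1/2A, whose powers are
-- unbounded by Bernoulli's inequality.
abstract
  subexponential : ∀ {f} → Subexponential f → ∀ A C .{{_ : NonZero A}} →
                   ∃[ r₀ ] ∀ r → r₀ ≤ r → 1 ≤ r → C * (A ^ r * f r) < suc A ^ r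
  subexponential {f} sub A C with sub (+ 1 ℚ./ suc (2 * A)) (unit-fraction-positive (2 * A))
  ... | C′ , _ , bound with ≤-natural C′
  ... | N , C′≤N = 2 * A * (C * N) , λ r r₀≤r 1≤r → *-cancelʳ-< (suc D ^ r) _ _ (begin-strict
    C * (A ^ r * f r) * suc D ^ r ≡⟨ shuffle₁ C (A ^ r) (f r) (suc D ^ r) ⟩
    C * A ^ r * (f r * suc D ^ r) ≤⟨ *-monoʳ-≤ (C * A ^ r) (integral r 1≤r) ⟩
    C * A ^ r * (N * suc (suc D) ^ r) ≡⟨ cong (λ z → C * A ^ r * (N * z)) (trans (cong (_^ r) (double A)) (^-distribʳ-* 2 (suc A) r)) ⟩
    C * A ^ r * (N * (2 ^ r * suc A ^ r)) ≡⟨ shuffle₂ C (A ^ r) N (2 ^ r) (suc A ^ r) ⟩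
    (2 ^ r * A ^ r) * (C * N) * suc A ^ r ≡⟨ cong (λ z → z * (C * N) * suc A ^ r) (sym (^-distribʳ-* 2 A r)) ⟩
    D ^ r * (C * N) * suc A ^ r <⟨ *-monoˡ-< (suc A ^ r) {{m^n≢0 (suc A) r}} (large r r₀≤r) ⟩
    suc D ^ r * suc A ^ r ≡⟨ *-comm (suc D ^ r) (suc A ^ r) ⟩
    suc A ^ r * suc D ^ r ∎)
    where
    open ≤-Reasoning
    D : ℕ
    D = 2 * A
    instance
      D≢0 : NonZero D
      D≢0 = m*n≢0 2 A
    shuffle₁ : ∀ a b c d → a * (b * c) * d ≡ a * b * (c * d)
    shuffle₁ = solve-∀
    shuffle₂ : ∀ a b c d e → a * b * (c * (d * e)) ≡ (d * b) * (a * c) * e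
    shuffle₂ = solve-∀
    double : ∀ A → 2 + 2 * A ≡ 2 * (1 + A)
    double = solve-∀
    large : ∀ r → D * (C * N) ≤ r → D ^ r * (C * N) < suc D ^ r
    large r r₀≤r = *-cancelʳ-< D _ _ (begin-strict
      D ^ r * (C * N) * D ≡⟨ trans (*-assoc (D ^ r) (C * N) D) (cong (D ^ r *_) (*-comm (C * N) D)) ⟩
      D ^ r * (D * (C * N)) ≤⟨ *-monoʳ-≤ (D ^ r) r₀≤r ⟩
      D ^ r * r <⟨ *-monoʳ-< (D ^ r) {{m^n≢0 D r}} (m<n+m r (>-nonZero⁻¹ D)) ⟩
      D ^ r * (D + r) ≤⟨ bernoulli D r ⟩
      suc D ^ r * D ∎)
    integral : ∀ r → 1 ≤ r → f r * suc D ^ r ≤ N * suc (suc D) ^ r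
    integral r 1≤r = subst₂ _≤_ (*-identityʳ _) (*-identityʳ _) (/-cancel-≤ (f r * suc D ^ r) 1 (N * suc (suc D) ^ r) 1 scaled)
      where
      x : ℚ
      x = + (suc D ^ r) ℚ./ 1
      scaled : + (f r * suc D ^ r) ℚ./ 1 ℚ.≤ + (N * suc (suc D) ^ r) ℚ./ 1
      scaled = ℚ.≤-trans (ℚ.≤-reflexive (sym (/-* (f r) 1 (suc D ^ r) 1)))
        (ℚ.≤-trans (ℚ.*-monoʳ-≤-nonNeg x {{ℚ.normalize-nonNeg (suc D ^ r) 1}} (bound r 1≤r))
        (ℚ.≤-trans (ℚ.≤-reflexive (trans (ℚ.*-assoc C′ _ x) (cong (C′ ℚ.*_) (1+1/n-^ D r))))
        (ℚ.≤-trans (ℚ.*-monoʳ-≤-nonNeg (+ (suc (suc D) ^ r) ℚ./ 1) {{ℚ.normalize-nonNeg (suc (suc D) ^ r) 1}} C′≤N)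
        (ℚ.≤-reflexive (/-* N 1 (suc (suc D) ^ r) 1)))))

slow-growth : ∀ A k (b : ℕ → ℕ) → 1 ≤ b 0 → A ^ k * b k < suc A ^ k →
              ∃[ r ] r < k × A * b (suc r) < suc A * b r
slow-growth A zero    b 1≤b bk< = ⊥-elim (<⇒≱ bk< (≤-trans 1≤b (≤-reflexive (sym (*-identityˡ (b 0))))))
slow-growth A (suc k) b 1≤b bk< with A * b (suc k) <? suc A * b k
... | yes slow = k , ≤-refl , slow
... | no ¬slow with slow-growth A k b 1≤b (*-cancelˡ-< (suc A) _ _ (≤-<-trans fast bk<))
  where
  fast : suc A * (A ^ k * b k) ≤ A ^ suc k * b (suc k)
  fast = begin
    suc A * (A ^ k * b k) ≡⟨ shuffle (suc A) (A ^ k) (b k) ⟩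
    A ^ k * (suc A * b k) ≤⟨ *-monoʳ-≤ (A ^ k) (≮⇒≥ ¬slow) ⟩
    A ^ k * (A * b (suc k)) ≡⟨ shuffle′ (A ^ k) A (b (suc k)) ⟩
    A ^ suc k * b (suc k) ∎
    where
    open ≤-Reasoning
    shuffle : ∀ x y z → x * (y * z) ≡ y * (x * z)
    shuffle = solve-∀
    shuffle′ : ∀ x y z → x * (y * z) ≡ (y * x) * z
    shuffle′ = solve-∀
... | r , r<k , slow = r , m<n⇒m<1+n r<k , slow

module Separation (em : ExcludedMiddle 0ℓ) where
  open Indicators em
  open FromRelation em

  record Separated {n} (G : SimpleGraph (Fin n)) (t k : ℕ) : Set where
    field
      piece : Fin n → Maybe (Fin n)
      few   : t * # (λ u → piece u ≡ nothing) ≤ n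
      same  : ∀ {u v a b} → T (adj G u v) → piece u ≡ just a → piece v ≡ just b → a ≡ b
      near  : ∀ {u a} → piece u ≡ just a → Within G k a u

  module _ {n} (G : SimpleGraph (Fin n)) (A k : ℕ)
           (slow : ∀ x → A ^ k * # (Within G k x) < suc A ^ k) where

    record SeparatedOn (U : Fin n → Set) : Set where
      field
        piece : Fin n → Maybe (Fin n)
        few   : suc A * # (λ u → U u × piece u ≡ nothing) ≤ # U
        same  : ∀ {u v a b} → U u → U v → T (adj G u v) → piece u ≡ just a → piece v ≡ just b → a ≡ b
        near  : ∀ {u a} → U u → piece u ≡ just a → Within G k a u

    module Carve (U : Fin n → Set) (x : Fin n) (x∈U : U x) where

      G∣U : SimpleGraph (Fin n)
      G∣U = graphOf (λ u v → T (adj G u v) × U u × U v)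
                    (λ (e , u , v) → adj-sym G e , v , u)
                    (λ (e , _) → adj-irrefl G e)

      G∣U⊆G : G∣U ⊆ G
      G∣U⊆G u v e = proj₁ (from-does e)

      B : ℕ → Fin n → Set
      B r = Within G∣U r x

      B⊆U : ∀ {r y u} → Within G∣U r u y → U u → U y
      B⊆U here       u∈U = u∈U
      B⊆U (step e p) u∈U = B⊆U p (proj₂ (proj₂ (from-does e)))

      radius : ∃[ r ] r < k × A * # (B (suc r)) < suc A * # (B r)
      radius = slow-growth A k (λ r → # (B r)) (#-witness x here)
        (≤-<-trans (*-monoʳ-≤ (A ^ k) (#-mono (λ y → Within-⊆ G∣U⊆G))) (slow x))

      r = proj₁ radius

      U′ : Fin n → Set
      U′ u = U u × ¬ B (suc r) u

      #U′< : # U′ < # U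
      #U′< = ≤-trans (+-monoʳ-≤ 1 (≤-refl {# U′}))
        (≤-trans (+-monoˡ-≤ (# U′) (#-witness {P = B (suc r)} x here))
          (#-split {P = U} {B (suc r)} {U′} (λ u b → B⊆U b x∈U) (λ u → proj₁) (λ u b → λ u′ → proj₂ u′ b)))

      module _ (rest : SeparatedOn U′) where
        open SeparatedOn rest renaming (piece to piece′; few to few′; same to same′; near to near′)

        piece : Fin n → Maybe (Fin n)
        piece u with em {B r u} | em {B (suc r) u}
        ... | yes _ | _     = just x
        ... | no _  | yes _ = nothing
        ... | no _  | no _  = piece′ u

        data View (u : Fin n) : Set where
          inside   : B r u → piece u ≡ just x → View u
          boundary : B (suc r) u → ¬ B r u → piece u ≡ nothing → View u
          outside  : ¬ B (suc r) u → piece u ≡ piece′ u → View u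

        view : ∀ u → View u
        view u with em {B r u} | em {B (suc r) u} | inside {u} | boundary {u} | outside {u}
        ... | yes b | _     | i | _  | _ = i b refl
        ... | no ¬b | yes b | _ | bd | _ = bd b ¬b refl
        ... | no _  | no ¬b | _ | _  | o = o ¬b refl

        few : suc A * # (λ u → U u × piece u ≡ nothing) ≤ # U
        few = begin
          suc A * # (λ u → U u × piece u ≡ nothing) ≤⟨ *-monoʳ-≤ (suc A) (#-∪ split) ⟩
          suc A * (# ∂B + # Z′) ≡⟨ *-distribˡ-+ (suc A) (# ∂B) (# Z′) ⟩
          suc A * # ∂B + suc A * # Z′ ≤⟨ +-mono-≤ few-∂ few′ ⟩
          # (B (suc r)) + # U′ ≤⟨ #-split {P = U} {B (suc r)} {U′} (λ u b → B⊆U b x∈U) (λ u → proj₁) (λ u b → λ u′ → proj₂ u′ b) ⟩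
          # U ∎
          where
          open ≤-Reasoning
          ∂B Z′ : Fin n → Set
          ∂B u = B (suc r) u × ¬ B r u
          Z′ u = U′ u × piece′ u ≡ nothing
          split : ∀ u → U u × piece u ≡ nothing → ∂B u ⊎ Z′ u
          split u (u∈U , e) with view u
          ... | inside _ e′ with () ← trans (sym e) e′
          split u (u∈U , e) | boundary b ¬b _ = inj₁ (b , ¬b)
          split u (u∈U , e) | outside ¬b e′ = inj₂ ((u∈U , ¬b) , trans (sym e′) e)
          few-∂ : suc A * # ∂B ≤ # (B (suc r))
          few-∂ = +-cancelʳ-≤ (A * # (B (suc r))) _ _ (begin
            suc A * # ∂B + A * # (B (suc r)) ≤⟨ +-monoʳ-≤ (suc A * # ∂B) (<⇒≤ (proj₂ (proj₂ radius))) ⟩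
            suc A * # ∂B + suc A * # (B r) ≡⟨ sym (*-distribˡ-+ (suc A) (# ∂B) (# (B r))) ⟩
            suc A * (# ∂B + # (B r)) ≤⟨ *-monoʳ-≤ (suc A) (#-split (λ u → proj₁) (λ u → Within-mono (n≤1+n r)) (λ u → proj₂)) ⟩
            # (B (suc r)) + A * # (B (suc r)) ∎)

        near : ∀ {u a} → U u → piece u ≡ just a → Within G k a u
        near {u} u∈U e with view u
        ... | inside b e′      = subst (λ a → Within G k a u) (just-injective (trans (sym e′) e))
                                   (Within-mono (<⇒≤ (proj₁ (proj₂ radius))) (Within-⊆ G∣U⊆G b))
        ... | boundary _ _ e′  with () ← trans (sym e′) e
        ... | outside ¬b e′    = near′ (u∈U , ¬b) (trans (sym e′) e)

        expand : ∀ {u v} → U u → U v → T (adj G u v) → B r u → B (suc r) v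
        expand u∈U v∈U e b = Within-step b (to-does (e , u∈U , v∈U))

        same : ∀ {u v a b} → U u → U v → T (adj G u v) → piece u ≡ just a → piece v ≡ just b → a ≡ b
        same {u} {v} u∈U v∈U e eᵤ eᵥ with view u | view v
        ... | boundary _ _ e′ | _               with () ← trans (sym e′) eᵤ
        same {u} {v} u∈U v∈U e eᵤ eᵥ | _ | boundary _ _ e′  with () ← trans (sym e′) eᵥ
        same {u} {v} u∈U v∈U e eᵤ eᵥ | inside _ e₁  | inside _ e₂ =
          trans (sym (just-injective (trans (sym e₁) eᵤ))) (just-injective (trans (sym e₂) eᵥ))
        same {u} {v} u∈U v∈U e eᵤ eᵥ | inside b _   | outside ¬b _ = ⊥-elim (¬b (expand u∈U v∈U e b))
        same {u} {v} u∈U v∈U e eᵤ eᵥ | outside ¬b _ | inside b _   = ⊥-elim (¬b (expand v∈U u∈U (adj-sym G e) b))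
        same {u} {v} u∈U v∈U e eᵤ eᵥ | outside ¬b₁ e₁ | outside ¬b₂ e₂ =
          same′ (u∈U , ¬b₁) (v∈U , ¬b₂) e (trans (sym e₁) eᵤ) (trans (sym e₂) eᵥ)

        extended : SeparatedOn U
        extended = record { piece = piece ; few = few ; same = same ; near = near }

    separatedOn : ∀ m (U : Fin n → Set) → # U ≤ m → SeparatedOn U
    separatedOn m U #U≤m with em {∃ U}
    ... | no empty = record
      { piece = λ _ → nothing
      ; few   = ≤-trans (≤-reflexive (trans (cong (suc A *_) (#-none (λ u → λ (u∈U , _) → empty (u , u∈U)))) (*-zeroʳ (suc A)))) z≤n
      ; same  = λ u∈U → ⊥-elim (empty (_ , u∈U))
      ; near  = λ u∈U → ⊥-elim (empty (_ , u∈U))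
      }
    separatedOn zero    U #U≤m | yes (x , x∈U) = ⊥-elim (<⇒≱ (#-witness {P = U} x x∈U) #U≤m)
    separatedOn (suc m) U #U≤m | yes (x , x∈U) =
      extended (separatedOn m U′ (≤-pred (≤-trans #U′< #U≤m)))
      where open Carve U x x∈U

    separated : Separated G (suc A) k
    separated = record
      { piece = piece
      ; few   = ≤-trans (*-monoʳ-≤ (suc A) (#-mono (λ u e → _ , e))) (≤-trans few (#≤n all))
      ; same  = same _ _
      ; near  = near _
      }
      where
      all : Fin n → Set
      all _ = ⊤
      open SeparatedOn (separatedOn n all (#≤n all))

abstract
  ∑ℤ : ∀ {n} → (Fin n → ℤ) → ℤ
  ∑ℤ = ℤSum.sum

  ∑ℤ-empty : (f : Fin 0 → ℤ) → ∑ℤ f ≡ 0ℤ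
  ∑ℤ-empty f = refl

  ∑ℤ-suc : ∀ {n} (f : Fin (suc n) → ℤ) → ∑ℤ f ≡ f zero ℤ.+ ∑ℤ (f ∘ suc)
  ∑ℤ-suc f = refl

  ∑ℤ-cong : ∀ {n} {f g : Fin n → ℤ} → (∀ i → f i ≡ g i) → ∑ℤ f ≡ ∑ℤ g
  ∑ℤ-cong = ℤSum.sum-cong-≗

  ∑ℤ-comm : ∀ {m n} (f : Fin m → Fin n → ℤ) → ∑ℤ (λ i → ∑ℤ (f i)) ≡ ∑ℤ (λ j → ∑ℤ (λ i → f i j))
  ∑ℤ-comm = ℤSum.∑-comm

  ∑ℤ-distrib-+ : ∀ {n} (f g : Fin n → ℤ) → ∑ℤ (λ i → f i ℤ.+ g i) ≡ ∑ℤ f ℤ.+ ∑ℤ g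
  ∑ℤ-distrib-+ = ℤSum.∑-distrib-+

  *-distribˡ-∑ℤ : ∀ {n} c (f : Fin n → ℤ) → c ℤ.* ∑ℤ f ≡ ∑ℤ (λ i → c ℤ.* f i)
  *-distribˡ-∑ℤ = ℤSum.*-distribˡ-sum

  ∑ℤ-mono : ∀ {n} {f g : Fin n → ℤ} → (∀ i → f i ℤ.≤ g i) → ∑ℤ f ℤ.≤ ∑ℤ g
  ∑ℤ-mono {zero}  f≤g = ℤ.≤-refl
  ∑ℤ-mono {suc n} f≤g = ℤ.+-mono-≤ (f≤g zero) (∑ℤ-mono (f≤g ∘ suc))

∑ℤ-+ : ∀ {n} (f : Fin n → ℕ) → ∑ℤ (λ i → + f i) ≡ + ∑ f
∑ℤ-+ {zero}  f rewrite ∑-empty f = ∑ℤ-empty (λ i → + f i)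
∑ℤ-+ {suc n} f rewrite ∑-suc f | ∑ℤ-suc (λ i → + f i) =
  trans (cong (ℤ._+_ (+ f zero)) (∑ℤ-+ (f ∘ suc))) (sym (ℤ.pos-+ (f zero) _))

∑ℤ-zero : ∀ {n} {f : Fin n → ℤ} → (∀ i → f i ≡ 0ℤ) → ∑ℤ f ≡ 0ℤ
∑ℤ-zero {n} f≡0 = trans (∑ℤ-cong f≡0) (trans (∑ℤ-+ {n} (λ _ → 0)) (cong +_ (∑-zero {n} (λ _ → refl))))

square : ∀ i → i ℤ.* i ≡ + (ℤ.∣ i ∣ * ℤ.∣ i ∣)
square (+ n)    = sym (ℤ.pos-* n n)
square -[1+ n ] = refl

⊖-+ : ∀ a b c d → (a ⊖ b) ℤ.+ (c ⊖ d) ≡ (a + c) ⊖ (b + d)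
⊖-+ a b c d = begin
  (a ⊖ b) ℤ.+ (c ⊖ d) ≡⟨ cong₂ ℤ._+_ (sym (ℤ.m-n≡m⊖n a b)) (sym (ℤ.m-n≡m⊖n c d)) ⟩
  (+ a ℤ.- + b) ℤ.+ (+ c ℤ.- + d) ≡⟨ regroup (+ a) (+ b) (+ c) (+ d) ⟩
  (+ a ℤ.+ + c) ℤ.- (+ b ℤ.+ + d) ≡⟨ cong₂ ℤ._-_ (sym (ℤ.pos-+ a c)) (sym (ℤ.pos-+ b d)) ⟩
  + (a + c) ℤ.- + (b + d) ≡⟨ ℤ.m-n≡m⊖n (a + c) (b + d) ⟩
  (a + c) ⊖ (b + d) ∎
  where
  open ≡-Reasoning
  regroup : ∀ x y z w → (x ℤ.- y) ℤ.+ (z ℤ.- w) ≡ (x ℤ.+ z) ℤ.- (y ℤ.+ w)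
  regroup = ℤ-Solver.solve-∀

∑ℤ-⊖ : ∀ {n} (f g : Fin n → ℕ) → ∑ℤ (λ i → f i ⊖ g i) ≡ ∑ f ⊖ ∑ g
∑ℤ-⊖ {zero}  f g rewrite ∑-empty f | ∑-empty g = ∑ℤ-empty (λ i → f i ⊖ g i)
∑ℤ-⊖ {suc n} f g rewrite ∑-suc f | ∑-suc g | ∑ℤ-suc (λ i → f i ⊖ g i) =
  trans (cong (ℤ._+_ (f zero ⊖ g zero)) (∑ℤ-⊖ (f ∘ suc) (g ∘ suc))) (⊖-+ (f zero) (g zero) _ _)

nonpositive-option : ∀ {o} (w : Fin o → ℕ) (g : Fin o → ℤ) → 1 ≤ ∑ w →
                     ∑ℤ (λ j → + w j ℤ.* g j) ≡ 0ℤ → ∃[ j ] 1 ≤ w j × g j ℤ.≤ 0ℤ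
nonpositive-option {o} w g 1≤∑ mean≡0 with Fin.any? (λ j → (1 ≤? w j) ×-dec (g j ℤ.≤? 0ℤ))
... | yes found = found
... | no none   = ⊥-elim (<⇒≱ 1≤∑ (ℤ.drop‿+≤+ (subst₂ ℤ._≤_ (∑ℤ-+ w) mean≡0 (∑ℤ-mono large))))
  where
  large : ∀ j → + w j ℤ.≤ + w j ℤ.* g j
  large j with w j in eq
  ... | zero  = ℤ.≤-refl
  ... | suc k = ℤ.≤-trans (ℤ.≤-reflexive (sym (ℤ.*-identityʳ (+ suc k))))
    (ℤ.*-monoˡ-≤-nonNeg (+ suc k) (ℤ.i<j⇒suc[i]≤j (ℤ.≰⇒> λ gj≤0 → none (j , subst (1 ≤_) (sym eq) (s≤s z≤n) , gj≤0))))

module _ {o c : ℕ} (N B : ℕ) (1≤N : 1 ≤ N) where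

  mean : (Fin o → ℕ) → (Fin o → Fin c → ℕ) → Fin c → ℕ
  mean w v x = ∑ (λ j → w j * v j x)

  deviation : (Fin o → ℕ) → (Fin o → Fin c → ℕ) → Fin o → Fin c → ℤ
  deviation w v j x = (N * v j x) ⊖ mean w v x

  module _ (w : Fin o → ℕ) (∑w : ∑ w ≡ N) (v : Fin o → Fin c → ℕ) (v≤B : ∀ j x → v j x ≤ B) where

    mean≤ : ∀ x → mean w v x ≤ N * B
    mean≤ x = ≤-trans (∑-mono (λ j → *-monoʳ-≤ (w j) (v≤B j x)))
                      (≤-reflexive (trans (sym (*-distribʳ-∑ B w)) (cong (_* B) ∑w)))

    deviation-square : ∀ j x → deviation w v j x ℤ.* deviation w v j x ℤ.≤ + (N * B * (N * B))
    deviation-square j x = ℤ.≤-trans (ℤ.≤-reflexive (square (deviation w v j x))) (ℤ.+≤+ (*-mono-≤ small small))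
      where
      small : ℤ.∣ deviation w v j x ∣ ≤ N * B
      small = ≤-trans (ℤ.∣m⊝n∣≤m⊔n (N * v j x) (mean w v x)) (⊔-lub (*-monoʳ-≤ N (v≤B j x)) (mean≤ x))

    mean-deviation : ∀ x → ∑ℤ (λ j → + w j ℤ.* deviation w v j x) ≡ 0ℤ
    mean-deviation x = begin
      ∑ℤ (λ j → + w j ℤ.* deviation w v j x) ≡⟨ ∑ℤ-cong term ⟩
      ∑ℤ (λ j → (N * (w j * v j x)) ⊖ (w j * m)) ≡⟨ ∑ℤ-⊖ (λ j → N * (w j * v j x)) (λ j → w j * m) ⟩
      ∑ (λ j → N * (w j * v j x)) ⊖ ∑ (λ j → w j * m) ≡⟨ cong₂ _⊖_ (sym (*-distribˡ-∑ N (λ j → w j * v j x)))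
                                                                  (trans (sym (*-distribʳ-∑ m w)) (cong (_* m) ∑w)) ⟩
      (N * m) ⊖ (N * m) ≡⟨ ℤ.n⊖n≡0 (N * m) ⟩
      0ℤ ∎
      where
      open ≡-Reasoning
      m = mean w v x
      swap : ∀ a b d → a * (b * d) ≡ b * (a * d)
      swap = solve-∀
      expand : ∀ a b d → a ℤ.* (b ℤ.- d) ≡ a ℤ.* b ℤ.- a ℤ.* d
      expand = ℤ-Solver.solve-∀
      term : ∀ j → + w j ℤ.* deviation w v j x ≡ (N * (w j * v j x)) ⊖ (w j * m)
      term j = begin
        + w j ℤ.* ((N * v j x) ⊖ m) ≡⟨ cong (+ w j ℤ.*_) (sym (ℤ.m-n≡m⊖n (N * v j x) m)) ⟩
        + w j ℤ.* (+ (N * v j x) ℤ.- + m) ≡⟨ expand (+ w j) (+ (N * v j x)) (+ m) ⟩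
        + w j ℤ.* + (N * v j x) ℤ.- + w j ℤ.* + m ≡⟨ cong₂ ℤ._-_ (sym (ℤ.pos-* (w j) _)) (sym (ℤ.pos-* (w j) m)) ⟩
        + (w j * (N * v j x)) ℤ.- + (w j * m) ≡⟨ ℤ.m-n≡m⊖n (w j * (N * v j x)) (w j * m) ⟩
        (w j * (N * v j x)) ⊖ (w j * m) ≡⟨ cong (_⊖ (w j * m)) (swap (w j) N (v j x)) ⟩
        (N * (w j * v j x)) ⊖ (w j * m) ∎

    good-option : (D : Fin c → ℤ) → ∃[ j ] 1 ≤ w j × ∑ℤ (λ x → D x ℤ.* deviation w v j x) ℤ.≤ 0ℤ
    good-option D = nonpositive-option w (λ j → ∑ℤ (λ x → D x ℤ.* deviation w v j x)) (subst (1 ≤_) (sym ∑w) 1≤N) (begin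
      ∑ℤ (λ j → + w j ℤ.* ∑ℤ (λ x → D x ℤ.* deviation w v j x)) ≡⟨ ∑ℤ-cong (λ j → *-distribˡ-∑ℤ (+ w j) (λ x → D x ℤ.* deviation w v j x)) ⟩
      ∑ℤ (λ j → ∑ℤ (λ x → + w j ℤ.* (D x ℤ.* deviation w v j x))) ≡⟨ ∑ℤ-comm (λ j x → + w j ℤ.* (D x ℤ.* deviation w v j x)) ⟩
      ∑ℤ (λ x → ∑ℤ (λ j → + w j ℤ.* (D x ℤ.* deviation w v j x))) ≡⟨ ∑ℤ-cong (λ x → trans
          (∑ℤ-cong (λ j → swap (+ w j) (D x) (deviation w v j x)))
          (sym (*-distribˡ-∑ℤ (D x) (λ j → + w j ℤ.* deviation w v j x)))) ⟩
      ∑ℤ (λ x → D x ℤ.* ∑ℤ (λ j → + w j ℤ.* deviation w v j x)) ≡⟨ ∑ℤ-zero (λ x → trans (cong (D x ℤ.*_) (mean-deviation x)) (ℤ.*-zeroʳ (D x))) ⟩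
      0ℤ ∎)
      where
      open ≡-Reasoning
      swap : ∀ a b d → a ℤ.* (b ℤ.* d) ≡ b ℤ.* (a ℤ.* d)
      swap = ℤ-Solver.solve-∀

    good-step : (D : Fin c → ℤ) → ∃[ j ] 1 ≤ w j ×
      (let D′ = λ x → D x ℤ.+ deviation w v j x in
       ∑ℤ (λ x → D′ x ℤ.* D′ x) ℤ.≤ ∑ℤ (λ x → D x ℤ.* D x) ℤ.+ + (c * (N * B * (N * B))))
    good-step D with good-option D
    ... | j , 1≤wj , corr = j , 1≤wj , (begin
      ∑ℤ (λ x → (D x ℤ.+ e x) ℤ.* (D x ℤ.+ e x))
        ≡⟨ ∑ℤ-cong (λ x → binomial (D x) (e x)) ⟩
      ∑ℤ (λ x → (D x ℤ.* D x ℤ.+ (D x ℤ.* e x ℤ.+ D x ℤ.* e x)) ℤ.+ e x ℤ.* e x)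
        ≡⟨ ∑ℤ-distrib-+ (λ x → D x ℤ.* D x ℤ.+ (D x ℤ.* e x ℤ.+ D x ℤ.* e x)) (λ x → e x ℤ.* e x) ⟩
      ∑ℤ (λ x → D x ℤ.* D x ℤ.+ (D x ℤ.* e x ℤ.+ D x ℤ.* e x)) ℤ.+ ∑ℤ (λ x → e x ℤ.* e x)
        ≡⟨ cong (ℤ._+ ∑ℤ (λ x → e x ℤ.* e x)) (trans (∑ℤ-distrib-+ (λ x → D x ℤ.* D x) (λ x → D x ℤ.* e x ℤ.+ D x ℤ.* e x))
             (cong (ℤ._+_ (∑ℤ (λ x → D x ℤ.* D x))) (∑ℤ-distrib-+ (λ x → D x ℤ.* e x) (λ x → D x ℤ.* e x)))) ⟩
      (∑ℤ (λ x → D x ℤ.* D x) ℤ.+ (∑ℤ (λ x → D x ℤ.* e x) ℤ.+ ∑ℤ (λ x → D x ℤ.* e x))) ℤ.+ ∑ℤ (λ x → e x ℤ.* e x)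
        ≤⟨ ℤ.+-mono-≤ (ℤ.+-monoʳ-≤ (∑ℤ (λ x → D x ℤ.* D x)) (ℤ.+-mono-≤ corr corr)) (ℤ.≤-trans (∑ℤ-mono (deviation-square j))
             (ℤ.≤-reflexive (trans (∑ℤ-+ {c} (λ _ → N * B * (N * B))) (cong +_ (∑-const c _))))) ⟩
      (∑ℤ (λ x → D x ℤ.* D x) ℤ.+ 0ℤ) ℤ.+ + (c * (N * B * (N * B)))
        ≡⟨ cong (λ z → z ℤ.+ + (c * (N * B * (N * B)))) (ℤ.+-identityʳ (∑ℤ (λ x → D x ℤ.* D x))) ⟩
      ∑ℤ (λ x → D x ℤ.* D x) ℤ.+ + (c * (N * B * (N * B)))
        ∎)
      where
      open ℤ.≤-Reasoning
      e = deviation w v j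
      binomial : ∀ a b → (a ℤ.+ b) ℤ.* (a ℤ.+ b) ≡ (a ℤ.* a ℤ.+ (a ℤ.* b ℤ.+ a ℤ.* b)) ℤ.+ b ℤ.* b
      binomial = ℤ-Solver.solve-∀

  norm² : (Fin c → ℤ) → ℤ
  norm² D = ∑ℤ (λ x → D x ℤ.* D x)

  drift : ∀ {q} (w : Fin q → Fin o → ℕ) (v : Fin q → Fin o → Fin c → ℕ) (choice : Fin q → Fin o) → Fin c → ℤ
  drift w v choice x = ∑ℤ (λ i → deviation (w i) (v i) (choice i) x)

  norm²-cong : ∀ {D E : Fin c → ℤ} → (∀ x → D x ≡ E x) → norm² D ≡ norm² E
  norm²-cong eq = ∑ℤ-cong (λ x → cong₂ ℤ._*_ (eq x) (eq x))

  record Walk {q} (w : Fin q → Fin o → ℕ) (v : Fin q → Fin o → Fin c → ℕ) (D : Fin c → ℤ) : Set where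
    field
      choice   : Fin q → Fin o
      positive : ∀ i → 1 ≤ w i (choice i)
      bounded  : norm² (λ x → D x ℤ.+ drift w v choice x) ℤ.≤ norm² D ℤ.+ + (q * (c * (N * B * (N * B))))

  walk : ∀ {q} (w : Fin q → Fin o → ℕ) → (∀ i → ∑ (w i) ≡ N) →
         (v : Fin q → Fin o → Fin c → ℕ) → (∀ i j x → v i j x ≤ B) → ∀ D → Walk w v D
  walk {zero} w ∑w v v≤B D = record
    { choice   = λ ()
    ; positive = λ ()
    ; bounded  = ℤ.≤-reflexive (trans
        (norm²-cong (λ x → trans (cong (ℤ._+_ (D x)) (∑ℤ-empty _)) (ℤ.+-identityʳ (D x))))
        (sym (ℤ.+-identityʳ (norm² D))))
    }
  walk {suc q} w ∑w v v≤B D = record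
    { choice   = choice
    ; positive = positive
    ; bounded  = begin
        norm² (λ x → D x ℤ.+ drift w v choice x) ≡⟨ norm²-cong assoc ⟩
        norm² (λ x → E x ℤ.+ drift (w ∘ suc) (v ∘ suc) rest.choice x) ≤⟨ rest.bounded ⟩
        norm² E ℤ.+ + (q * K) ≤⟨ ℤ.+-monoˡ-≤ (+ (q * K)) (proj₂ (proj₂ first)) ⟩
        norm² D ℤ.+ + K ℤ.+ + (q * K) ≡⟨ ℤ.+-assoc (norm² D) (+ K) (+ (q * K)) ⟩
        norm² D ℤ.+ (+ K ℤ.+ + (q * K)) ≡⟨ cong (ℤ._+_ (norm² D)) (sym (ℤ.pos-+ K (q * K))) ⟩
        norm² D ℤ.+ + (suc q * K) ∎
    }
    where
    open ℤ.≤-Reasoning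
    K = c * (N * B * (N * B))
    first = good-step (w zero) (∑w zero) (v zero) (v≤B zero) D
    E : Fin c → ℤ
    E x = D x ℤ.+ deviation (w zero) (v zero) (proj₁ first) x
    module rest = Walk (walk (w ∘ suc) (∑w ∘ suc) (v ∘ suc) (v≤B ∘ suc) E)
    choice : Fin (suc q) → Fin o
    choice zero    = proj₁ first
    choice (suc i) = rest.choice i
    positive : ∀ i → 1 ≤ w i (choice i)
    positive zero    = proj₁ (proj₂ first)
    positive (suc i) = rest.positive i
    assoc : ∀ x → D x ℤ.+ drift w v choice x ≡ E x ℤ.+ drift (w ∘ suc) (v ∘ suc) rest.choice x
    assoc x = trans (cong (ℤ._+_ (D x)) (∑ℤ-suc (λ i → deviation (w i) (v i) (choice i) x)))
                    (sym (ℤ.+-assoc (D x) (deviation (w zero) (v zero) (proj₁ first) x) _))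

-- Second moment method: option j of item i is drawn with probability w i j / N, and
-- a² exceeds the sum of the variances of all loads.
rounding : ∀ {q o c} N B → 1 ≤ N → (w : Fin q → Fin o → ℕ) → (∀ i → ∑ (w i) ≡ N) →
           (v : Fin q → Fin o → Fin c → ℕ) → (∀ i j x → v i j x ≤ B) →
           ∀ a → q * (c * (B * B)) < a * a →
           Σ[ choice ∈ (Fin q → Fin o) ] (∀ i → 1 ≤ w i (choice i)) ×
           (∀ x → N * ∑ (λ i → v i (choice i) x) ≤ ∑ (λ i → ∑ (λ j → w i j * v i j x)) + N * a)
rounding {q} {o} {c} N B 1≤N w ∑w v v≤B a big =
  choice , positive , λ x → ≮⇒≥ (λ over → <⇒≱ big (contradiction x over))
  where
  open Walk (walk N B 1≤N w ∑w v v≤B (λ _ → 0ℤ)) renaming (bounded to total)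
  instance
    N≢0 : NonZero N
    N≢0 = >-nonZero 1≤N
    N²≢0 : NonZero (N * N)
    N²≢0 = m*n≢0 N N
  D : Fin c → ℤ
  D x = 0ℤ ℤ.+ ∑ℤ (λ i → deviation N B 1≤N (w i) (v i) (choice i) x)
  load m : Fin c → ℕ
  load x = ∑ (λ i → v i (choice i) x)
  m x = ∑ (λ i → ∑ (λ j → w i j * v i j x))
  D≡ : ∀ x → D x ≡ (N * load x) ⊖ m x
  D≡ x = trans (ℤ.+-identityˡ _) (trans (∑ℤ-⊖ (λ i → N * v i (choice i) x) (λ i → ∑ (λ j → w i j * v i j x)))
    (cong (_⊖ m x) (sym (*-distribˡ-∑ N (λ i → v i (choice i) x)))))
  norms : ∑ (λ x → ℤ.∣ D x ∣ * ℤ.∣ D x ∣) ≤ q * (c * (N * B * (N * B)))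
  norms = ℤ.drop‿+≤+ (ℤ.≤-trans (ℤ.≤-reflexive (trans (sym (∑ℤ-+ (λ x → ℤ.∣ D x ∣ * ℤ.∣ D x ∣))) (∑ℤ-cong (λ x → sym (square (D x))))))
    (ℤ.≤-trans total (ℤ.≤-reflexive (trans (cong (λ z → z ℤ.+ + (q * (c * (N * B * (N * B))))) (∑ℤ-zero {c} (λ _ → refl))) (ℤ.+-identityˡ (+ (q * (c * (N * B * (N * B))))))))))
  contradiction : ∀ x → m x + N * a < N * load x → a * a ≤ q * (c * (B * B))
  contradiction x over = *-cancelˡ-≤ (N * N) (begin
    N * N * (a * a) ≡⟨ shuffle N a ⟩
    N * a * (N * a) ≤⟨ *-mono-≤ large large ⟩
    ℤ.∣ D x ∣ * ℤ.∣ D x ∣ ≤⟨ term≤∑ (λ x → ℤ.∣ D x ∣ * ℤ.∣ D x ∣) x ⟩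
    ∑ (λ x → ℤ.∣ D x ∣ * ℤ.∣ D x ∣) ≤⟨ norms ⟩
    q * (c * (N * B * (N * B))) ≡⟨ shuffle′ q c N B ⟩
    N * N * (q * (c * (B * B))) ∎)
    where
    open ≤-Reasoning
    shuffle : ∀ n a → n * n * (a * a) ≡ n * a * (n * a)
    shuffle = solve-∀
    shuffle′ : ∀ q c n b → q * (c * (n * b * (n * b))) ≡ n * n * (q * (c * (b * b)))
    shuffle′ = solve-∀
    m≤Nload : m x ≤ N * load x
    m≤Nload = ≤-trans (m≤m+n (m x) (N * a)) (<⇒≤ over)
    large : N * a ≤ ℤ.∣ D x ∣
    large = begin
      N * a ≤⟨ m+n≤o⇒m≤o∸n (N * a) (≤-trans (≤-reflexive (+-comm (N * a) (m x))) (<⇒≤ over)) ⟩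
      N * load x ∸ m x ≡⟨ cong ℤ.∣_∣ (sym (trans (D≡ x) (ℤ.⊖-≥ m≤Nload))) ⟩
      ℤ.∣ D x ∣ ∎

module Assignments (em : ExcludedMiddle 0ℓ) where
  open Indicators em

  record Assignment {n n′ t : ℕ} (M : ℕ) (τ : Fin n → Fin t) (τ′ : Fin n′ → Fin t) : Set where
    field
      to       : Fin n′ → Maybe (Fin n)
      type     : ∀ {y x} → to y ≡ just x → τ x ≡ τ′ y
      capacity : ∀ x → # (λ y → to y ≡ just x) ≤ M
      unserved : ∀ i → # (λ y → τ′ y ≡ i × to y ≡ nothing) ≤ # (λ y → τ′ y ≡ i) ∸ M * # (λ x → τ x ≡ i)

  private
    #-suc : ∀ {n} (P : Fin (suc n) → Set) → # P ≡ χ (P zero) + # (P ∘ suc)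
    #-suc P = ∑-suc (λ i → χ (P i))

  module _ {n n′ t : ℕ} (M : ℕ) (τ : Fin n → Fin t) (τ′ : Fin (suc n′) → Fin t)
           (A : Assignment M τ (τ′ ∘ suc)) where
    private module A = Assignment A

    extend : Maybe (Fin n) → Fin (suc n′) → Maybe (Fin n)
    extend m zero    = m
    extend m (suc y) = A.to y

    unserved-other : ∀ m i → (τ′ zero ≡ i → m ≢ nothing) →
      # (λ y → τ′ y ≡ i × extend m y ≡ nothing) ≤ # (λ y → τ′ y ≡ i) ∸ M * # (λ x → τ x ≡ i)
    unserved-other m i served = begin
      # (λ y → τ′ y ≡ i × extend m y ≡ nothing) ≡⟨ #-suc (λ y → τ′ y ≡ i × extend m y ≡ nothing) ⟩
      χ (τ′ zero ≡ i × m ≡ nothing) + # (λ y → τ′ (suc y) ≡ i × A.to y ≡ nothing)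
                                                                       ≡⟨ cong (_+ # (λ y → τ′ (suc y) ≡ i × A.to y ≡ nothing)) (χ-false (λ (e , e′) → served e e′)) ⟩
      # (λ y → τ′ (suc y) ≡ i × A.to y ≡ nothing) ≤⟨ A.unserved i ⟩
      # (λ y → τ′ (suc y) ≡ i) ∸ M * # (λ x → τ x ≡ i) ≤⟨ ∸-monoˡ-≤ (M * # (λ x → τ x ≡ i)) (m≤n+m _ (χ (τ′ zero ≡ i))) ⟩
      χ (τ′ zero ≡ i) + # (λ y → τ′ (suc y) ≡ i) ∸ M * # (λ x → τ x ≡ i)
                                                                       ≡⟨ cong (_∸ M * # (λ x → τ x ≡ i)) (sym (#-suc (λ y → τ′ y ≡ i))) ⟩
      # (λ y → τ′ y ≡ i) ∸ M * # (λ x → τ x ≡ i) ∎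
      where open ≤-Reasoning

    assign : ∀ x → τ x ≡ τ′ zero → # (λ y → A.to y ≡ just x) < M → Assignment M τ τ′
    assign x τx≡ free = record
      { to       = extend (just x)
      ; type     = type
      ; capacity = capacity
      ; unserved = λ i → unserved-other (just x) i (λ _ ())
      }
      where
      type : ∀ {y z} → extend (just x) y ≡ just z → τ z ≡ τ′ y
      type {zero}  refl = τx≡
      type {suc y} e    = A.type e
      capacity : ∀ z → # (λ y → extend (just x) y ≡ just z) ≤ M
      capacity z rewrite #-suc (λ y → extend (just x) y ≡ just z) with em {x ≡ z}
      ... | yes refl rewrite χ-true {just x ≡ just x} refl = free
      ... | no x≢z   rewrite χ-false {just x ≡ just z} (x≢z ∘ just-injective) = A.capacity z

    skip : (∀ x → τ x ≡ τ′ zero → M ≤ # (λ y → A.to y ≡ just x)) → Assignment M τ τ′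
    skip full = record
      { to       = extend nothing
      ; type     = type
      ; capacity = capacity
      ; unserved = unserved
      }
      where
      type : ∀ {y z} → extend nothing y ≡ just z → τ z ≡ τ′ y
      type {suc y} e = A.type e
      capacity : ∀ z → # (λ y → extend nothing y ≡ just z) ≤ M
      capacity z rewrite #-suc (λ y → extend nothing y ≡ just z) | χ-false {nothing ≡ just z} (λ ()) = A.capacity z
      served : # (λ x → τ x ≡ τ′ zero) * M ≤ # (λ y → τ′ (suc y) ≡ τ′ zero × A.to y ≢ nothing)
      served = begin
        # (λ x → τ x ≡ τ′ zero) * M
          ≡⟨ *-distribʳ-∑ M (λ x → χ (τ x ≡ τ′ zero)) ⟩
        ∑ (λ x → χ (τ x ≡ τ′ zero) * M)
          ≤⟨ ∑-mono (λ x → χ*≤ (λ e → ≤-trans (full x e) (#-mono (λ y e′ → e , e′)))) ⟩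
        ∑ (λ x → # (λ y → τ x ≡ τ′ zero × A.to y ≡ just x))
          ≡⟨ ∑-comm (λ x y → χ (τ x ≡ τ′ zero × A.to y ≡ just x)) ⟩
        ∑ (λ y → # (λ x → τ x ≡ τ′ zero × A.to y ≡ just x))
          ≤⟨ ∑-mono (λ y → ≤-trans (#-unique (λ x x′ (_ , e) (_ , e′) → just-injective (trans (sym e) e′)))
               (χ-mono (λ (x , e , e′) → trans (sym (A.type e′)) e , λ e″ → just≢nothing (trans (sym e′) e″)))) ⟩
        # (λ y → τ′ (suc y) ≡ τ′ zero × A.to y ≢ nothing)
          ∎
        where
        open ≤-Reasoning
        just≢nothing : ∀ {x : Fin n} → just x ≢ nothing
        just≢nothing ()
      unserved : ∀ i → # (λ y → τ′ y ≡ i × extend nothing y ≡ nothing) ≤ # (λ y → τ′ y ≡ i) ∸ M * # (λ x → τ x ≡ i)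
      unserved i with em {τ′ zero ≡ i}
      ... | no ≢i = unserved-other nothing i (λ e → ⊥-elim (≢i e))
      ... | yes refl = m+n≤o⇒m≤o∸n _ (begin
        # (λ y → τ′ y ≡ i × extend nothing y ≡ nothing) + M * # (λ x → τ x ≡ i)
          ≤⟨ +-monoʳ-≤ _ (≤-trans (≤-reflexive (*-comm M (# (λ x → τ x ≡ i)))) (≤-trans served (≤-trans (m≤n+m _ 0) (m≤n+m _ _)))) ⟩
        # (λ y → τ′ y ≡ i × extend nothing y ≡ nothing) + (χ (τ′ zero ≡ i × nothing {A = Fin n} ≢ nothing) + # (λ y → τ′ (suc y) ≡ i × A.to y ≢ nothing))
          ≡⟨ cong (_+_ (# (λ y → τ′ y ≡ i × extend nothing y ≡ nothing))) (sym (#-suc (λ y → τ′ y ≡ i × extend nothing y ≢ nothing))) ⟩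
        # (λ y → τ′ y ≡ i × extend nothing y ≡ nothing) + # (λ y → τ′ y ≡ i × extend nothing y ≢ nothing)
          ≤⟨ #-split (λ y → proj₁) (λ y → proj₁) (λ y (_ , e) (_ , ¬e) → ¬e e) ⟩
        # (λ y → τ′ y ≡ i)
          ∎)
        where open ≤-Reasoning

  assignment : ∀ {n n′ t} M (τ : Fin n → Fin t) (τ′ : Fin n′ → Fin t) → Assignment M τ τ′
  assignment {n′ = zero} M τ τ′ = record
    { to       = λ _ → nothing
    ; type     = λ ()
    ; capacity = λ x → ≤-trans (≤-reflexive (∑-empty _)) z≤n
    ; unserved = λ i → ≤-trans (≤-reflexive (∑-empty _)) z≤n
    }
  assignment {n′ = suc n′} M τ τ′ with assignment M τ (τ′ ∘ suc)
  ... | A with em {∃[ x ] τ x ≡ τ′ zero × # (λ y → Assignment.to A y ≡ just x) < M}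
  ... | yes (x , e , free) = assign M τ τ′ A x e free
  ... | no none            = skip M τ τ′ A (λ x e → ≮⇒≥ (λ free → none (x , e , free)))

  ∑-types : ∀ {n t} (τ : Fin n → Fin t) (P : Fin n → Set) → ∑ (λ i → # (λ y → τ y ≡ i × P y)) ≡ # P
  ∑-types τ P = trans (∑-comm (λ i y → χ (τ y ≡ i × P y))) (∑-cong (λ y → begin
    ∑ (λ i → χ (τ y ≡ i × P y)) ≡⟨ ∑-cong (λ i → χ-× (τ y ≡ i) (P y)) ⟩
    ∑ (λ i → χ (τ y ≡ i) * χ (P y)) ≡⟨ sym (*-distribʳ-∑ (χ (P y)) (λ i → χ (τ y ≡ i))) ⟩
    # (τ y ≡_) * χ (P y) ≡⟨ cong (_* χ (P y)) (#-≡ (τ y)) ⟩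
    1 * χ (P y) ≡⟨ *-identityˡ (χ (P y)) ⟩
    χ (P y) ∎))
    where open ≡-Reasoning

  unused-value : ∀ {m} (ι : Fin m → Maybe (Fin m)) → (∀ {y y′ x} → ι y ≡ just x → ι y′ ≡ just x → y ≡ y′) →
                 ∀ {y} → ι y ≡ nothing → ∃[ x ] ∀ y → ι y ≢ just x
  unused-value {m} ι inj {y₀} undefined with em {∃[ x ] ∀ y → ι y ≢ just x}
  ... | yes found = found
  ... | no none   = ⊥-elim (<-irrefl refl (begin
    suc m ≤⟨ +-mono-≤ (#-witness {P = λ y → ι y ≡ nothing} y₀ undefined)
                                                   (≤-reflexive (sym (#-all {P = λ x → ∃[ y ] ι y ≡ just x} used))) ⟩
    # (λ y → ι y ≡ nothing) + # (λ x → ∃[ y ] ι y ≡ just x)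
                                              ≤⟨ +-monoʳ-≤ (# (λ y → ι y ≡ nothing)) (#-injection {Q = λ y → ∃[ x ] ι y ≡ just x}
                                                   (λ x → proj₁) (λ x (y , e) → x , e)
                                                   (λ { x x′ (y , e) (.y , e′) refl → just-injective (trans (sym e) e′) })) ⟩
    # (λ y → ι y ≡ nothing) + # (λ y → ∃[ x ] ι y ≡ just x)
                                              ≤⟨ #-split {P = λ _ → Fin m} (λ y _ → y) (λ y _ → y) (λ y e (x , e′) → nothing≢just (trans (sym e) e′)) ⟩
    # {m} (λ _ → Fin m) ≤⟨ #≤n _ ⟩
    m ∎))
    where
    open ≤-Reasoning
    nothing≢just : ∀ {x : Fin m} → nothing ≢ just x
    nothing≢just ()
    used : ∀ x → ∃[ y ] ι y ≡ just x
    used x with em {∃[ y ] ι y ≡ just x}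
    ... | yes y = y
    ... | no ¬y = ⊥-elim (none (x , λ y e → ¬y (y , e)))

  total-injection : ∀ {m} (σ : Fin m → Fin m) → (∀ {y y′} → σ y ≡ σ y′ → y ≡ y′) →
                    Σ[ π ∈ Fin m ↔ Fin m ] ∀ y → Inverse.to π y ≡ σ y
  total-injection {m} σ inj = mk↔ₛ′ σ (proj₁ ∘ preimage) (proj₂ ∘ preimage) (λ y → inj (proj₂ (preimage (σ y)))) , λ _ → refl
    where
    preimage : ∀ x → ∃[ y ] σ y ≡ x
    preimage x with em {∃[ y ] σ y ≡ x}
    ... | yes y = y
    ... | no ¬y = ⊥-elim (<-irrefl refl (begin
      suc m ≤⟨ ≤-reflexive (cong₂ _+_ (sym (#-≡ x)) (sym (#-all {P = λ _ → Fin m} (λ y → y)))) ⟩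
      # (x ≡_) + # {m} (λ _ → Fin m) ≤⟨ +-monoʳ-≤ (# (x ≡_)) (#-injection {Q = x ≢_} (λ y _ → σ y) (λ y _ e → ¬y (y , sym e)) (λ y y′ _ _ → inj)) ⟩
      # (x ≡_) + # (x ≢_) ≤⟨ #-split {P = λ _ → Fin m} (λ y _ → y) (λ y _ → y) (λ y e ¬e → ¬e e) ⟩
      # {m} (λ _ → Fin m) ≤⟨ #≤n _ ⟩
      m ∎))
      where open ≤-Reasoning

  extend-injection : ∀ {m} k (ι : Fin m → Maybe (Fin m)) → # (λ y → ι y ≡ nothing) ≤ k →
                     (∀ {y y′ x} → ι y ≡ just x → ι y′ ≡ just x → y ≡ y′) →
                     Σ[ π ∈ Fin m ↔ Fin m ] ∀ {y x} → ι y ≡ just x → Inverse.to π y ≡ x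
  extend-injection {m} k ι ≤k inj with em {∃[ y ] ι y ≡ nothing}
  ... | no total = proj₁ π , λ {y} {x} e → trans (proj₂ π y) (just-injective (trans (sym (proj₂ (defined y))) e))
    where
    defined : ∀ y → ∃[ x ] ι y ≡ just x
    defined y with ι y in eq
    ... | just x  = x , refl
    ... | nothing = ⊥-elim (total (y , eq))
    π = total-injection (proj₁ ∘ defined) (λ {y} {y′} e → inj (proj₂ (defined y)) (trans (proj₂ (defined y′)) (cong just (sym e))))
  extend-injection {m} zero    ι ≤k inj | yes (y₀ , e₀) = ⊥-elim (<⇒≱ (#-witness {P = λ y → ι y ≡ nothing} y₀ e₀) ≤k)
  extend-injection {m} (suc k) ι ≤k inj | yes (y₀ , e₀) =
    proj₁ rec , λ {y} {x} e → proj₂ rec (trans (ι′-old y (λ { refl → nothing≢just (trans (sym e₀) e) })) e)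
    where
    x₀ = proj₁ (unused-value ι inj e₀)
    unused = proj₂ (unused-value ι inj e₀)
    nothing≢just : ∀ {x : Fin m} → nothing ≢ just x
    nothing≢just ()
    ι′ : Fin m → Maybe (Fin m)
    ι′ y with y Fin.≟ y₀
    ... | yes _ = just x₀
    ... | no _  = ι y
    ι′-new : ι′ y₀ ≡ just x₀
    ι′-new with y₀ Fin.≟ y₀
    ... | yes _ = refl
    ... | no ¬e = ⊥-elim (¬e refl)
    ι′-old : ∀ y → y ≢ y₀ → ι′ y ≡ ι y
    ι′-old y y≢ with y Fin.≟ y₀
    ... | yes e = ⊥-elim (y≢ e)
    ... | no _  = refl
    inj′ : ∀ {y y′ x} → ι′ y ≡ just x → ι′ y′ ≡ just x → y ≡ y′
    inj′ {y} {y′} e e′ with y Fin.≟ y₀ | y′ Fin.≟ y₀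
    ... | yes refl | yes refl = refl
    ... | yes refl | no _     = ⊥-elim (unused y′ (trans e′ (sym e)))
    ... | no _     | yes refl = ⊥-elim (unused y (trans e (sym e′)))
    ... | no _     | no _     = inj e e′
    fewer : # (λ y → ι′ y ≡ nothing) ≤ k
    fewer = ≤-pred (≤-trans (≤-trans
      (≤-reflexive (cong (_+ # (λ y → ι′ y ≡ nothing)) (sym (#-≡ y₀))))
      (#-split (λ y → λ { refl → e₀ }) (λ y e → trans (sym (ι′-old y (λ { refl → nothing≢just (trans (sym e) ι′-new) }))) e)
        (λ y → λ { refl e → nothing≢just (trans (sym e) ι′-new) }))) ≤k)
    rec = extend-injection k ι′ fewer inj′

to-injective : ∀ {A B : Set} (π : A ↔ B) {x y} → Inverse.to π x ≡ Inverse.to π y → x ≡ y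
to-injective π {x} {y} e = trans (sym (Inverse.strictlyInverseʳ π x)) (trans (cong (Inverse.from π) e) (Inverse.strictlyInverseʳ π y))

pullback : ∀ {V W : Set} → (V → W) → SimpleGraph W → SimpleGraph V
pullback f G .adj u v         = adj G (f u) (f v)
pullback f G .symmetric u v   = symmetric G (f u) (f v)
pullback f G .irreflexive v   = irreflexive G (f v)

pullback-≅ : ∀ {V W : Set} (π : V ↔ W) (G : SimpleGraph W) → pullback (Inverse.to π) G ≅ G
pullback-≅ π G .bijection     = π
pullback-≅ π G .preserves u v = refl

≅-trans : ∀ {U V W : Set} {G : SimpleGraph U} {H : SimpleGraph V} {K : SimpleGraph W} → G ≅ H → H ≅ K → G ≅ K
≅-trans φ ψ .bijection     = ↔-trans (bijection φ) (bijection ψ)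
≅-trans φ ψ .preserves u v = trans (preserves ψ _ _) (preserves φ u v)

≅-sym : ∀ {V W : Set} {G : SimpleGraph V} {H : SimpleGraph W} → G ≅ H → H ≅ G
≅-sym {G = G} {H} φ .bijection     = ↔-sym (bijection φ)
≅-sym {G = G} {H} φ .preserves u v = trans (sym (preserves φ _ _))
  (cong₂ (adj H) (Inverse.strictlyInverseˡ (bijection φ) u) (Inverse.strictlyInverseˡ (bijection φ) v))

edgeless-graph : {V : Set} → SimpleGraph V
edgeless-graph .adj _ _         = false
edgeless-graph .symmetric _ _   = refl
edgeless-graph .irreflexive _   = refl

no-pairs : ∀ {n} (R : Fin n → Fin n → Bool) → (∀ u v → ¬ T (R u v)) → countPairs R ≡ 0
no-pairs {n} R none = cong length (filter-none
  (λ (u , v) → (u Fin.<? v) ×-dec T? (R u v))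
  (universal (λ (u , v) (_ , e) → none u v e) (cartesianProduct (allFin n) (allFin n))))

module _ {n : ℕ} (H : SimpleGraph (Fin n)) where

  CopyVertex : ℕ → ℕ → Set
  CopyVertex zero    r = Fin r
  CopyVertex (suc m) r = Fin n ⊎ CopyVertex m r

  copies : ∀ m r → SimpleGraph (CopyVertex m r)
  copies zero    r = edgeless-graph
  copies (suc m) r = H ⊎ᴳ copies m r

  copies-order : ℕ → ℕ → ℕ
  copies-order zero    r = r
  copies-order (suc m) r = n + copies-order m r

  copies-order-≡ : ∀ m r → copies-order m r ≡ m * n + r
  copies-order-≡ zero    r = refl
  copies-order-≡ (suc m) r = trans (cong (_+_ n) (copies-order-≡ m r)) (sym (+-assoc n (m * n) r))

  copies-order-nonZero : ∀ m r .{{_ : NonZero r}} → NonZero (copies-order m r)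
  copies-order-nonZero m r = >-nonZero (<-≤-trans (>-nonZero⁻¹ r) (≤-trans (m≤n+m r (m * n)) (≤-reflexive (sym (copies-order-≡ m r)))))

  enumerate : ∀ m r → Fin (copies-order m r) ↔ CopyVertex m r
  enumerate zero    r = ↔-refl
  enumerate (suc m) r = ↔-trans Fin.+↔⊎ (↔-refl ⊎-↔ enumerate m r)

  copy : ∀ {m r} → Fin m → Fin n → CopyVertex m r
  copy zero    x = inj₁ x
  copy (suc i) x = inj₂ (copy i x)

  copy-injective : ∀ {m r} (i j : Fin m) {x y} → copy {r = r} i x ≡ copy j y → (i , x) ≡ (j , y)
  copy-injective zero    zero    e = cong (zero ,_) (inj₁-injective e)
  copy-injective (suc i) (suc j) e with refl ← copy-injective i j (inj₂-injective e) = refl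

  copy-adj : ∀ {m r} (i : Fin m) x y → adj (copies m r) (copy i x) (copy i y) ≡ adj H x y
  copy-adj zero    x y = refl
  copy-adj (suc i) x y = copy-adj i x y

  module _ {d : ℕ} {P : Pred FinGraph 0ℓ} (monotone-P : IsUnionClosedMonotone d P) .{{_ : NonZero n}} (PH : P ⟨ H ⟩) where
    open IsUnionClosedMonotone monotone-P

    copies-member : ∀ m r .{{_ : NonZero r}} (C : FinGraph) → graph C ≅ copies m r → P C
    copies-member zero    r C φ = edgeless C (no-pairs (adj (graph C)) (λ u v e → subst T (sym (preserves φ u v)) e))
    copies-member (suc m) r C φ = union {⟨ H ⟩} {rest} PH (copies-member m r rest rest-≅) C (≅-trans φ split)
      where
      rest : FinGraph
      rest = ⟨_⟩ {{copies-order-nonZero m r}} (pullback (Inverse.to (enumerate m r)) (copies m r))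
      rest-≅ : graph rest ≅ copies m r
      rest-≅ = pullback-≅ (enumerate m r) (copies m r)
      split : (H ⊎ᴳ copies m r) ≅ (H ⊎ᴳ graph rest)
      split .bijection = ↔-refl ⊎-↔ ↔-sym (enumerate m r)
      split .preserves (inj₁ u) (inj₁ v) = refl
      split .preserves (inj₁ u) (inj₂ v) = refl
      split .preserves (inj₂ u) (inj₁ v) = refl
      split .preserves (inj₂ u) (inj₂ v) = preserves (≅-sym rest-≅) u v

    embedded-member : (em : ExcludedMiddle 0ℓ) → ∀ {n′} m → m * n < n′ → .{{_ : NonZero n′}} →
      (A : SimpleGraph (Fin n′)) (ι : Fin n′ → Maybe (Fin m × Fin n)) →
      (∀ {y y′ p} → ι y ≡ just p → ι y′ ≡ just p → y ≡ y′) →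
      (∀ y y′ → T (adj A y y′) → ∃[ i ] ∃[ x ] ∃[ x′ ] ι y ≡ just (i , x) × ι y′ ≡ just (i , x′) × T (adj H x x′)) →
      P ⟨ A ⟩
    embedded-member em {n′} m mn<n′ = go (trans (copies-order-≡ m r) (m+[n∸m]≡n (<⇒≤ mn<n′)))
      where
      r = n′ ∸ m * n
      instance
        r≢0 : NonZero r
        r≢0 = >-nonZero (m<n⇒0<n∸m mn<n′)
      go : ∀ {k} → copies-order m r ≡ k → .{{_ : NonZero k}} →
        (A : SimpleGraph (Fin k)) (ι : Fin k → Maybe (Fin m × Fin n)) →
        (∀ {y y′ p} → ι y ≡ just p → ι y′ ≡ just p → y ≡ y′) →
        (∀ y y′ → T (adj A y y′) → ∃[ i ] ∃[ x ] ∃[ x′ ] ι y ≡ just (i , x) × ι y′ ≡ just (i , x′) × T (adj H x x′)) →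
        P ⟨ A ⟩
      go refl A ι inj edges = monotone {A = C} {B = A} A⊆C (copies-member m r ⟨ C ⟩ (pullback-≅ ρ (copies m r)))
        where
        π = enumerate m r
        place : Fin m × Fin n → Fin (copies-order m r)
        place (i , x) = Inverse.from π (copy i x)
        place-injective : ∀ {p q} → place p ≡ place q → p ≡ q
        place-injective {i , x} {j , y} e = copy-injective i j (to-injective (↔-sym π) e)
        ι′ : Fin (copies-order m r) → Maybe (Fin (copies-order m r))
        ι′ y = Maybe.map place (ι y)
        inj′ : ∀ {y y′ x} → ι′ y ≡ just x → ι′ y′ ≡ just x → y ≡ y′
        inj′ {y} {y′} e e′ with ι y in eq | ι y′ in eq′
        ... | just p | just q = inj eq (trans eq′ (cong just (place-injective (trans (just-injective e′) (sym (just-injective e))))))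
        σ = Assignments.extend-injection em _ ι′ ≤-refl inj′
        ρ : Fin (copies-order m r) ↔ CopyVertex m r
        ρ = ↔-trans (proj₁ σ) π
        C : SimpleGraph (Fin (copies-order m r))
        C = pullback (Inverse.to ρ) (copies m r)
        located : ∀ {y i x} → ι y ≡ just (i , x) → Inverse.to ρ y ≡ copy i x
        located {y} {i} {x} e = trans (cong (Inverse.to π) (proj₂ σ (cong (Maybe.map place) e))) (Inverse.strictlyInverseˡ π (copy i x))
        A⊆C : A ⊆ C
        A⊆C y y′ e with edges y y′ e
        ... | i , x , x′ , e₁ , e₂ , h = subst T (sym (trans (cong₂ (adj (copies m r)) (located e₁) (located e₂)) (copy-adj i x x′))) h

module Pairs (em : ExcludedMiddle 0ℓ) where
  open Indicators em

  length-filter-product : ∀ {m n} {A B : Set} (P : A × B → Set) (P? : ∀ p → Dec (P p)) (f : Fin m → A) (g : Fin n → B) →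
    length (filter P? (cartesianProduct (tabulate f) (tabulate g))) ≡ ∑ (λ i → # (λ j → P (f i , g j)))
  length-filter-product {zero}  P P? f g = sym (∑-empty (λ i → # (λ j → P (f i , g j))))
  length-filter-product {suc m} P P? f g = begin
    length (filter P? (map (f zero ,_) ys ++ rest)) ≡⟨ cong length (filter-++ P? (map (f zero ,_) ys) rest) ⟩
    length (filter P? (map (f zero ,_) ys) ++ filter P? rest) ≡⟨ length-++ (filter P? (map (f zero ,_) ys)) ⟩
    length (filter P? (map (f zero ,_) ys)) + length (filter P? rest) ≡⟨ cong₂ _+_
      (trans (cong (length ∘ filter P?) (map-tabulate g (f zero ,_))) (length-filter-tabulate P P? (λ j → f zero , g j)))
      (length-filter-product P P? (f ∘ suc) g) ⟩
    # (λ j → P (f zero , g j)) + ∑ (λ i → # (λ j → P (f (suc i) , g j))) ≡⟨ sym (∑-suc (λ i → # (λ j → P (f i , g j)))) ⟩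
    ∑ (λ i → # (λ j → P (f i , g j))) ∎
    where
    open ≡-Reasoning
    ys = tabulate g
    rest = cartesianProduct (tabulate (f ∘ suc)) ys

  countPairs≡ : ∀ {n} (R : Fin n → Fin n → Bool) → countPairs R ≡ ∑ (λ u → # (λ v → u Fin.< v × T (R u v)))
  countPairs≡ R = length-filter-product (λ (u , v) → u Fin.< v × T (R u v))
    (λ (u , v) → (u Fin.<? v) ×-dec T? (R u v)) (λ i → i) (λ i → i)

  double-countPairs : ∀ {n} (R : Fin n → Fin n → Bool) → (∀ u v → R u v ≡ R v u) → (∀ v → R v v ≡ false) →
                      countPairs R + countPairs R ≡ ∑ (λ u → # (λ v → T (R u v)))
  double-countPairs R R-sym R-irrefl = begin
    countPairs R + countPairs R
      ≡⟨ cong₂ _+_ (countPairs≡ R) (trans (countPairs≡ R) (trans (∑-comm (λ u v → χ (u Fin.< v × T (R u v))))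
           (∑-cong (λ v → ∑-cong (λ u → χ-cong (λ (l , r) → l , subst T (R-sym u v) r) (λ (l , r) → l , subst T (R-sym v u) r)))))) ⟩
    ∑ (λ u → # (λ v → u Fin.< v × T (R u v))) + ∑ (λ u → # (λ v → v Fin.< u × T (R u v)))
      ≡⟨ sym (∑-distrib-+ (λ u → # (λ v → u Fin.< v × T (R u v))) (λ u → # (λ v → v Fin.< u × T (R u v)))) ⟩
    ∑ (λ u → # (λ v → u Fin.< v × T (R u v)) + # (λ v → v Fin.< u × T (R u v)))
      ≡⟨ ∑-cong (λ u → ≤-antisym
           (#-split (λ v → proj₂) (λ v → proj₂) (λ v (u<v , _) (v<u , _) → Fin.<-asym u<v v<u))
           (#-∪ (λ v r → orient u v r))) ⟩
    ∑ (λ u → # (λ v → T (R u v)))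
      ∎
    where
    open ≡-Reasoning
    orient : ∀ u v → T (R u v) → (u Fin.< v × T (R u v)) ⊎ (v Fin.< u × T (R u v))
    orient u v r with Fin.<-cmp u v
    ... | tri< u<v _ _  = inj₁ (u<v , r)
    ... | tri≈ _ refl _ = ⊥-elim (subst T (R-irrefl u) r)
    ... | tri> _ _ v<u  = inj₂ (v<u , r)

  double-△ : ∀ {n} (G H : SimpleGraph (Fin n)) →
             ∣E G △E H ∣ + ∣E G △E H ∣ ≡ ∑ (λ u → # (λ v → T (adj G u v xor adj H u v)))
  double-△ G H = double-countPairs (λ u v → adj G u v xor adj H u v)
    (λ u v → cong₂ _xor_ (symmetric G u v) (symmetric H u v)) (λ v → cong₂ _xor_ (irreflexive G v) (irreflexive H v))

-- The functions are arbitrary outside the balls of radius ρ.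
record LocalIso {V W : Set} (ρ : ℕ) (G : SimpleGraph V) (x : V) (H : SimpleGraph W) (y : W) : Set where
  field
    to        : V → W
    from      : W → V
    to-root   : to x ≡ y
    to-ball   : ∀ {u} → Within G ρ x u → Within H ρ y (to u)
    from-ball : ∀ {v} → Within H ρ y v → Within G ρ x (from v)
    from-to   : ∀ {u} → Within G ρ x u → from (to u) ≡ u
    to-from   : ∀ {v} → Within H ρ y v → to (from v) ≡ v
    to-adj    : ∀ {u u′} → Within G ρ x u → Within G ρ x u′ → adj H (to u) (to u′) ≡ adj G u u′

module _ {V W : Set} {ρ : ℕ} {G : SimpleGraph V} {x : V} {H : SimpleGraph W} {y : W} where

  flip : LocalIso ρ G x H y → LocalIso ρ H y G x
  flip φ = record
    { to        = from
    ; from      = to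
    ; to-root   = trans (cong from (sym to-root)) (from-to here)
    ; to-ball   = from-ball
    ; from-ball = to-ball
    ; from-to   = to-from
    ; to-from   = from-to
    ; to-adj    = λ b b′ → trans (sym (to-adj (from-ball b) (from-ball b′))) (cong₂ (adj H) (to-from b) (to-from b′))
    }
    where open LocalIso φ

  module _ (φ : LocalIso ρ G x H y) where
    open LocalIso φ

    to-injective-on-ball : ∀ {u u′} → Within G ρ x u → Within G ρ x u′ → to u ≡ to u′ → u ≡ u′
    to-injective-on-ball b b′ e = trans (sym (from-to b)) (trans (cong from e) (from-to b′))

    to-walk : ∀ {r s u v} → s + r ≤ ρ → Within G s x u → Within G r u v → Within H r (to u) (to v)
    to-walk s+r≤ρ b here = here
    to-walk {suc r} {s} s+r≤ρ b (step e p) = step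
      (subst T (sym (to-adj (Within-mono (≤-trans (m≤m+n s (suc r)) s+r≤ρ) b) (Within-mono (≤-trans (m≤m+n (suc s) r) 1+s+r≤ρ) (Within-step b e)))) e)
      (to-walk 1+s+r≤ρ (Within-step b e) p)
      where
      1+s+r≤ρ : suc s + r ≤ ρ
      1+s+r≤ρ = ≤-trans (≤-reflexive (sym (+-suc s r))) s+r≤ρ

    to-root-walk : ∀ {r v} → r ≤ ρ → Within G r v x → Within H r (to v) y
    to-root-walk r≤ρ p = Within-sym (subst (λ w → Within H _ w _) to-root (to-walk r≤ρ (here {r = 0}) (Within-sym p)))

module BallSizes (em : ExcludedMiddle 0ℓ) where
  open Indicators em

  ball-size-≤ : ∀ {n n′ ρ r s} {G : SimpleGraph (Fin n)} {x} {H : SimpleGraph (Fin n′)} {y} →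
                (φ : LocalIso ρ G x H y) → s + r ≤ ρ → ∀ {u} → Within G s x u →
                # (Within G r u) ≤ # (Within H r (LocalIso.to φ u))
  ball-size-≤ {r = r} {s} φ s+r≤ρ {u} b = #-injection (λ v _ → to v) (λ v p → to-walk φ s+r≤ρ b p)
    (λ v v′ p p′ → to-injective-on-ball φ (Within-mono s+r≤ρ (Within-trans b p)) (Within-mono s+r≤ρ (Within-trans b p′)))
    where open LocalIso φ

Σ< : ℕ → (ℕ → ℕ) → ℕ
Σ< zero    g = 0
Σ< (suc s) g = Σ< s g + g s

Σ<-mono : ∀ s {g h : ℕ → ℕ} → (∀ r → r < s → g r ≤ h r) → Σ< s g ≤ Σ< s h
Σ<-mono zero    g≤h = z≤n
Σ<-mono (suc s) g≤h = +-mono-≤ (Σ<-mono s (λ r r<s → g≤h r (m<n⇒m<1+n r<s))) (g≤h s ≤-refl)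

*-distribˡ-Σ< : ∀ s c g → c * Σ< s g ≡ Σ< s (λ r → c * g r)
*-distribˡ-Σ< zero    c g = *-zeroʳ c
*-distribˡ-Σ< (suc s) c g = trans (*-distribˡ-+ c (Σ< s g) (g s)) (cong (_+ c * g s) (*-distribˡ-Σ< s c g))

Σ<-shift : ∀ s k g → Σ< s (λ r → g (r + k)) ≤ Σ< (s + k) g
Σ<-shift zero    k g = z≤n
Σ<-shift (suc s) k g = +-monoˡ-≤ (g (s + k)) (Σ<-shift s k g)

Σ<-tail : ∀ s k g → Σ< (k + s) g ≡ Σ< s g + Σ< k (λ r → g (r + s))
Σ<-tail s zero    g = sym (+-identityʳ _)
Σ<-tail s (suc k) g = trans (cong (_+ g (k + s)) (Σ<-tail s k g)) (+-assoc (Σ< s g) _ _)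

Σ<-≤-const : ∀ k {g c} → (∀ r → g r ≤ c) → Σ< k g ≤ k * c
Σ<-≤-const zero    g≤c = z≤n
Σ<-≤-const (suc k) {g} {c} g≤c = ≤-trans (+-mono-≤ (Σ<-≤-const k g≤c) (g≤c k)) (≤-reflexive (+-comm (k * c) c))

∑-Σ<-comm : ∀ {n} s (g : Fin n → ℕ → ℕ) → ∑ (λ i → Σ< s (g i)) ≡ Σ< s (λ r → ∑ (λ i → g i r))
∑-Σ<-comm zero    g = ∑-zero (λ i → refl)
∑-Σ<-comm (suc s) g = trans (∑-distrib-+ (λ i → Σ< s (g i)) (λ i → g i s)) (cong (_+ ∑ (λ i → g i s)) (∑-Σ<-comm s g))

common-multiple : ∀ {n} (g : Fin n → ℕ) → (∀ i → 1 ≤ g i) → ∃[ N ] 1 ≤ N × ∀ i → ∃[ κ ] κ * g i ≡ N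
common-multiple {zero}  g 1≤g = 1 , ≤-refl , λ ()
common-multiple {suc n} g 1≤g with common-multiple (g ∘ suc) (1≤g ∘ suc)
... | N , 1≤N , κ = g zero * N , *-mono-≤ (1≤g zero) 1≤N , λ where
  zero    → N , *-comm N (g zero)
  (suc i) → g zero * proj₁ (κ i) , trans (*-assoc (g zero) _ _) (cong (g zero *_) (proj₂ (κ i)))

converse-bernoulli : ∀ A m → suc A ^ m * suc A ≤ A ^ m * suc A + m * suc A ^ m
converse-bernoulli A zero    = ≤-reflexive (sym (+-identityʳ (1 * suc A)))
converse-bernoulli A (suc m) = begin
  suc A ^ suc m * suc A ≡⟨ *-assoc (suc A) (suc A ^ m) (suc A) ⟩
  suc A * (suc A ^ m * suc A) ≤⟨ *-monoʳ-≤ (suc A) (converse-bernoulli A m) ⟩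
  suc A * (A ^ m * suc A + m * suc A ^ m) ≡⟨ split A (A ^ m) m (suc A ^ m) ⟩
  A ^ suc m * suc A + (suc A * A ^ m + m * suc A ^ suc m) ≤⟨ +-monoʳ-≤ (A ^ suc m * suc A) (+-monoˡ-≤ (m * suc A ^ suc m) (*-monoʳ-≤ (suc A) (^-monoˡ-≤ m (n≤1+n A)))) ⟩
  A ^ suc m * suc A + suc m * suc A ^ suc m ∎
  where
  open ≤-Reasoning
  split : ∀ A x m y → (1 + A) * (x * (1 + A) + m * y) ≡ A * x * (1 + A) + ((1 + A) * x + m * ((1 + A) * y))
  split = solve-∀

module Kernels (em : ExcludedMiddle 0ℓ) (A K R : ℕ) where
  open Indicators em
  open BallSizes em

  range : ℕ
  range = R + K + K

  -- Geometric weights of ratio A / (A + 1), scaled to be integers.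
  weight : ℕ → ℕ
  weight r = A ^ r * suc A ^ (range ∸ r)

  weight-shift : ∀ r → r + K ≤ range → suc A ^ K * weight (r + K) ≡ A ^ K * weight r
  weight-shift r r+K≤ = begin
    suc A ^ K * (A ^ (r + K) * suc A ^ (range ∸ (r + K))) ≡⟨ cong (λ z → suc A ^ K * (z * suc A ^ (range ∸ (r + K)))) (^-distribˡ-+-* A r K) ⟩
    suc A ^ K * (A ^ r * A ^ K * suc A ^ (range ∸ (r + K))) ≡⟨ shuffle (suc A ^ K) (A ^ r) (A ^ K) (suc A ^ (range ∸ (r + K))) ⟩
    A ^ K * (A ^ r * (suc A ^ K * suc A ^ (range ∸ (r + K)))) ≡⟨ cong (λ z → A ^ K * (A ^ r * z)) (sym (^-distribˡ-+-* (suc A) K (range ∸ (r + K)))) ⟩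
    A ^ K * (A ^ r * suc A ^ (K + (range ∸ (r + K)))) ≡⟨ cong (λ z → A ^ K * (A ^ r * suc A ^ z)) exponent ⟩
    A ^ K * (A ^ r * suc A ^ (range ∸ r)) ∎
    where
    open ≡-Reasoning
    shuffle : ∀ a b c d → a * (b * c * d) ≡ c * (b * (a * d))
    shuffle = solve-∀
    exponent : K + (range ∸ (r + K)) ≡ range ∸ r
    exponent = trans (cong (_+_ K) (sym (∸-+-assoc range r K))) (m+[n∸m]≡n (m+n≤o⇒m≤o∸n K (≤-trans (≤-reflexive (+-comm K r)) r+K≤)))

  module _ {n} (G : SimpleGraph (Fin n)) where

    W : ℕ → Fin n → Fin n → ℕ
    W s u z = Σ< s (λ r → weight r * χ (Within G r u z))

    Z : ℕ → Fin n → ℕ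
    Z s u = Σ< s (λ r → weight r * # (Within G r u))

    ∑W≡Z : ∀ s u → ∑ (W s u) ≡ Z s u
    ∑W≡Z s u = trans (∑-Σ<-comm s (λ z r → weight r * χ (Within G r u z)))
      (Σ<-cong s (λ r → sym (*-distribˡ-∑ (weight r) (λ z → χ (Within G r u z)))))
      where
      Σ<-cong : ∀ s {g h : ℕ → ℕ} → (∀ r → g r ≡ h r) → Σ< s g ≡ Σ< s h
      Σ<-cong zero    g≡h = refl
      Σ<-cong (suc s) g≡h = cong₂ _+_ (Σ<-cong s g≡h) (g≡h s)

    W-shift : ∀ {s u v} → s + K ≤ range → Within G K u v → ∀ z → A ^ K * W s u z ≤ suc A ^ K * W (s + K) v z
    W-shift {s} {u} {v} s+K≤ uv z = begin
      A ^ K * W s u z ≡⟨ *-distribˡ-Σ< s (A ^ K) (λ r → weight r * χ (Within G r u z)) ⟩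
      Σ< s (λ r → A ^ K * (weight r * χ (Within G r u z))) ≤⟨ Σ<-mono s term ⟩
      Σ< s (λ r → suc A ^ K * (weight (r + K) * χ (Within G (r + K) v z))) ≤⟨ Σ<-shift s K (λ r → suc A ^ K * (weight r * χ (Within G r v z))) ⟩
      Σ< (s + K) (λ r → suc A ^ K * (weight r * χ (Within G r v z))) ≡⟨ sym (*-distribˡ-Σ< (s + K) (suc A ^ K) (λ r → weight r * χ (Within G r v z))) ⟩
      suc A ^ K * W (s + K) v z ∎
      where
      open ≤-Reasoning
      term : ∀ r → r < s → A ^ K * (weight r * χ (Within G r u z)) ≤ suc A ^ K * (weight (r + K) * χ (Within G (r + K) v z))
      term r r<s = begin
        A ^ K * (weight r * χ (Within G r u z)) ≡⟨ sym (*-assoc (A ^ K) (weight r) _) ⟩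
        A ^ K * weight r * χ (Within G r u z) ≡⟨ cong (_* χ (Within G r u z)) (sym (weight-shift r (≤-trans (+-monoˡ-≤ K (<⇒≤ r<s)) s+K≤))) ⟩
        suc A ^ K * weight (r + K) * χ (Within G r u z) ≤⟨ *-monoʳ-≤ (suc A ^ K * weight (r + K)) (χ-mono (λ uz →
                                                                        Within-mono (≤-reflexive (+-comm K r)) (Within-trans (Within-sym uv) uz))) ⟩
        suc A ^ K * weight (r + K) * χ (Within G (r + K) v z) ≡⟨ *-assoc (suc A ^ K) (weight (r + K)) _ ⟩
        suc A ^ K * (weight (r + K) * χ (Within G (r + K) v z)) ∎

    Z-shift : ∀ {s u v} → s + K ≤ range → Within G K u v → A ^ K * Z s u ≤ suc A ^ K * Z (s + K) v
    Z-shift {s} {u} {v} s+K≤ uv = begin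
      A ^ K * Z s u ≡⟨ cong (A ^ K *_) (sym (∑W≡Z s u)) ⟩
      A ^ K * ∑ (W s u) ≡⟨ *-distribˡ-∑ (A ^ K) (W s u) ⟩
      ∑ (λ z → A ^ K * W s u z) ≤⟨ ∑-mono (W-shift s+K≤ uv) ⟩
      ∑ (λ z → suc A ^ K * W (s + K) v z) ≡⟨ sym (*-distribˡ-∑ (suc A ^ K) (W (s + K) v)) ⟩
      suc A ^ K * ∑ (W (s + K) v) ≡⟨ cong (suc A ^ K *_) (∑W≡Z (s + K) v) ⟩
      suc A ^ K * Z (s + K) v ∎
      where open ≤-Reasoning

    W-positive : ∀ {s u z} → 1 ≤ W s u z → Within G s u z
    W-positive {suc s} {u} {z} 1≤W with em {Within G s u z}
    ... | yes p = Within-mono (n≤1+n s) p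
    ... | no ¬p = Within-mono (n≤1+n s) (W-positive (≤-trans 1≤W (≤-reflexive
      (trans (cong (_+_ (W s u z)) (trans (cong (weight s *_) (χ-false ¬p)) (*-zeroʳ (weight s)))) (+-identityʳ (W s u z))))))

    W≤Zχ : ∀ s u z → W s u z ≤ Z s u * χ (Within G s u z)
    W≤Zχ s u z with em {Within G s u z}
    ... | yes p rewrite χ-true p | *-identityʳ (Z s u) = ≤-trans (term≤∑ (W s u) z) (≤-reflexive (∑W≡Z s u))
    ... | no ¬p = ≤-trans (≤-pred (≰⇒> (λ 1≤W → ¬p (W-positive 1≤W)))) z≤n

    root-weight : ∀ s → 1 ≤ s → ∀ u → suc A ^ range ≤ Z s u
    root-weight (suc zero)    _ u = ≤-trans (≤-reflexive (sym (trans (*-identityʳ (weight 0)) (*-identityˡ _))))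
                                      (*-monoʳ-≤ (weight 0) (#-witness {P = Within G 0 u} u here))
    root-weight (suc (suc s)) _ u = ≤-trans (root-weight (suc s) (s≤s z≤n) u) (m≤m+n _ _)

    1≤Z : ∀ s → 1 ≤ s → ∀ u → 1 ≤ Z s u
    1≤Z s 1≤s u = ≤-trans (m^n>0 (suc A) range) (root-weight s 1≤s u)

  module _ {n n′ ρ} {G : SimpleGraph (Fin n)} {x} {H : SimpleGraph (Fin n′)} {y} (φ : LocalIso ρ G x H y) where
    open LocalIso φ

    W-transfer : ∀ s → s ≤ ρ → ∀ u → W G s u x ≤ W H s (to u) y
    W-transfer s s≤ρ u = Σ<-mono s (λ r r<s → *-monoʳ-≤ (weight r) (χ-mono (to-root-walk φ (≤-trans (<⇒≤ r<s) s≤ρ))))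

    Z-transfer : ∀ s {t u} → t + s ≤ ρ → Within G t x u → Z G s u ≤ Z H s (to u)
    Z-transfer s {t} t+s≤ρ b = Σ<-mono s (λ r r<s → *-monoʳ-≤ (weight r) (ball-size-≤ φ (≤-trans (+-monoʳ-≤ t (<⇒≤ r<s)) t+s≤ρ) b))

  -- The error splits into the loss of a factor (A / (A + 1)) ^ 2K, small by the choice
  -- of A, and the 2K outermost shells, small by subexponential growth.
  Z-tail : ∀ t .{{_ : NonZero K}} → A ≡ 2 * t * (K + K) → 1 ≤ R → (f : ℕ → ℕ) →
           (∀ r → R ≤ r → 2 * t * (K + K) * (A ^ r * f r) ≤ suc A ^ r) →
           ∀ {n} (G : SimpleGraph (Fin n)) u → (∀ r → 1 ≤ r → # (Within G r u) ≤ f r) →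
           t * (suc A ^ (K + K) * Z G (K + K + R) u) ≤ t * (A ^ (K + K) * Z G R u) + suc A ^ (K + K) * Z G (K + K + R) u
  Z-tail t A≡ 1≤R f slow G u balls = *-cancelˡ-≤ 2 (begin
    2 * (t * (q * Z⁺)) ≡⟨ cong (λ z → 2 * (t * (q * z))) Z⁺≡ ⟩
    2 * (t * (q * (Z₀ + τ))) ≡⟨ expand t q Z₀ τ ⟩
    2 * t * q * Z₀ + q * (2 * t * τ) ≤⟨ +-mono-≤ (*-monoˡ-≤ Z₀ powers) (*-monoʳ-≤ q shells) ⟩
    (2 * t * p + q) * Z₀ + q * Z₀ ≤⟨ m≤m+n _ (2 * (q * τ)) ⟩
    (2 * t * p + q) * Z₀ + q * Z₀ + 2 * (q * τ) ≡⟨ collect t p q Z₀ τ ⟩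
    2 * (t * (p * Z₀) + q * (Z₀ + τ)) ≡⟨ cong (λ z → 2 * (t * (p * Z₀) + q * z)) (sym Z⁺≡) ⟩
    2 * (t * (p * Z₀) + q * Z⁺) ∎)
    where
    open ≤-Reasoning
    m = K + K
    p = A ^ m
    q = suc A ^ m
    Z₀ = Z G R u
    Z⁺ = Z G (m + R) u
    τ = Σ< m (λ r → weight (r + R) * # (Within G (r + R) u))
    Z⁺≡ : Z⁺ ≡ Z₀ + τ
    Z⁺≡ = Σ<-tail R m (λ r → weight r * # (Within G r u))
    instance
      m≢0 : NonZero m
      m≢0 = >-nonZero (<-≤-trans (>-nonZero⁻¹ K) (m≤m+n K K))
    expand : ∀ t q z τ → 2 * (t * (q * (z + τ))) ≡ 2 * t * q * z + q * (2 * t * τ)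
    expand = solve-∀
    collect : ∀ t p q z τ → (2 * t * p + q) * z + q * z + 2 * (q * τ) ≡ 2 * (t * (p * z) + q * (z + τ))
    collect = solve-∀
    powers : 2 * t * q ≤ 2 * t * p + q
    powers = *-cancelˡ-≤ m (+-cancelʳ-≤ q _ _ (begin
      m * (2 * t * q) + q ≡⟨ trans (rearrange m t q) (cong (λ z → q * suc z) (sym A≡)) ⟩
      q * suc A ≤⟨ converse-bernoulli A m ⟩
      p * suc A + m * q ≡⟨ cong (λ z → p * suc z + m * q) A≡ ⟩
      p * suc (2 * t * m) + m * q ≡⟨ rearrange′ m t p q ⟩
      m * (2 * t * p + q) + p ≤⟨ +-monoʳ-≤ (m * (2 * t * p + q)) (^-monoˡ-≤ m (n≤1+n A)) ⟩
      m * (2 * t * p + q) + q ∎))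
      where
      rearrange : ∀ m t q → m * (2 * t * q) + q ≡ q * (1 + 2 * t * m)
      rearrange = solve-∀
      rearrange′ : ∀ m t p q → p * (1 + 2 * t * m) + m * q ≡ m * (2 * t * p + q) + p
      rearrange′ = solve-∀
    shell : ∀ r → r < m → 2 * t * m * (weight (r + R) * # (Within G (r + R) u)) ≤ suc A ^ range
    shell r r<m = begin
      2 * t * m * (A ^ i * suc A ^ (range ∸ i) * # (Within G i u)) ≤⟨ *-monoʳ-≤ (2 * t * m) (*-monoʳ-≤ (weight i) (balls i (≤-trans 1≤R (m≤n+m R r)))) ⟩
      2 * t * m * (A ^ i * suc A ^ (range ∸ i) * f i) ≡⟨ shuffle (2 * t * m) (A ^ i) (suc A ^ (range ∸ i)) (f i) ⟩
      2 * t * m * (A ^ i * f i) * suc A ^ (range ∸ i) ≤⟨ *-monoˡ-≤ (suc A ^ (range ∸ i)) (slow i (m≤n+m R r)) ⟩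
      suc A ^ i * suc A ^ (range ∸ i) ≡⟨ sym (^-distribˡ-+-* (suc A) i (range ∸ i)) ⟩
      suc A ^ (i + (range ∸ i)) ≡⟨ cong (suc A ^_) (m+[n∸m]≡n i≤range) ⟩
      suc A ^ range ∎
      where
      i = r + R
      shuffle : ∀ c a b f → c * (a * b * f) ≡ c * (a * f) * b
      shuffle = solve-∀
      i≤range : i ≤ range
      i≤range = ≤-trans (+-monoˡ-≤ R (<⇒≤ r<m)) (≤-reflexive (trans (+-comm m R) (sym (+-assoc R K K))))
    shells : 2 * t * τ ≤ Z₀
    shells = *-cancelˡ-≤ m (begin
      m * (2 * t * τ) ≡⟨ trans (sym (*-assoc m (2 * t) τ)) (cong (_* τ) (*-comm m (2 * t))) ⟩
      2 * t * m * τ ≡⟨ *-distribˡ-Σ< m (2 * t * m) (λ r → weight (r + R) * # (Within G (r + R) u)) ⟩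
      Σ< m (λ r → 2 * t * m * (weight (r + R) * # (Within G (r + R) u))) ≤⟨ Σ<-mono m shell ⟩
      Σ< m (λ _ → suc A ^ range) ≤⟨ Σ<-≤-const m (λ _ → ≤-refl) ⟩
      m * suc A ^ range ≤⟨ *-monoʳ-≤ m (root-weight G R 1≤R u) ⟩
      m * Z₀ ∎)

module Placements (em : ExcludedMiddle 0ℓ) (A K R : ℕ) where
  open Indicators em
  open Kernels em A K R

  -- place q is the matched isomorphism that moves the piece with centre q into G.
  record Placed {n n′ : ℕ} (G : SimpleGraph (Fin n)) (G′ : SimpleGraph (Fin n′)) (t ρ : ℕ)
                (piece : Fin n′ → Maybe (Fin n′)) (capacity loss : ℕ) : Set where
    field
      place      : Fin n′ → Maybe (Σ[ z′ ∈ Fin n′ ] Σ[ z ∈ Fin n ] LocalIso ρ G′ z′ G z)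
      place-near : ∀ {q z′ p} → place q ≡ just (z′ , p) → Within G′ R q z′
      load       : ∀ x → # (λ y → ∃[ q ] piece y ≡ just q × ∃[ z′ ] ∃[ z ] Σ[ φ ∈ LocalIso ρ G′ z′ G z ] place q ≡ just (z′ , z , φ) × LocalIso.to φ y ≡ x) ≤ capacity
      lost       : t * # (λ y → ∃[ q ] piece y ≡ just q × place q ≡ nothing) ≤ loss

  module Place
    {n n′ : ℕ} (G : SimpleGraph (Fin n)) (G′ : SimpleGraph (Fin n′))
    (f : ℕ → ℕ) (balls : ∀ u r → 1 ≤ r → # (Within G′ r u) ≤ f r)
    (t ρ : ℕ) (1≤K : 1 ≤ K) (1≤R : 1 ≤ R) (ρ-large : (R + K) + (R + K) ≤ ρ)
    (tail : ∀ u → t * (suc A ^ (K + K) * Z G′ (K + K + R) u) ≤ t * (A ^ (K + K) * Z G′ R u) + suc A ^ (K + K) * Z G′ (K + K + R) u)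
    (piece : Fin n′ → Maybe (Fin n′)) (near : ∀ {u q} → piece u ≡ just q → Within G′ K q u)
    (match : ∀ z′ → Maybe (Σ[ z ∈ Fin n ] LocalIso ρ G′ z′ G z))
    (M : ℕ) (capacity : ∀ z → # (λ z′ → ∃[ φ ] match z′ ≡ just (z , φ)) ≤ M)
    (a : ℕ) (a-large : n′ * (suc n * (f K * f K)) < a * a)
    where

    private
      just≢nothing : ∀ {X : Set} {x : X} → just x ≢ nothing
      just≢nothing ()

    -- The option zero discards a piece.
    image : Fin (suc n′) → Fin n′ → Maybe (Fin n)
    image zero     y = nothing
    image (suc z′) y = Maybe.map (λ (z , φ) → LocalIso.to φ y) (match z′)

    unmatched : ℕ
    unmatched = # (λ z′ → match z′ ≡ nothing)

    Zˢ : Fin n′ → ℕ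
    Zˢ q = suc A ^ (K + K) * Z G′ (R + K + K) q

    1≤R+K : 1 ≤ R + K
    1≤R+K = ≤-trans 1≤R (m≤m+n R K)

    private
      left : ∃[ N ] 1 ≤ N × ∀ q → ∃[ κ ] κ * Zˢ q ≡ N
      left = common-multiple Zˢ (λ q → *-mono-≤ (m^n>0 (suc A) (K + K)) (1≤Z G′ (R + K + K) (≤-trans 1≤R+K (m≤m+n (R + K) K)) q))
      right : ∃[ N ] 1 ≤ N × ∀ x → ∃[ κ ] κ * Z G (R + K) x ≡ N
      right = common-multiple (Z G (R + K)) (1≤Z G (R + K) 1≤R+K)

    N : ℕ
    N = proj₁ left * proj₁ right

    1≤N : 1 ≤ N
    1≤N = *-mono-≤ (proj₁ (proj₂ left)) (proj₁ (proj₂ right))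

    private instance
      N≢0 : NonZero N
      N≢0 = >-nonZero 1≤N

    κ′ : Fin n′ → ℕ
    κ′ q = proj₁ right * proj₁ (proj₂ (proj₂ left) q)

    κ′-≡ : ∀ q → κ′ q * Zˢ q ≡ N
    κ′-≡ q = trans (*-assoc (proj₁ right) _ (Zˢ q)) (trans (cong (proj₁ right *_) (proj₂ (proj₂ (proj₂ left) q))) (*-comm (proj₁ right) (proj₁ left)))

    κ : Fin n → ℕ
    κ x = proj₁ left * proj₁ (proj₂ (proj₂ right) x)

    κ-≡ : ∀ x → κ x * Z G (R + K) x ≡ N
    κ-≡ x = trans (*-assoc (proj₁ left) _ (Z G (R + K) x)) (cong (proj₁ left *_) (proj₂ (proj₂ (proj₂ right) x)))

    mass : Fin n′ → ℕ
    mass q = κ′ q * A ^ (K + K)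

    w : Fin n′ → Fin (suc n′) → ℕ
    w q zero     = N ∸ mass q * Z G′ R q
    w q (suc z′) = mass q * W G′ R q z′

    private
      powers : ∀ b → b ^ (K + K) ≡ b ^ K * b ^ K
      powers b = ^-distribˡ-+-* b K K

    two-shifts : ∀ q → A ^ (K + K) * Z G′ R q ≤ Zˢ q
    two-shifts q = begin
      A ^ (K + K) * Z G′ R q ≡⟨ trans (cong (_* Z G′ R q) (powers A)) (*-assoc (A ^ K) (A ^ K) _) ⟩
      A ^ K * (A ^ K * Z G′ R q) ≤⟨ *-monoʳ-≤ (A ^ K) (Z-shift G′ (m≤m+n (R + K) K) here) ⟩
      A ^ K * (suc A ^ K * Z G′ (R + K) q) ≡⟨ swap (A ^ K) (suc A ^ K) _ ⟩
      suc A ^ K * (A ^ K * Z G′ (R + K) q) ≤⟨ *-monoʳ-≤ (suc A ^ K) (Z-shift G′ ≤-refl here) ⟩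
      suc A ^ K * (suc A ^ K * Z G′ (R + K + K) q) ≡⟨ sym (trans (cong (_* Z G′ (R + K + K) q) (powers (suc A))) (*-assoc (suc A ^ K) (suc A ^ K) _)) ⟩
      Zˢ q ∎
      where
      open ≤-Reasoning
      swap : ∀ a b c → a * (b * c) ≡ b * (a * c)
      swap = solve-∀

    mass*Z≤N : ∀ q → mass q * Z G′ R q ≤ N
    mass*Z≤N q = ≤-trans (≤-reflexive (*-assoc (κ′ q) _ _)) (≤-trans (*-monoʳ-≤ (κ′ q) (two-shifts q)) (≤-reflexive (κ′-≡ q)))

    ∑w≡N : ∀ q → ∑ (w q) ≡ N
    ∑w≡N q = begin
      ∑ (w q) ≡⟨ ∑-suc (w q) ⟩
      N ∸ mass q * Z G′ R q + ∑ (λ z′ → mass q * W G′ R q z′) ≡⟨ cong (_+_ (N ∸ mass q * Z G′ R q)) (sym (*-distribˡ-∑ (mass q) (W G′ R q))) ⟩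
      N ∸ mass q * Z G′ R q + mass q * ∑ (W G′ R q) ≡⟨ cong (λ z → N ∸ mass q * Z G′ R q + mass q * z) (∑W≡Z G′ R q) ⟩
      N ∸ mass q * Z G′ R q + mass q * Z G′ R q ≡⟨ m∸n+n≡m (mass*Z≤N q) ⟩
      N ∎
      where open ≡-Reasoning

    null-weight : ∀ q → t * w q zero ≤ N
    null-weight q = ≤-trans (≤-reflexive (*-distribˡ-∸ t N (mass q * Z G′ R q))) (m≤n+o⇒m∸n≤o (t * N) (t * (mass q * Z G′ R q)) (begin
      t * N ≡⟨ cong (t *_) (sym (κ′-≡ q)) ⟩
      t * (κ′ q * Zˢ q) ≡⟨ swap t (κ′ q) (Zˢ q) ⟩
      κ′ q * (t * Zˢ q) ≤⟨ *-monoʳ-≤ (κ′ q) tail′ ⟩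
      κ′ q * (t * (A ^ (K + K) * Z G′ R q) + Zˢ q) ≡⟨ expand (κ′ q) t (A ^ (K + K)) (Z G′ R q) (Zˢ q) ⟩
      t * (mass q * Z G′ R q) + κ′ q * Zˢ q ≡⟨ cong (_+_ (t * (mass q * Z G′ R q))) (κ′-≡ q) ⟩
      t * (mass q * Z G′ R q) + N ∎))
      where
      open ≤-Reasoning
      swap : ∀ a b c → a * (b * c) ≡ b * (a * c)
      swap = solve-∀
      expand : ∀ k t a z s → k * (t * (a * z) + s) ≡ t * (k * a * z) + k * s
      expand = solve-∀
      tail′ : t * Zˢ q ≤ t * (A ^ (K + K) * Z G′ R q) + Zˢ q
      tail′ = subst (λ s → t * (suc A ^ (K + K) * Z G′ s q) ≤ t * (A ^ (K + K) * Z G′ R q) + suc A ^ (K + K) * Z G′ s q)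
        (trans (+-comm (K + K) R) (sym (+-assoc R K K))) (tail q)

    weight-near : ∀ {q z′} → 1 ≤ w q (suc z′) → Within G′ R q z′
    weight-near {q} {z′} 1≤w = W-positive G′ (n≢0⇒n>0 (λ W≡0 → <⇒≱ 1≤w (≤-reflexive (trans (cong (mass q *_) W≡0) (*-zeroʳ (mass q))))))

    weight-≤ : ∀ q z′ → w q (suc z′) ≤ N * χ (Within G′ R q z′)
    weight-≤ q z′ = begin
      mass q * W G′ R q z′ ≤⟨ *-monoʳ-≤ (mass q) (W≤Zχ G′ R q z′) ⟩
      mass q * (Z G′ R q * χ (Within G′ R q z′)) ≡⟨ sym (*-assoc (mass q) _ _) ⟩
      mass q * Z G′ R q * χ (Within G′ R q z′) ≤⟨ *-monoˡ-≤ (χ (Within G′ R q z′)) (mass*Z≤N q) ⟩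
      N * χ (Within G′ R q z′) ∎
      where open ≤-Reasoning

    -- Every x in the image of the piece would itself choose z with at least the weight
    -- of φ, because the kernel depends only on the isomorphic balls.
    weight-transfer : ∀ {q z′ z u} (φ : LocalIso ρ G′ z′ G z) → Within G′ K q u → Within G′ R q z′ →
                      w q (suc z′) ≤ κ (LocalIso.to φ u) * W G (R + K) (LocalIso.to φ u) z
    weight-transfer {q} {z′} {z} {u} φ qu qz′ = begin
      κ′ q * A ^ (K + K) * W G′ R q z′ ≡⟨ cong (λ p → κ′ q * p * W G′ R q z′) (powers A) ⟩
      κ′ q * (A ^ K * A ^ K) * W G′ R q z′ ≡⟨ shuffle (κ′ q) (A ^ K) (W G′ R q z′) ⟩
      κ′ q * A ^ K * (A ^ K * W G′ R q z′) ≤⟨ *-monoʳ-≤ (κ′ q * A ^ K) (W-shift G′ (m≤m+n (R + K) K) qu z′) ⟩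
      κ′ q * A ^ K * (suc A ^ K * W G′ (R + K) u z′) ≤⟨ *-monoʳ-≤ (κ′ q * A ^ K) (*-monoʳ-≤ (suc A ^ K) (W-transfer φ (R + K) R+K≤ρ u)) ⟩
      κ′ q * A ^ K * (suc A ^ K * W G (R + K) x z) ≡⟨ sym (*-assoc (κ′ q * A ^ K) (suc A ^ K) _) ⟩
      κ′ q * A ^ K * suc A ^ K * W G (R + K) x z ≤⟨ *-monoˡ-≤ (W G (R + K) x z) normaliser ⟩
      κ x * W G (R + K) x z ∎
      where
      open ≤-Reasoning
      x = LocalIso.to φ u
      R+K≤ρ : R + K ≤ ρ
      R+K≤ρ = ≤-trans (m≤m+n (R + K) (R + K)) ρ-large
      z′u : Within G′ (R + K) z′ u
      z′u = Within-trans (Within-sym qz′) qu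
      zx : Within G (R + K) z x
      zx = subst (λ v → Within G (R + K) v x) (LocalIso.to-root φ) (to-walk φ R+K≤ρ (here {r = 0}) z′u)
      Z≤ : Z G (R + K) x ≤ Z G′ (R + K) u
      Z≤ = subst (λ v → Z G (R + K) x ≤ Z G′ (R + K) v) (LocalIso.from-to φ (Within-mono R+K≤ρ z′u)) (Z-transfer (flip φ) (R + K) ρ-large zx)
      shuffle : ∀ k a b → k * (a * a) * b ≡ k * a * (a * b)
      shuffle = solve-∀
      shuffle₁ : ∀ k a b c → k * a * b * c ≡ k * b * (a * c)
      shuffle₁ = solve-∀
      shuffle₂ : ∀ k b c → k * b * (b * c) ≡ k * (b * b * c)
      shuffle₂ = solve-∀
      instance
        Z≢0 : NonZero (Z G (R + K) x)
        Z≢0 = >-nonZero (1≤Z G (R + K) 1≤R+K x)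
      normaliser : κ′ q * A ^ K * suc A ^ K ≤ κ x
      normaliser = *-cancelʳ-≤ _ _ (Z G (R + K) x) (begin
        κ′ q * A ^ K * suc A ^ K * Z G (R + K) x ≡⟨ shuffle₁ (κ′ q) (A ^ K) (suc A ^ K) (Z G (R + K) x) ⟩
        κ′ q * suc A ^ K * (A ^ K * Z G (R + K) x) ≤⟨ *-monoʳ-≤ (κ′ q * suc A ^ K) (*-monoʳ-≤ (A ^ K) Z≤) ⟩
        κ′ q * suc A ^ K * (A ^ K * Z G′ (R + K) u) ≤⟨ *-monoʳ-≤ (κ′ q * suc A ^ K) (Z-shift G′ ≤-refl (Within-sym qu)) ⟩
        κ′ q * suc A ^ K * (suc A ^ K * Z G′ (R + K + K) q) ≡⟨ shuffle₂ (κ′ q) (suc A ^ K) (Z G′ (R + K + K) q) ⟩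
        κ′ q * (suc A ^ K * suc A ^ K * Z G′ (R + K + K) q) ≡⟨ cong (λ p → κ′ q * (p * Z G′ (R + K + K) q)) (sym (powers (suc A))) ⟩
        κ′ q * Zˢ q ≡⟨ trans (κ′-≡ q) (sym (κ-≡ x)) ⟩
        κ x * Z G (R + K) x ∎)

    goal : Fin (suc n) → Maybe (Fin n)
    goal zero    = nothing
    goal (suc x) = just x

    v : Fin n′ → Fin (suc n′) → Fin (suc n) → ℕ
    v q o c = # (λ y → piece y ≡ just q × image o y ≡ goal c)

    piece-size : ∀ q → # (λ y → piece y ≡ just q) ≤ f K
    piece-size q = ≤-trans (#-mono (λ y → near)) (balls q K 1≤K)

    v≤ : ∀ q o c → v q o c ≤ f K
    v≤ q o c = ≤-trans (#-mono (λ y → proj₁)) (piece-size q)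

    pieces-disjoint : ∀ (S : Fin n′ → Set) → ∑ (λ q → # (λ y → piece y ≡ just q × S y)) ≤ # S
    pieces-disjoint S = ≤-trans (≤-reflexive (∑-comm (λ q y → χ (piece y ≡ just q × S y))))
      (∑-mono (λ y → ≤-trans (#-unique (λ q q′ (e , _) (e′ , _) → just-injective (trans (sym e) e′))) (χ-mono (λ (q , _ , s) → s))))

    mean-split : ∀ c → ∑ (λ q → ∑ (λ o → w q o * v q o c)) ≡
                       ∑ (λ q → w q zero * v q zero c) + ∑ (λ z′ → ∑ (λ q → w q (suc z′) * v q (suc z′) c))
    mean-split c = trans (∑-cong (λ q → ∑-suc (λ o → w q o * v q o c)))
      (trans (∑-distrib-+ (λ q → w q zero * v q zero c) (λ q → ∑ (λ z′ → w q (suc z′) * v q (suc z′) c)))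
             (cong (_+_ (∑ (λ q → w q zero * v q zero c))) (∑-comm (λ q z′ → w q (suc z′) * v q (suc z′) c))))

    module _ (x : Fin n) where

      contribution : Fin n′ → Fin n → ℕ
      contribution z′ z = χ (∃[ φ ] match z′ ≡ just (z , φ)) * (κ x * W G (R + K) x z)

      option-load : ∀ z′ → ∑ (λ q → w q (suc z′) * v q (suc z′) (suc x)) ≤ ∑ (contribution z′)
      option-load z′ with match z′ in eq
      ... | nothing = ≤-trans (≤-reflexive (∑-zero (λ q → trans (cong (w q (suc z′) *_) (#-none (λ y (_ , e) → just≢nothing (sym e)))) (*-zeroʳ (w q (suc z′)))))) z≤n
      ... | just (z , φ) = begin
        ∑ (λ q → w q (suc z′) * # (λ y → piece y ≡ just q × just (to y) ≡ just x))
          ≡⟨ ∑-cong (λ q → *-distribˡ-∑ (w q (suc z′)) (λ y → χ (piece y ≡ just q × just (to y) ≡ just x))) ⟩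
        ∑ (λ q → ∑ (λ y → w q (suc z′) * χ (piece y ≡ just q × just (to y) ≡ just x)))
          ≤⟨ ∑-mono (λ q → ∑-mono (term q)) ⟩
        ∑ (λ q → ∑ (λ y → u * χ (piece y ≡ just q × from x ≡ y)))
          ≡⟨ ∑-cong (λ q → sym (*-distribˡ-∑ u (λ y → χ (piece y ≡ just q × from x ≡ y)))) ⟩
        ∑ (λ q → u * # (λ y → piece y ≡ just q × from x ≡ y))
          ≡⟨ sym (*-distribˡ-∑ u (λ q → # (λ y → piece y ≡ just q × from x ≡ y))) ⟩
        u * ∑ (λ q → # (λ y → piece y ≡ just q × from x ≡ y))
          ≤⟨ *-monoʳ-≤ u (≤-trans (pieces-disjoint (from x ≡_)) (≤-reflexive (#-≡ (from x)))) ⟩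
        u * 1
          ≡⟨ trans (*-identityʳ u) (sym (trans (cong (_* u) (χ-true (φ , refl))) (*-identityˡ u))) ⟩
        χ (∃[ ψ ] just (z , φ) ≡ just (z , ψ)) * u
          ≤⟨ term≤∑ (λ z₁ → χ (∃[ ψ ] just (z , φ) ≡ just (z₁ , ψ)) * (κ x * W G (R + K) x z₁)) z ⟩
        ∑ (λ z₁ → χ (∃[ ψ ] just (z , φ) ≡ just (z₁ , ψ)) * (κ x * W G (R + K) x z₁))
          ∎
        where
        open ≤-Reasoning
        open LocalIso φ
        u = κ x * W G (R + K) x z
        term : ∀ q y → w q (suc z′) * χ (piece y ≡ just q × just (to y) ≡ just x) ≤ u * χ (piece y ≡ just q × from x ≡ y)
        term q y with em {piece y ≡ just q × just (to y) ≡ just x} | em {1 ≤ w q (suc z′)}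
        ... | no ¬p | _      = ≤-trans (≤-reflexive (trans (cong (w q (suc z′) *_) (χ-false ¬p)) (*-zeroʳ (w q (suc z′))))) z≤n
        ... | yes _ | no w≡0 = ≤-trans (*-monoˡ-≤ (χ (piece y ≡ just q × just (to y) ≡ just x)) {w q (suc z′)} {0} (≤-pred (≰⇒> w≡0))) z≤n
        ... | yes (e , refl) | yes 1≤w = begin
          w q (suc z′) * χ (piece y ≡ just q × just (to y) ≡ just x) ≡⟨ trans (cong (w q (suc z′) *_) (χ-true (e , refl))) (*-identityʳ _) ⟩
          w q (suc z′) ≤⟨ weight-transfer φ (near e) (weight-near 1≤w) ⟩
          u ≡⟨ sym (trans (cong (u *_) (χ-true (e , from-to z′y))) (*-identityʳ u)) ⟩
          u * χ (piece y ≡ just q × from x ≡ y) ∎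
          where
          z′y : Within G′ ρ z′ y
          z′y = Within-mono (≤-trans (m≤m+n (R + K) (R + K)) ρ-large) (Within-trans (Within-sym (weight-near 1≤w)) (near e))

      mean-load : ∑ (λ q → ∑ (λ o → w q o * v q o (suc x))) ≤ N * M
      mean-load = begin
        ∑ (λ q → ∑ (λ o → w q o * v q o (suc x)))
          ≡⟨ mean-split (suc x) ⟩
        ∑ (λ q → w q zero * v q zero (suc x)) + ∑ (λ z′ → ∑ (λ q → w q (suc z′) * v q (suc z′) (suc x)))
          ≡⟨ cong (_+ ∑ (λ z′ → ∑ (λ q → w q (suc z′) * v q (suc z′) (suc x))))
               (∑-zero (λ q → trans (cong (w q zero *_) (#-none (λ y (_ , e) → just≢nothing (sym e)))) (*-zeroʳ (w q zero)))) ⟩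
        ∑ (λ z′ → ∑ (λ q → w q (suc z′) * v q (suc z′) (suc x)))
          ≤⟨ ∑-mono option-load ⟩
        ∑ (λ z′ → ∑ (contribution z′))
          ≡⟨ ∑-comm contribution ⟩
        ∑ (λ z → ∑ (λ z′ → contribution z′ z))
          ≡⟨ ∑-cong (λ z → sym (*-distribʳ-∑ (κ x * W G (R + K) x z) (λ z′ → χ (∃[ φ ] match z′ ≡ just (z , φ))))) ⟩
        ∑ (λ z → # (λ z′ → ∃[ φ ] match z′ ≡ just (z , φ)) * (κ x * W G (R + K) x z))
          ≤⟨ ∑-mono (λ z → *-monoˡ-≤ (κ x * W G (R + K) x z) (capacity z)) ⟩
        ∑ (λ z → M * (κ x * W G (R + K) x z))
          ≡⟨ sym (trans (cong (M *_) (*-distribˡ-∑ (κ x) (W G (R + K) x))) (*-distribˡ-∑ M (λ z → κ x * W G (R + K) x z))) ⟩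
        M * (κ x * ∑ (W G (R + K) x))
          ≡⟨ cong (λ z → M * (κ x * z)) (∑W≡Z G (R + K) x) ⟩
        M * (κ x * Z G (R + K) x)
          ≡⟨ trans (cong (M *_) (κ-≡ x)) (*-comm M N) ⟩
        N * M
          ∎
        where open ≤-Reasoning

    option-loss : ∀ z′ → ∑ (λ q → w q (suc z′) * v q (suc z′) zero) ≤ χ (match z′ ≡ nothing) * (N * f (R + K))
    option-loss z′ with match z′ in eq
    ... | just (z , φ) = ≤-trans (≤-reflexive (∑-zero (λ q → trans (cong (w q (suc z′) *_) (#-none (λ y (_ , e) → just≢nothing e))) (*-zeroʳ (w q (suc z′)))))) z≤n
    ... | nothing = begin
      ∑ (λ q → w q (suc z′) * # (λ y → piece y ≡ just q × nothing ≡ nothing {A = Fin n}))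
        ≤⟨ ∑-mono term ⟩
      ∑ (λ q → N * # (λ y → piece y ≡ just q × Within G′ (R + K) z′ y))
        ≡⟨ sym (*-distribˡ-∑ N (λ q → # (λ y → piece y ≡ just q × Within G′ (R + K) z′ y))) ⟩
      N * ∑ (λ q → # (λ y → piece y ≡ just q × Within G′ (R + K) z′ y))
        ≤⟨ *-monoʳ-≤ N (≤-trans (pieces-disjoint (Within G′ (R + K) z′)) (balls z′ (R + K) 1≤R+K)) ⟩
      N * f (R + K)
        ≡⟨ sym (trans (cong (_* (N * f (R + K))) (χ-true {nothing {A = Σ[ z ∈ Fin n ] LocalIso ρ G′ z′ G z} ≡ nothing} refl)) (*-identityˡ _)) ⟩
      χ (nothing {A = Σ[ z ∈ Fin n ] LocalIso ρ G′ z′ G z} ≡ nothing) * (N * f (R + K))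
        ∎
      where
      open ≤-Reasoning
      term : ∀ q → w q (suc z′) * # (λ y → piece y ≡ just q × nothing ≡ nothing {A = Fin n}) ≤ N * # (λ y → piece y ≡ just q × Within G′ (R + K) z′ y)
      term q with em {Within G′ R q z′}
      ... | yes qz′ = *-mono-≤ (≤-trans (weight-≤ q z′) (≤-reflexive (trans (cong (N *_) (χ-true qz′)) (*-identityʳ N))))
                        (#-mono (λ y (e , _) → e , Within-trans (Within-sym qz′) (near e)))
      ... | no ¬qz′ = ≤-trans (*-monoˡ-≤ (# (λ y → piece y ≡ just q × nothing ≡ nothing {A = Fin n}))
                        (≤-trans (weight-≤ q z′) (≤-reflexive (trans (cong (N *_) (χ-false ¬qz′)) (*-zeroʳ N))))) z≤n

    mean-loss : t * ∑ (λ q → ∑ (λ o → w q o * v q o zero)) ≤ N * (n′ + t * (f (R + K) * unmatched))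
    mean-loss = begin
      t * ∑ (λ q → ∑ (λ o → w q o * v q o zero))
        ≡⟨ cong (t *_) (mean-split zero) ⟩
      t * (∑ (λ q → w q zero * v q zero zero) + ∑ (λ z′ → ∑ (λ q → w q (suc z′) * v q (suc z′) zero)))
        ≡⟨ *-distribˡ-+ t (∑ (λ q → w q zero * v q zero zero)) _ ⟩
      t * ∑ (λ q → w q zero * v q zero zero) + t * ∑ (λ z′ → ∑ (λ q → w q (suc z′) * v q (suc z′) zero))
        ≤⟨ +-mono-≤ null (*-monoʳ-≤ t (∑-mono option-loss)) ⟩
      N * n′ + t * ∑ (λ z′ → χ (match z′ ≡ nothing) * (N * f (R + K)))
        ≡⟨ cong (λ z → N * n′ + t * z) (sym (*-distribʳ-∑ (N * f (R + K)) (λ z′ → χ (match z′ ≡ nothing)))) ⟩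
      N * n′ + t * (unmatched * (N * f (R + K)))
        ≡⟨ collect N n′ t unmatched (f (R + K)) ⟩
      N * (n′ + t * (f (R + K) * unmatched))
        ∎
      where
      open ≤-Reasoning
      collect : ∀ N n t m f → N * n + t * (m * (N * f)) ≡ N * (n + t * (f * m))
      collect = solve-∀
      null : t * ∑ (λ q → w q zero * v q zero zero) ≤ N * n′
      null = begin
        t * ∑ (λ q → w q zero * v q zero zero) ≡⟨ *-distribˡ-∑ t (λ q → w q zero * v q zero zero) ⟩
        ∑ (λ q → t * (w q zero * v q zero zero)) ≤⟨ ∑-mono (λ q → ≤-trans (≤-reflexive (sym (*-assoc t (w q zero) (v q zero zero)))) (*-monoˡ-≤ (v q zero zero) (null-weight q))) ⟩
        ∑ (λ q → N * v q zero zero) ≡⟨ sym (*-distribˡ-∑ N (λ q → v q zero zero)) ⟩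
        N * ∑ (λ q → v q zero zero) ≤⟨ *-monoʳ-≤ N (≤-trans (pieces-disjoint (λ y → nothing ≡ nothing {A = Fin n})) (#≤n _)) ⟩
        N * n′ ∎

    private
      rounded : Σ[ choice ∈ (Fin n′ → Fin (suc n′)) ] (∀ q → 1 ≤ w q (choice q)) ×
        (∀ c → N * ∑ (λ q → v q (choice q) c) ≤ ∑ (λ q → ∑ (λ o → w q o * v q o c)) + N * a)
      rounded = rounding N (f K) 1≤N w ∑w≡N v v≤ a a-large

    centre : Fin n′ → Fin (suc n′)
    centre = proj₁ rounded

    centre-near : ∀ {q z′} → centre q ≡ suc z′ → Within G′ R q z′
    centre-near {q} e = weight-near (subst (λ o → 1 ≤ w q o) e (proj₁ (proj₂ rounded) q))

    Located : Fin n′ → Maybe (Fin n) → Set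
    Located y m = ∃[ q ] piece y ≡ just q × image (centre q) y ≡ m

    private
      located≤ : ∀ c → # (λ y → Located y (goal c)) ≤ ∑ (λ q → v q (centre q) c)
      located≤ c = ≤-trans (∑-mono (λ y → χ-∃ (λ q → piece y ≡ just q × image (centre q) y ≡ goal c)))
                           (≤-reflexive (∑-comm (λ y q → χ (piece y ≡ just q × image (centre q) y ≡ goal c))))

    load : ∀ x → # (λ y → Located y (just x)) ≤ M + a
    load x = *-cancelˡ-≤ N (begin
      N * # (λ y → Located y (just x)) ≤⟨ *-monoʳ-≤ N (located≤ (suc x)) ⟩
      N * ∑ (λ q → v q (centre q) (suc x)) ≤⟨ proj₂ (proj₂ rounded) (suc x) ⟩
      ∑ (λ q → ∑ (λ o → w q o * v q o (suc x))) + N * a ≤⟨ +-monoˡ-≤ (N * a) (mean-load x) ⟩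
      N * M + N * a ≡⟨ sym (*-distribˡ-+ N M a) ⟩
      N * (M + a) ∎)
      where open ≤-Reasoning

    lost : t * # (λ y → Located y nothing) ≤ n′ + t * (f (R + K) * unmatched + a)
    lost = *-cancelˡ-≤ N (begin
      N * (t * # (λ y → Located y nothing)) ≤⟨ *-monoʳ-≤ N (*-monoʳ-≤ t (located≤ zero)) ⟩
      N * (t * ∑ (λ q → v q (centre q) zero)) ≡⟨ swap N t _ ⟩
      t * (N * ∑ (λ q → v q (centre q) zero)) ≤⟨ *-monoʳ-≤ t (proj₂ (proj₂ rounded) zero) ⟩
      t * (∑ (λ q → ∑ (λ o → w q o * v q o zero)) + N * a) ≡⟨ *-distribˡ-+ t _ (N * a) ⟩
      t * ∑ (λ q → ∑ (λ o → w q o * v q o zero)) + t * (N * a) ≤⟨ +-monoˡ-≤ (t * (N * a)) mean-loss ⟩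
      N * (n′ + t * (f (R + K) * unmatched)) + t * (N * a) ≡⟨ collect N n′ t (f (R + K) * unmatched) a ⟩
      N * (n′ + t * (f (R + K) * unmatched + a)) ∎)
      where
      open ≤-Reasoning
      swap : ∀ a b c → a * (b * c) ≡ b * (a * c)
      swap = solve-∀
      collect : ∀ N n t m a → N * (n + t * m) + t * (N * a) ≡ N * (n + t * (m + a))
      collect = solve-∀

    private
      place-at : Fin (suc n′) → Maybe (Σ[ z′ ∈ Fin n′ ] Σ[ z ∈ Fin n ] LocalIso ρ G′ z′ G z)
      place-at zero     = nothing
      place-at (suc z′) = Maybe.map (z′ ,_) (match z′)

      place-just : ∀ o {z′ z φ} → place-at o ≡ just (z′ , z , φ) → o ≡ suc z′ × ∀ y → image o y ≡ just (LocalIso.to φ y)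
      place-just (suc z′) eq with match z′
      place-just (suc z′) refl | just _ = refl , λ y → refl

      place-nothing : ∀ o → place-at o ≡ nothing → ∀ y → image o y ≡ nothing
      place-nothing zero     eq y = refl
      place-nothing (suc z′) eq y with match z′
      ... | nothing = refl

    placed : Placed G G′ t ρ piece (M + a) (n′ + t * (f (R + K) * unmatched + a))
    placed = record
      { place      = λ q → place-at (centre q)
      ; place-near = λ {q} e → centre-near (proj₁ (place-just (centre q) e))
      ; load       = λ x → ≤-trans (#-mono (λ y → λ { (q , e , _ , _ , _ , p , refl) → q , e , proj₂ (place-just (centre q) p) y })) (load x)
      ; lost       = ≤-trans (*-monoʳ-≤ t (#-mono (λ y (q , e , p) → q , e , place-nothing (centre q) p y))) lost
      }

module Transplants (em : ExcludedMiddle 0ℓ) where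
  open Indicators em
  open FromRelation em
  open Separation em
  open Pairs em

  module Transplantation
    {n n′ : ℕ} (G H : SimpleGraph (Fin n)) (G′ : SimpleGraph (Fin n′))
    (t t′ k K R ρ M d B : ℕ)
    (degrees : ∀ u → # (λ v → T (adj G′ u v)) ≤ d)
    (balls : ∀ u → # (Within G′ (k + k) u) ≤ B)
    (S : Separated G t k) (S′ : Separated G′ t′ K)
    (R+K≤ρ : R + K ≤ ρ) (R+K+2k≤ρ : (R + K) + (k + k) ≤ ρ)
    (place : Fin n′ → Maybe (Σ[ z′ ∈ Fin n′ ] Σ[ z ∈ Fin n ] LocalIso ρ G′ z′ G z))
    (place-near : ∀ {q z′ p} → place q ≡ just (z′ , p) → Within G′ R q z′)
    where

    private
      module S  = Separated S
      module S′ = Separated S′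
      just≢nothing : ∀ {X : Set} {x : X} → just x ≢ nothing
      just≢nothing ()
      nothing≢just : ∀ {X : Set} {x : X} → nothing ≢ just x
      nothing≢just ()

    record At (y q : Fin n′) (x : Fin n) : Set where
      constructor at
      field
        piece-y : S′.piece y ≡ just q
        {z′}    : Fin n′
        {z}     : Fin n
        φ       : LocalIso ρ G′ z′ G z
        placed  : place q ≡ just (z′ , z , φ)
        to-y    : LocalIso.to φ y ≡ x

    At-ball : ∀ {y q z′ p} → S′.piece y ≡ just q → place q ≡ just (z′ , p) → Within G′ (R + K) z′ y
    At-ball e e′ = Within-trans (Within-sym (place-near e′)) (S′.near e)

    At-functional : ∀ {y q q₁ x x₁} → At y q x → At y q₁ x₁ → q ≡ q₁ × x ≡ x₁
    At-functional (at e φ p refl) (at e₁ φ₁ p₁ refl) with just-injective (trans (sym e) e₁)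
    ... | refl with just-injective (trans (sym p) p₁)
    ... | refl = refl , refl

    At-injective : ∀ {y y₁ q x} → At y q x → At y₁ q x → y ≡ y₁
    At-injective (at e φ p f) (at e₁ φ₁ p₁ f₁) with just-injective (trans (sym p) p₁)
    ... | refl = to-injective-on-ball φ (Within-mono R+K≤ρ (At-ball e p)) (Within-mono R+K≤ρ (At-ball e₁ p)) (trans f (sym f₁))

    Whole : Fin n′ → Fin n → Set
    Whole q b = ∀ x → S.piece x ≡ just b → ∃[ y ] At y q x

    record Good (y q : Fin n′) (x b : Fin n) : Set where
      constructor good
      field
        located : At y q x
        piece-x : S.piece x ≡ just b
        whole   : Whole q b

    Good-functional : ∀ {y q q₁ x x₁ b b₁} → Good y q x b → Good y q₁ x₁ b₁ → q ≡ q₁ × x ≡ x₁ × b ≡ b₁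
    Good-functional (good l p w) (good l₁ p₁ w₁) with At-functional l l₁
    ... | refl , refl = refl , refl , just-injective (trans (sym p) p₁)

    Good? : Fin n′ → Set
    Good? y = ∃[ q ] ∃[ x ] ∃[ b ] Good y q x b

    Kept : Fin n′ → Fin n′ → Set
    Kept y y′ = T (adj G′ y y′) × ∃[ q ] ∃[ x ] ∃[ x′ ] ∃[ b ] Good y q x b × Good y′ q x′ b × T (adj H x x′)

    H′ : SimpleGraph (Fin n′)
    H′ = graphOf Kept (λ (e , q , x , x′ , b , g , g′ , h) → adj-sym G′ e , q , x′ , x , b , g′ , g , adj-sym H h)
                      (λ (e , _) → adj-irrefl G′ e)

    module _ (placed-load : ∀ x → # (λ y → ∃[ q ] S′.piece y ≡ just q × ∃[ z′ ] ∃[ z ] Σ[ φ ∈ LocalIso ρ G′ z′ G z ] place q ≡ just (z′ , z , φ) × LocalIso.to φ y ≡ x) ≤ M) where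

      load : ∀ x → # (λ y → ∃[ q ] At y q x) ≤ M
      load x = ≤-trans (#-mono (λ y → λ { (q , at e φ p f) → q , e , _ , _ , φ , p , f })) (placed-load x)

      -- The copy of the piece b inside the image of q is numbered by the earlier
      -- images that contain b.
      index : Fin n′ → Fin n → ℕ
      index q b = # (λ q₁ → q₁ Fin.< q × Whole q₁ b)

      index-mono : ∀ {q q₁ b} → q Fin.< q₁ → Whole q b → index q b < index q₁ b
      index-mono {q} {q₁} {b} q<q₁ w = ≤-trans (≤-reflexive (cong (_+ index q b) (sym (#-≡ q))))
        (#-split (λ q₂ → λ { refl → q<q₁ , w }) (λ q₂ (l , w′) → Fin.<-trans l q<q₁ , w′) (λ q₂ → λ { refl (l , _) → Fin.<-irrefl refl l }))

      index<M : ∀ {q b x} → S.piece x ≡ just b → Whole q b → index q b < M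
      index<M {q} {b} {x} e w = begin-strict
        index q b <⟨ ≤-trans (≤-reflexive (cong (_+ index q b) (sym (#-≡ q))))
                                                (#-split (λ q₂ → λ { refl → w }) (λ q₂ → proj₂) (λ q₂ → λ { refl (l , _) → Fin.<-irrefl refl l })) ⟩
        # (λ q₁ → Whole q₁ b) ≤⟨ #-injection (λ q₁ w₁ → proj₁ (w₁ x e)) (λ q₁ w₁ → q₁ , proj₂ (w₁ x e))
                                                (λ q₁ q₂ w₁ w₂ f → proj₁ (At-functional (proj₂ (w₁ x e)) (subst (λ y → At y q₂ x) (sym f) (proj₂ (w₂ x e))))) ⟩
        # (λ y → ∃[ q ] At y q x) ≤⟨ load x ⟩
        M ∎
        where open ≤-Reasoning

      slot : ∀ {y q x b} → Good y q x b → Fin M × Fin n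
      slot {x = x} (good l p w) = fromℕ< (index<M p w) , x

      slot-cong : ∀ {y y′ q x x′ b} (g : Good y q x b) (g′ : Good y′ q x′ b) → proj₁ (slot g) ≡ proj₁ (slot g′)
      slot-cong (good l p w) (good l′ p′ w′) = Fin.fromℕ<-cong _ _ refl (index<M p w) (index<M p′ w′)

      slot-injective : ∀ {y y₁ q q₁ x x₁ b b₁} (g : Good y q x b) (g₁ : Good y₁ q₁ x₁ b₁) → slot g ≡ slot g₁ → y ≡ y₁
      slot-injective {q = q} {q₁} {x} {b = b} {b₁} (good l p w) (good l₁ p₁ w₁) eq
        with cong proj₂ eq
      ... | refl with just-injective (trans (sym p) p₁)
      ... | refl with Fin.<-cmp q q₁
      ... | tri< q<q₁ _ _ = ⊥-elim (<⇒≢ (index-mono q<q₁ w) same-index)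
        where same-index = Fin.fromℕ<-injective _ _ (index<M p w) (index<M p₁ w₁) (cong proj₁ eq)
      ... | tri> _ _ q₁<q = ⊥-elim (<⇒≢ (index-mono q₁<q w₁) (sym same-index))
        where same-index = Fin.fromℕ<-injective _ _ (index<M p w) (index<M p₁ w₁) (cong proj₁ eq)
      ... | tri≈ _ refl _ = At-injective l l₁

      ι : Fin n′ → Maybe (Fin M × Fin n)
      ι y with em {Good? y}
      ... | yes (_ , _ , _ , g) = just (slot g)
      ... | no _                = nothing

      ι-good : ∀ {y q x b} (g : Good y q x b) → ι y ≡ just (slot g)
      ι-good {y} g with em {Good? y}
      ... | no ¬g = ⊥-elim (¬g (_ , _ , _ , g))
      ... | yes (_ , _ , _ , g₁) with Good-functional g₁ g
      ... | refl , refl , refl = cong just (cong₂ _,_ (slot-cong g₁ g) refl)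

      ι-injective : ∀ {y y′ p} → ι y ≡ just p → ι y′ ≡ just p → y ≡ y′
      ι-injective {y} {y′} e e′ with em {Good? y} | em {Good? y′}
      ... | yes (_ , _ , _ , g) | yes (_ , _ , _ , g′) = slot-injective g g′ (just-injective (trans e (sym e′)))

      H′-member : ∀ {D} {P : Pred FinGraph 0ℓ} → IsUnionClosedMonotone D P → .{{_ : NonZero n}} → .{{_ : NonZero n′}} →
                  P ⟨ H ⟩ → M * n < n′ → P ⟨ H′ ⟩
      H′-member P-closed PH Mn<n′ = embedded-member H P-closed PH em M Mn<n′ H′ ι ι-injective edges
        where
        edges : ∀ y y′ → T (adj H′ y y′) → ∃[ i ] ∃[ x ] ∃[ x′ ] ι y ≡ just (i , x) × ι y′ ≡ just (i , x′) × T (adj H x x′)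
        edges y y′ e with from-does e
        ... | _ , q , x , x′ , b , g , g′ , h =
          proj₁ (slot g) , x , x′ , ι-good g , trans (ι-good g′) (cong (λ i → just (i , x′)) (sym (slot-cong g g′))) , h

      Bad Near Lost Cut : Fin n′ → Set
      Bad y  = ¬ Good? y
      Near y = ∃[ u ] S′.piece u ≡ nothing × Within G′ (k + k) u y
      Lost y = ∃[ q ] S′.piece y ≡ just q × place q ≡ nothing
      Cut y  = ∃[ x ] S.piece x ≡ nothing × ∃[ q ] At y q x

      piece-walk : ∀ {y q} → ¬ Near y → ∀ {s r u v} → s + r ≤ k + k → Within G′ s y u → S′.piece u ≡ just q →
                   Within G′ r u v → S′.piece v ≡ just q
      piece-walk far s+r≤ yu e here = e
      piece-walk far {s} {suc r} s+r≤ yu e (step {v = u₁} a p) with S′.piece u₁ in eq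
      ... | nothing = ⊥-elim (far (u₁ , eq , Within-sym (Within-mono (≤-trans (m≤m+n (suc s) r) 1+s+r≤) (Within-step yu a))))
        where
        1+s+r≤ : suc s + r ≤ k + k
        1+s+r≤ = ≤-trans (≤-reflexive (sym (+-suc s r))) s+r≤
      ... | just q₁ = piece-walk far (≤-trans (≤-reflexive (sym (+-suc s r))) s+r≤) (Within-step yu a)
                        (trans eq (cong just (sym (S′.same a e eq)))) p

      -- A piece of G has radius k, so if y is farther than 2k from the separator
      -- then the walks joining the location of y to its whole piece lift to G′.
      good-unless : ∀ y → ¬ Near y → ¬ Lost y → ¬ Cut y → Good? y
      good-unless y far kept uncut with S′.piece y in e-piece
      ... | nothing = ⊥-elim (far (y , e-piece , here))
      ... | just q with place q in e-place
      ... | nothing = ⊥-elim (kept (q , refl , e-place))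
      ... | just (z′ , z , φ) with S.piece (LocalIso.to φ y) in e-x
      ... | nothing = ⊥-elim (uncut (_ , e-x , q , at e-piece φ e-place refl))
      ... | just b = q , _ , b , good (at e-piece φ e-place refl) e-x whole
        where
        open LocalIso φ
        z′y : Within G′ (R + K) z′ y
        z′y = At-ball e-piece e-place
        zx : Within G (R + K) z (to y)
        zx = subst (λ u → Within G (R + K) u (to y)) to-root (to-walk φ R+K≤ρ (here {r = 0}) z′y)
        whole : Whole q b
        whole x e = from x , at (piece-walk far {s = 0} ≤-refl here e-piece lifted) φ e-place (to-from (Within-mono R+K+2k≤ρ (Within-trans zx xx)))
          where
          xx : Within G (k + k) (to y) x
          xx = Within-trans (Within-sym (S.near e-x)) (S.near e)
          lifted : Within G′ (k + k) y (from x)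
          lifted = subst (λ u → Within G′ (k + k) u (from x)) (from-to (Within-mono R+K≤ρ z′y)) (to-walk (flip φ) R+K+2k≤ρ zx xx)

      bad-count : # Bad ≤ # (λ u → S′.piece u ≡ nothing) * B + (# Lost + # (λ x → S.piece x ≡ nothing) * M)
      bad-count = ≤-trans (#-∪ split) (+-mono-≤ (#-bound (λ y near → near) (λ u _ → balls u))
        (≤-trans (#-∪ (λ y c → c)) (+-monoʳ-≤ (# Lost) (#-bound (λ y cut → cut) (λ x _ → load x)))))
        where
        split : ∀ y → Bad y → Near y ⊎ (Lost y ⊎ Cut y)
        split y bad with em {Near y} | em {Lost y} | em {Cut y}
        ... | yes near | _      | _      = inj₁ near
        ... | no _     | yes l  | _      = inj₂ (inj₁ l)
        ... | no _     | no _   | yes c  = inj₂ (inj₂ c)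
        ... | no ¬near | no ¬l  | no ¬c  = ⊥-elim (bad (good-unless y ¬near ¬l ¬c))

      private
        T-xor : ∀ {a b} → T (a xor b) → (T b → T a) → T a × ¬ T b
        T-xor {true}  {false} _ _ = _ , λ ()
        T-xor {false} {true}  _ f = ⊥-elim (f _)

        xor-T : ∀ {a b} → T a → ¬ T b → T (a xor b)
        xor-T {true} {false} _ _  = _
        xor-T {true} {true}  _ ¬b = ⊥-elim (¬b _)

      Joined : Fin n′ → Fin n′ → Fin n → Fin n → Set
      Joined y y′ x x′ = ∃[ q ] At y q x × At y′ q x′

      removed-edge : ∀ y y′ → T (adj G′ y y′ xor adj H′ y y′) →
        (Bad y × T (adj G′ y y′)) ⊎ ((Bad y′ × T (adj G′ y y′)) ⊎ (∃[ x ] ∃[ x′ ] T (adj G x x′ xor adj H x x′) × Joined y y′ x x′))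
      removed-edge y y′ t with T-xor {adj G′ y y′} {adj H′ y y′} t (λ h → proj₁ (from-does h))
      ... | e , ¬h with em {Good? y} | em {Good? y′}
      ... | no bad | _ = inj₁ (bad , e)
      ... | yes _ | no bad = inj₂ (inj₁ (bad , e))
      ... | yes (q , x , b , good l p w) | yes (q′ , x′ , b′ , good l′ p′ w′) = inj₂ (inj₂ (x , x′ , xor-T (adj-x l l′) ¬adj-H , both))
        where
        q≡q′ : q ≡ q′
        q≡q′ = S′.same e (At.piece-y l) (At.piece-y l′)
        both : Joined y y′ x x′
        both = q , l , subst (λ q → At y′ q x′) (sym q≡q′) l′
        adj-x : At y q x → At y′ q′ x′ → T (adj G x x′)
        adj-x (at e₁ φ p₁ refl) (at e₂ φ₂ p₂ refl) with q≡q′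
        ... | refl with just-injective (trans (sym p₁) p₂)
        ... | refl = subst T (sym (LocalIso.to-adj φ (Within-mono R+K≤ρ (At-ball e₁ p₁)) (Within-mono R+K≤ρ (At-ball e₂ p₁)))) e
        ¬adj-H : ¬ T (adj H x x′)
        ¬adj-H h = ¬h (to-does (e , q , x , x′ , b , good l p w ,
          subst₂ (λ q b → Good y′ q x′ b) (sym q≡q′) (sym (S.same (adj-x l l′) p p′)) (good l′ p′ w′) , h))

      edit-count : ∣E G′ △E H′ ∣ ≤ d * # Bad + M * ∣E G △E H ∣
      edit-count = *-cancelˡ-≤ 2 (begin
        2 * ∣E G′ △E H′ ∣ ≡⟨ twice ∣E G′ △E H′ ∣ ⟩
        ∣E G′ △E H′ ∣ + ∣E G′ △E H′ ∣ ≡⟨ double-△ G′ H′ ⟩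
        ∑ (λ y → # (λ y′ → T (adj G′ y y′ xor adj H′ y y′)))
          ≤⟨ ∑-mono (λ y → ≤-trans (#-∪ (removed-edge y)) (+-monoʳ-≤ (# (λ y′ → Bad y × T (adj G′ y y′))) (#-∪ (λ y′ c → c)))) ⟩
        ∑ (λ y → # (λ y′ → Bad y × T (adj G′ y y′)) + (# (λ y′ → Bad y′ × T (adj G′ y y′)) + # (Moved y)))
          ≡⟨ trans (∑-distrib-+ _ _) (cong (_+_ (∑ (λ y → # (λ y′ → Bad y × T (adj G′ y y′))))) (∑-distrib-+ _ _)) ⟩
        ∑ (λ y → # (λ y′ → Bad y × T (adj G′ y y′))) + (∑ (λ y → # (λ y′ → Bad y′ × T (adj G′ y y′))) + ∑ (λ y → # (Moved y)))
          ≤⟨ +-mono-≤ first (+-mono-≤ second moved) ⟩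
        d * # Bad + (d * # Bad + M * ∑ (λ x → # (λ x′ → T (adj G x x′ xor adj H x x′))))
          ≡⟨ cong (λ z → d * # Bad + (d * # Bad + M * z)) (sym (double-△ G H)) ⟩
        d * # Bad + (d * # Bad + M * (∣E G △E H ∣ + ∣E G △E H ∣))
          ≡⟨ collect (d * # Bad) M ∣E G △E H ∣ ⟩
        2 * (d * # Bad + M * ∣E G △E H ∣)
          ∎)
        where
        open ≤-Reasoning
        twice : ∀ a → 2 * a ≡ a + a
        twice = solve-∀
        collect : ∀ a m e → a + (a + m * (e + e)) ≡ 2 * (a + m * e)
        collect = solve-∀
        Moved : Fin n′ → Fin n′ → Set
        Moved y y′ = ∃[ x ] ∃[ x′ ] T (adj G x x′ xor adj H x x′) × Joined y y′ x x′
        first : ∑ (λ y → # (λ y′ → Bad y × T (adj G′ y y′))) ≤ d * # Bad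
        first = begin
          ∑ (λ y → # (λ y′ → Bad y × T (adj G′ y y′))) ≡⟨ ∑-cong (λ y → ∑-cong (λ y′ → χ-× (Bad y) (T (adj G′ y y′)))) ⟩
          ∑ (λ y → ∑ (λ y′ → χ (Bad y) * χ (T (adj G′ y y′)))) ≡⟨ ∑-cong (λ y → sym (*-distribˡ-∑ (χ (Bad y)) (λ y′ → χ (T (adj G′ y y′))))) ⟩
          ∑ (λ y → χ (Bad y) * # (λ y′ → T (adj G′ y y′))) ≤⟨ ∑-mono (λ y → *-monoʳ-≤ (χ (Bad y)) (degrees y)) ⟩
          ∑ (λ y → χ (Bad y) * d) ≡⟨ sym (*-distribʳ-∑ d (λ y → χ (Bad y))) ⟩
          # Bad * d ≡⟨ *-comm (# Bad) d ⟩
          d * # Bad ∎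
        second : ∑ (λ y → # (λ y′ → Bad y′ × T (adj G′ y y′))) ≤ d * # Bad
        second = ≤-trans (≤-reflexive (trans (∑-comm (λ y y′ → χ (Bad y′ × T (adj G′ y y′))))
          (∑-cong (λ y′ → ∑-cong (λ y → χ-cong (λ (b , e) → b , adj-sym G′ e) (λ (b , e) → b , adj-sym G′ e)))))) first
        pairs-at : ∀ x x′ → ∑ (λ y → # (λ y′ → Joined y y′ x x′)) ≤ M
        pairs-at x x′ = ≤-trans (∑-mono (λ y → ≤-trans
          (#-unique (λ y₁ y₂ (q , l , l₁) (q₂ , l₂ , l₃) → At-injective l₁ (subst (λ q → At y₂ q x′) (proj₁ (At-functional l₂ l)) l₃)))
          (χ-mono (λ (y′ , q , l , _) → q , l)))) (load x)
        moved : ∑ (λ y → # (Moved y)) ≤ M * ∑ (λ x → # (λ x′ → T (adj G x x′ xor adj H x x′)))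
        moved = begin
          ∑ (λ y → # (Moved y))
            ≤⟨ ∑-mono (λ y → ∑-mono (λ y′ → ≤-trans (χ-∃ _) (∑-mono (λ x → χ-∃ _)))) ⟩
          ∑ (λ y → ∑ (λ y′ → ∑ (λ x → ∑ (λ x′ → F y y′ x x′))))
            ≡⟨ ∑-cong (λ y → ∑-comm (λ y′ x → ∑ (F y y′ x))) ⟩
          ∑ (λ y → ∑ (λ x → ∑ (λ y′ → ∑ (λ x′ → F y y′ x x′))))
            ≡⟨ ∑-cong (λ y → ∑-cong (λ x → ∑-comm (λ y′ x′ → F y y′ x x′))) ⟩
          ∑ (λ y → ∑ (λ x → ∑ (λ x′ → ∑ (λ y′ → F y y′ x x′))))
            ≡⟨ ∑-comm (λ y x → ∑ (λ x′ → ∑ (λ y′ → F y y′ x x′))) ⟩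
          ∑ (λ x → ∑ (λ y → ∑ (λ x′ → ∑ (λ y′ → F y y′ x x′))))
            ≡⟨ ∑-cong (λ x → ∑-comm (λ y x′ → ∑ (λ y′ → F y y′ x x′))) ⟩
          ∑ (λ x → ∑ (λ x′ → ∑ (λ y → ∑ (λ y′ → F y y′ x x′))))
            ≤⟨ ∑-mono (λ x → ∑-mono (λ x′ → cell x x′)) ⟩
          ∑ (λ x → ∑ (λ x′ → M * χ (T (adj G x x′ xor adj H x x′))))
            ≡⟨ sym (trans (*-distribˡ-∑ M (λ x → # (λ x′ → T (adj G x x′ xor adj H x x′)))) (∑-cong (λ x → *-distribˡ-∑ M (λ x′ → χ (T (adj G x x′ xor adj H x x′)))))) ⟩
          M * ∑ (λ x → # (λ x′ → T (adj G x x′ xor adj H x x′)))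
            ∎
          where
          F : Fin n′ → Fin n′ → Fin n → Fin n → ℕ
          F y y′ x x′ = χ (T (adj G x x′ xor adj H x x′) × Joined y y′ x x′)
          cell : ∀ x x′ → ∑ (λ y → ∑ (λ y′ → F y y′ x x′)) ≤ M * χ (T (adj G x x′ xor adj H x x′))
          cell x x′ with em {T (adj G x x′ xor adj H x x′)}
          ... | yes t = ≤-trans (∑-mono (λ y → ∑-mono (λ y′ → χ-mono proj₂)))
                          (≤-trans (pairs-at x x′) (≤-reflexive (sym (trans (cong (M *_) (χ-true t)) (*-identityʳ M)))))
          ... | no ¬t = ≤-trans (≤-reflexive (∑-zero (λ y → ∑-zero (λ y′ → χ-false (¬t ∘ proj₁))))) z≤n

      transplant : ∀ {D} {P : Pred FinGraph 0ℓ} → IsUnionClosedMonotone D P → .{{_ : NonZero n}} → .{{_ : NonZero n′}} →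
        P ⟨ H ⟩ → M * n < n′ →
        Σ[ H″ ∈ SimpleGraph (Fin n′) ] P ⟨ H″ ⟩ × ∃[ bad ] ∣E G′ △E H″ ∣ ≤ d * bad + M * ∣E G △E H ∣ ×
          bad ≤ # (λ u → S′.piece u ≡ nothing) * B + (# Lost + # (λ x → S.piece x ≡ nothing) * M)
      transplant P-closed PH Mn<n′ = H′ , H′-member P-closed PH Mn<n′ , # Bad , edit-count , bad-count

strict-quotient : ∀ m b .{{_ : NonZero m}} .{{_ : NonZero b}} → ∃[ a ] a * b < m × m ≤ suc a * b
strict-quotient (suc zero)    b = 0 , s≤s z≤n , ≤-trans (>-nonZero⁻¹ b) (≤-reflexive (sym (*-identityˡ b)))
strict-quotient (suc (suc m)) b with strict-quotient (suc m) b
... | a , ab<m , m≤ with suc m <? suc a * b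
... | yes m< = a , m<n⇒m<1+n ab<m , m<
... | no m≮  = suc a , s≤s (≮⇒≥ m≮) , ≤-trans (s≤s m≤) (+-monoˡ-≤ (suc a * b) (>-nonZero⁻¹ b))

module Comparisons (em : ExcludedMiddle 0ℓ) where
  open Indicators em
  open Separation em
  open Assignments em
  open Transplants em

  BoundedBalls : (ℕ → ℕ) → ∀ {n} → SimpleGraph (Fin n) → Set
  BoundedBalls f G = ∀ u r → 1 ≤ r → # (Within G r u) ≤ f r

  module Compare (d : ℕ) (1≤d : 1 ≤ d) (f : ℕ → ℕ) (sub : Subexponential f)
                 (P : Pred FinGraph 0ℓ) (P-closed : IsUnionClosedMonotone d P)
                 (e : ℕ) (1≤e : 1 ≤ e) where

    D : ℕ
    D = e * d

    private instance
      D≢0 : NonZero D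
      D≢0 = >-nonZero (*-mono-≤ 1≤e 1≤d)

    radius : ∀ A C .{{_ : NonZero A}} → ∃[ r ] 1 ≤ r × ∀ s → r ≤ s → C * (A ^ s * f s) < suc A ^ s
    radius A C = suc (proj₁ slow) , s≤s z≤n , λ s r≤s → proj₂ slow s (≤-trans (n≤1+n _) r≤s) (≤-trans (s≤s z≤n) r≤s)
      where
      slow : ∃[ r₀ ] ∀ r → r₀ ≤ r → 1 ≤ r → C * (A ^ r * f r) < suc A ^ r
      slow = subexponential sub A C

    separate : ∀ A .{{_ : NonZero A}} → ∃[ k ] 1 ≤ k × ∀ {n} (G : SimpleGraph (Fin n)) → BoundedBalls f G → Separated G (suc A) k
    separate A = k , 1≤k , λ G balls → separated G A k (λ x →
      ≤-<-trans (*-monoʳ-≤ (A ^ k) (balls x k 1≤k)) (≤-<-trans (≤-reflexive (sym (*-identityˡ _))) (proj₂ (proj₂ (radius A 1)) k ≤-refl)))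
      where
      k = proj₁ (radius A 1)
      1≤k = proj₁ (proj₂ (radius A 1))

    private instance
      4D≢0 : NonZero (4 * D)
      4D≢0 = m*n≢0 4 D
      8D≢0 : NonZero (8 * D)
      8D≢0 = m*n≢0 8 D

    k : ℕ
    k = proj₁ (separate (4 * D))

    B : ℕ
    B = f (k + k)

    K : ℕ
    K = proj₁ (separate (suc (4 * D * B)))

    1≤K : 1 ≤ K
    1≤K = proj₁ (proj₂ (separate (suc (4 * D * B))))

    t : ℕ
    t = 8 * D

    A : ℕ
    A = 2 * t * (K + K)

    private instance
      K≢0 : NonZero K
      K≢0 = >-nonZero 1≤K
      A≢0 : NonZero A
      A≢0 = m*n≢0 (2 * t) (K + K) {{m*n≢0 2 t}} {{>-nonZero (≤-trans 1≤K (m≤m+n K K))}}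

    R : ℕ
    R = proj₁ (radius A A)

    1≤R : 1 ≤ R
    1≤R = proj₁ (proj₂ (radius A A))

    F : ℕ
    F = f (R + K)

    ρ : ℕ
    ρ = (R + K) + (R + K) + (k + k)

    s : ℕ
    s = D * F * 64 + D * 16

    open Kernels em A K R using (Z; Z-tail)
    open Placements em A K R

    module _ {n n′ : ℕ} {G : SimpleGraph (Fin n)} {G′ : SimpleGraph (Fin n′)} {c : ℕ} {M : ℕ}
             {τ : Fin n → Fin c} {τ′ : Fin n′ → Fin c}
             (iso : ∀ {z z′} → τ z ≡ τ′ z′ → LocalIso ρ G′ z′ G z) (assigned : Assignment M τ τ′) where
      private module Assigned = Assignment assigned

      match-at : ∀ z′ m → Assigned.to z′ ≡ m → Maybe (Σ[ z ∈ Fin n ] LocalIso ρ G′ z′ G z)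
      match-at z′ nothing  eq = nothing
      match-at z′ (just z) eq = just (z , iso (Assigned.type eq))

      match : ∀ z′ → Maybe (Σ[ z ∈ Fin n ] LocalIso ρ G′ z′ G z)
      match z′ = match-at z′ (Assigned.to z′) refl

      match-just : ∀ {z′ z φ} m eq → match-at z′ m eq ≡ just (z , φ) → Assigned.to z′ ≡ just z
      match-just (just _) eq refl = eq

      match-nothing : ∀ {z′} m eq → match-at z′ m eq ≡ nothing → Assigned.to z′ ≡ nothing
      match-nothing nothing eq refl = eq

      match-capacity : ∀ z → # (λ z′ → ∃[ φ ] match z′ ≡ just (z , φ)) ≤ M
      match-capacity z = ≤-trans (#-mono (λ z′ (φ , eq) → match-just _ refl eq)) (Assigned.capacity z)

      unmatched-count : # (λ z′ → match z′ ≡ nothing) ≤ ∑ (λ i → # (λ z′ → τ′ z′ ≡ i) ∸ M * # (λ z → τ z ≡ i))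
      unmatched-count = begin
        # (λ z′ → match z′ ≡ nothing) ≤⟨ #-mono (λ z′ → match-nothing _ refl) ⟩
        # (λ z′ → Assigned.to z′ ≡ nothing) ≡⟨ sym (∑-types τ′ (λ z′ → Assigned.to z′ ≡ nothing)) ⟩
        ∑ (λ i → # (λ z′ → τ′ z′ ≡ i × Assigned.to z′ ≡ nothing)) ≤⟨ ∑-mono Assigned.unserved ⟩
        ∑ (λ i → # (λ z′ → τ′ z′ ≡ i) ∸ M * # (λ z → τ z ≡ i)) ∎
        where open ≤-Reasoning

    module _ (c : ℕ) where

      h : ℕ
      h = suc (D * F * 64 * c)

      Similar : ∀ {n n′} → (Fin n → Fin c) → (Fin n′ → Fin c) → Set
      Similar {n} {n′} τ τ′ = ∀ i → h * (# (λ z′ → τ′ z′ ≡ i) * n) ≤ h * (# (λ z → τ z ≡ i) * n′) + n * n′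

      threshold : ℕ → ℕ
      threshold n = suc (2 * (suc s * n * (suc n * (f K * f K)))) * (suc s * n) + D * F * 64 * (n * suc s) + 1

      module _ {n n′ : ℕ} .{{_ : NonZero n}} (n′-large : threshold n ≤ n′) where

        private
          n′≢0 : NonZero n′
          n′≢0 = >-nonZero (≤-trans (m≤n+m 1 _) n′-large)

          sn≢0 : NonZero (suc s * n)
          sn≢0 = m*n≢0 (suc s) n

          quotient : ∃[ a ] a * (suc s * n) < n′ × n′ ≤ suc a * (suc s * n)
          quotient = strict-quotient n′ (suc s * n) {{n′≢0}} {{sn≢0}}

        a : ℕ
        a = proj₁ quotient

        n′-upper : n′ ≤ suc a * (suc s * n)
        n′-upper = proj₂ (proj₂ quotient)

        M : ℕ
        M = s * a

        copies-fit : (M + a) * n < n′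
        copies-fit = ≤-<-trans (≤-reflexive (rearrange s a n)) (proj₁ (proj₂ quotient))
          where
          rearrange : ∀ s a n → (s * a + a) * n ≡ a * ((1 + s) * n)
          rearrange = solve-∀

        a-lower : 2 * (suc s * n * (suc n * (f K * f K))) < a
        a-lower = ≤-pred (*-cancelʳ-< (suc s * n) _ _ (begin-strict
          suc (2 * (suc s * n * (suc n * (f K * f K)))) * (suc s * n) <⟨ m<m+n _ {1} (s≤s z≤n) ⟩
          _ + 1 ≤⟨ +-monoˡ-≤ 1 (m≤m+n _ (D * F * 64 * (n * suc s))) ⟩
          threshold n ≤⟨ n′-large ⟩
          n′ ≤⟨ n′-upper ⟩
          suc a * (suc s * n) ∎))
          where open ≤-Reasoning

        a-large : n′ * (suc n * (f K * f K)) < a * a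
        a-large = begin-strict
          n′ * Q ≤⟨ *-monoˡ-≤ Q n′-upper ⟩
          suc a * (suc s * n) * Q ≡⟨ *-assoc (suc a) (suc s * n) Q ⟩
          suc a * (suc s * n * Q) ≤⟨ *-monoˡ-≤ (suc s * n * Q) (+-monoˡ-≤ a 1≤a) ⟩
          (a + a) * (suc s * n * Q) ≡⟨ rearrange a (suc s * n * Q) ⟩
          a * (2 * (suc s * n * Q)) <⟨ *-monoʳ-< a {{>-nonZero 1≤a}} a-lower ⟩
          a * a ∎
          where
          open ≤-Reasoning
          Q = suc n * (f K * f K)
          1≤a : 1 ≤ a
          1≤a = ≤-trans (s≤s z≤n) a-lower
          rearrange : ∀ a q → (a + a) * q ≡ a * (2 * q)
          rearrange = solve-∀

        private
          sna≤n′ : s * (n * a) ≤ n′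
          sna≤n′ = ≤-trans (≤-trans (≤-reflexive (rearrange s n a)) (m≤m+n (s * a * n) (a * n)))
            (≤-trans (≤-reflexive (sym (*-distribʳ-+ n (s * a) a))) (<⇒≤ copies-fit))
            where
            rearrange : ∀ s n a → s * (n * a) ≡ s * a * n
            rearrange = solve-∀

          64DFna : D * F * 64 * (n * a) ≤ n′
          64DFna = ≤-trans (*-monoˡ-≤ (n * a) (m≤m+n (D * F * 64) (D * 16))) sna≤n′

          16Da : D * 16 * a ≤ n′
          16Da = ≤-trans (*-mono-≤ (m≤n+m (D * 16) (D * F * 64)) (m≤n*m a n)) sna≤n′

          64DFns : D * F * 64 * (n * suc s) ≤ n′
          64DFns = ≤-trans (m≤n+m _ _) (≤-trans (m≤m+n _ 1) n′-large)

        unmatched-bound : ∀ {τ : Fin n → Fin c} {τ′ : Fin n′ → Fin c} → Similar τ τ′ →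
          D * F * 16 * ∑ (λ i → # (λ z′ → τ′ z′ ≡ i) ∸ M * # (λ z → τ z ≡ i)) ≤ n′
        unmatched-bound {τ} {τ′} similar = *-cancelˡ-≤ (4 * h) (begin
          4 * h * (D * F * 16 * Δ) ≡⟨ rearrange₁ h (D * F) Δ ⟩
          D * F * 64 * (h * Δ) ≤⟨ *-monoʳ-≤ (D * F * 64) total ⟩
          D * F * 64 * (h * (n * (a + suc s)) + c * n′) ≡⟨ rearrange₂ (D * F * 64) h n a (suc s) c n′ ⟩
          h * (D * F * 64 * (n * a)) + h * (D * F * 64 * (n * suc s)) + D * F * 64 * c * n′
            ≤⟨ +-mono-≤ (+-mono-≤ (*-monoʳ-≤ h 64DFna) (*-monoʳ-≤ h 64DFns)) (*-monoˡ-≤ n′ (n≤1+n (D * F * 64 * c))) ⟩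
          h * n′ + h * n′ + h * n′ ≤⟨ m≤m+n _ (h * n′) ⟩
          h * n′ + h * n′ + h * n′ + h * n′ ≡⟨ rearrange₃ h n′ ⟩
          4 * h * n′ ∎)
          where
          open ≤-Reasoning
          N N′ : Fin c → ℕ
          N i = # (λ z → τ z ≡ i)
          N′ i = # (λ z′ → τ′ z′ ≡ i)
          Δ = ∑ (λ i → N′ i ∸ M * N i)
          rearrange₁ : ∀ h x u → 4 * h * (x * 16 * u) ≡ x * 64 * (h * u)
          rearrange₁ = solve-∀
          rearrange₂ : ∀ x h n a s c m → x * (h * (n * (a + s)) + c * m) ≡ h * (x * (n * a)) + h * (x * (n * s)) + x * c * m
          rearrange₂ = solve-∀
          rearrange₃ : ∀ h m → h * m + h * m + h * m + h * m ≡ 4 * h * m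
          rearrange₃ = solve-∀
          type : ∀ i → h * (N′ i ∸ M * N i) ≤ h * (N i * (a + suc s)) + n′
          type i = ≤-trans (≤-reflexive (*-distribˡ-∸ h (N′ i) (M * N i))) (m≤n+o⇒m∸n≤o (h * N′ i) (h * (M * N i)) (*-cancelʳ-≤ _ _ n (begin
            h * N′ i * n ≡⟨ *-assoc h (N′ i) n ⟩
            h * (N′ i * n) ≤⟨ similar i ⟩
            h * (N i * n′) + n * n′ ≤⟨ +-monoˡ-≤ (n * n′) (*-monoʳ-≤ h (*-monoʳ-≤ (N i) n′-upper)) ⟩
            h * (N i * (suc a * (suc s * n))) + n * n′ ≡⟨ regroup h (N i) a s n n′ ⟩
            (h * (s * a * N i) + (h * (N i * (a + suc s)) + n′)) * n ∎)))
            where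
            regroup : ∀ h x a s n m → h * (x * ((1 + a) * ((1 + s) * n))) + n * m ≡ (h * (s * a * x) + (h * (x * (a + (1 + s))) + m)) * n
            regroup = solve-∀
          total : h * Δ ≤ h * (n * (a + suc s)) + c * n′
          total = begin
            h * Δ ≡⟨ *-distribˡ-∑ h (λ i → N′ i ∸ M * N i) ⟩
            ∑ (λ i → h * (N′ i ∸ M * N i)) ≤⟨ ∑-mono type ⟩
            ∑ (λ i → h * (N i * (a + suc s)) + n′) ≡⟨ ∑-distrib-+ (λ i → h * (N i * (a + suc s))) (λ _ → n′) ⟩
            ∑ (λ i → h * (N i * (a + suc s))) + ∑ {c} (λ _ → n′) ≡⟨ cong₂ _+_
                (trans (sym (*-distribˡ-∑ h (λ i → N i * (a + suc s)))) (cong (h *_) (sym (*-distribʳ-∑ (a + suc s) N)))) (∑-const c n′) ⟩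
            h * (∑ N * (a + suc s)) + c * n′ ≡⟨ cong (λ z → h * (z * (a + suc s)) + c * n′) all-types ⟩
            h * (n * (a + suc s)) + c * n′ ∎
            where
            all-types : ∑ N ≡ n
            all-types = trans (∑-cong (λ i → #-cong {Q = λ z → τ z ≡ i × Fin n} (λ z eq → eq , z) (λ z → proj₁)))
                              (trans (∑-types τ (λ _ → Fin n)) (#-all (λ z → z)))

        module _ (G : SimpleGraph (Fin n)) (G′ : SimpleGraph (Fin n′)) (balls : BoundedBalls f G) (balls′ : BoundedBalls f G′)
                 (degrees′ : ∀ u → # (λ v → T (adj G′ u v)) ≤ d)
                 (τ : Fin n → Fin c) (τ′ : Fin n′ → Fin c)
                 (iso : ∀ {z z′} → τ z ≡ τ′ z′ → LocalIso ρ G′ z′ G z) (similar : Similar τ τ′)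
                 (H : SimpleGraph (Fin n)) where

          S : Separated G (suc (4 * D)) k
          S = proj₂ (proj₂ (separate (4 * D))) G balls

          S′ : Separated G′ (suc (suc (4 * D * B))) K
          S′ = proj₂ (proj₂ (separate (suc (4 * D * B)))) G′ balls′

          assigned : Assignment M τ τ′
          assigned = assignment M τ τ′

          unmatched : ℕ
          unmatched = # (λ z′ → match iso assigned z′ ≡ nothing)

          placed : Placed G G′ t ρ (Separated.piece S′) (M + a) (n′ + t * (F * unmatched + a))
          placed = Place.placed G G′ f balls′ t ρ 1≤K 1≤R (m≤m+n _ (k + k))
            (λ u → Z-tail t refl 1≤R f (λ r R≤r → <⇒≤ (proj₂ (proj₂ (radius A A)) r R≤r)) G′ u (balls′ u))
            (Separated.piece S′) (Separated.near S′) (match iso assigned) M (match-capacity iso assigned) a a-large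

          lost-count : ℕ
          lost-count = # (λ y → ∃[ q ] Separated.piece S′ y ≡ just q × Placed.place placed q ≡ nothing)

          lost-bound : 4 * D * lost-count ≤ n′
          lost-bound = *-cancelˡ-≤ 2 (begin
            2 * (4 * D * lost-count) ≡⟨ rearrange₁ D lost-count ⟩
            t * lost-count ≤⟨ Placed.lost placed ⟩
            n′ + t * (F * unmatched + a) ≤⟨ +-monoʳ-≤ n′ (*-cancelˡ-≤ 2 halves) ⟩
            n′ + n′ ≡⟨ cong (_+_ n′) (sym (+-identityʳ n′)) ⟩
            2 * n′ ∎)
            where
            open ≤-Reasoning
            rearrange₁ : ∀ D l → 2 * (4 * D * l) ≡ 8 * D * l
            rearrange₁ = solve-∀
            rearrange₂ : ∀ D F u a → 2 * (8 * D * (F * u + a)) ≡ D * F * 16 * u + D * 16 * a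
            rearrange₂ = solve-∀
            halves : 2 * (t * (F * unmatched + a)) ≤ 2 * n′
            halves = begin
              2 * (t * (F * unmatched + a)) ≡⟨ rearrange₂ D F unmatched a ⟩
              D * F * 16 * unmatched + D * 16 * a ≤⟨ +-mono-≤ (≤-trans (*-monoʳ-≤ (D * F * 16) (unmatched-count iso assigned)) (unmatched-bound similar)) 16Da ⟩
              n′ + n′ ≡⟨ cong (_+_ n′) (sym (+-identityʳ n′)) ⟩
              2 * n′ ∎

          X X′ : ℕ
          X  = # (λ x → Separated.piece S x ≡ nothing)
          X′ = # (λ u → Separated.piece S′ u ≡ nothing)

          transplanted : P ⟨ H ⟩ → Σ[ H″ ∈ SimpleGraph (Fin n′) ] P (⟨_⟩ {{n′≢0}} H″) ×
            ∃[ bad ] ∣E G′ △E H″ ∣ ≤ d * bad + (M + a) * ∣E G △E H ∣ × bad ≤ X′ * B + (lost-count + X * (M + a))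
          transplanted PH = Transplantation.transplant G H G′ (suc (4 * D)) (suc (suc (4 * D * B))) k K R ρ (M + a) d B degrees′
            (λ u → balls′ u (k + k) (≤-trans (proj₁ (proj₂ (separate (4 * D)))) (m≤m+n k k)))
            S S′ (≤-trans (m≤m+n (R + K) (R + K)) (m≤m+n _ (k + k))) (+-monoˡ-≤ (k + k) (m≤m+n (R + K) (R + K)))
            (Placed.place placed) (Placed.place-near placed) (Placed.load placed) P-closed {{it}} {{n′≢0}} PH copies-fit

          bad-bound : ∀ {bad} → bad ≤ X′ * B + (lost-count + X * (M + a)) → D * bad ≤ n′
          bad-bound {bad} few-bad = *-cancelˡ-≤ 4 (begin
            4 * (D * bad) ≤⟨ *-monoʳ-≤ 4 (*-monoʳ-≤ D few-bad) ⟩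
            4 * (D * (X′ * B + (lost-count + X * (M + a)))) ≡⟨ expand D X′ B lost-count X (M + a) ⟩
            4 * D * B * X′ + (4 * D * lost-count + 4 * D * X * (M + a))
              ≤⟨ +-mono-≤ (≤-trans (*-monoˡ-≤ X′ (≤-trans (n≤1+n (4 * D * B)) (n≤1+n (suc (4 * D * B))))) (Separated.few S′))
                 (+-mono-≤ lost-bound (≤-trans (*-monoˡ-≤ (M + a) (≤-trans (*-monoˡ-≤ X (n≤1+n (4 * D))) (Separated.few S)))
                   (≤-trans (≤-reflexive (*-comm n (M + a))) (<⇒≤ copies-fit)))) ⟩
            n′ + (n′ + n′) ≤⟨ m≤n+m _ n′ ⟩
            n′ + (n′ + (n′ + n′)) ≡⟨ cong (λ z → n′ + (n′ + (n′ + z))) (sym (+-identityʳ n′)) ⟩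
            4 * n′ ∎)
            where
            open ≤-Reasoning
            expand : ∀ D x b l y m → 4 * (D * (x * b + (l + y * m))) ≡ 4 * D * b * x + (4 * D * l + 4 * D * y * m)
            expand = solve-∀

          comparison : P ⟨ H ⟩ → Σ[ H″ ∈ SimpleGraph (Fin n′) ] P (⟨_⟩ {{n′≢0}} H″) ×
                       e * (∣E G′ △E H″ ∣ * n) ≤ e * (∣E G △E H ∣ * n′) + n * n′
          comparison PH = proj₁ (transplanted PH) , proj₁ (proj₂ (transplanted PH)) , edit-bound (proj₂ (proj₂ (transplanted PH)))
            where
            open ≤-Reasoning
            expand : ∀ e d b m x n → e * ((d * b + m * x) * n) ≡ e * (x * (m * n)) + n * (e * d * b)
            expand = solve-∀
            edit-bound : ∀ {y} → ∃[ bad ] y ≤ d * bad + (M + a) * ∣E G △E H ∣ × bad ≤ X′ * B + (lost-count + X * (M + a)) →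
                         e * (y * n) ≤ e * (∣E G △E H ∣ * n′) + n * n′
            edit-bound {y} (bad , edits , few-bad) = begin
              e * (y * n) ≤⟨ *-monoʳ-≤ e (*-monoˡ-≤ n edits) ⟩
              e * ((d * bad + (M + a) * ∣E G △E H ∣) * n) ≡⟨ expand e d bad (M + a) ∣E G △E H ∣ n ⟩
              e * (∣E G △E H ∣ * ((M + a) * n)) + n * (D * bad)
                ≤⟨ +-mono-≤ (*-monoʳ-≤ e (*-monoʳ-≤ ∣E G △E H ∣ (<⇒≤ copies-fit))) (*-monoʳ-≤ n (bad-bound few-bad)) ⟩
              e * (∣E G △E H ∣ * n′) + n * n′ ∎

RootedIso-trans : ∀ {U V W : Set} {G : SimpleGraph U} {x} {H : SimpleGraph V} {y} {K : SimpleGraph W} {z} →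
                  RootedIso G x H y → RootedIso H y K z → RootedIso G x K z
RootedIso-trans (φ , e) (ψ , e′) = ≅-trans φ ψ , trans (cong (Inverse.to (bijection ψ)) e) e′

RootedIso-sym : ∀ {V W : Set} {G : SimpleGraph V} {x} {H : SimpleGraph W} {y} → RootedIso G x H y → RootedIso H y G x
RootedIso-sym (φ , e) = ≅-sym φ , trans (cong (Inverse.from (bijection φ)) (sym e)) (Inverse.strictlyInverseʳ (bijection φ) _)

module BallTypes (em : ExcludedMiddle 0ℓ) where
  open Indicators em
  open FromRelation em

  record Enumeration {n} (P : Fin n → Set) : Set where
    field
      size      : ℕ
      size≤     : size ≤ # P
      element   : Fin size → Fin n
      injective : ∀ {i j} → element i ≡ element j → i ≡ j
      member    : ∀ i → P (element i)
      index     : ∀ v → P v → Fin size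
      found     : ∀ v p → element (index v p) ≡ v

  enumeration : ∀ {n} (P : Fin n → Set) → Enumeration P
  enumeration {zero} P = record
    { size = 0 ; size≤ = z≤n ; element = λ () ; injective = λ { {()} } ; member = λ () ; index = λ () ; found = λ () }
  enumeration {suc n} P with em {P zero} | enumeration (P ∘ suc)
  ... | no ¬p | E = record
    { size      = size
    ; size≤     = ≤-trans size≤ (≤-trans (m≤n+m _ (χ (P zero))) (≤-reflexive (sym (∑-suc (λ i → χ (P i))))))
    ; element   = suc ∘ element
    ; injective = injective ∘ Fin.suc-injective
    ; member    = member
    ; index     = index′
    ; found     = found′
    }
    where
    open Enumeration E
    index′ : ∀ v → P v → Fin size
    index′ zero    p = ⊥-elim (¬p p)
    index′ (suc v) p = index v p
    found′ : ∀ v p → suc (element (index′ v p)) ≡ v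
    found′ zero    p = ⊥-elim (¬p p)
    found′ (suc v) p = cong suc (found v p)
  ... | yes p₀ | E = record
    { size      = suc size
    ; size≤     = ≤-trans (+-mono-≤ (≤-reflexive (sym (χ-true p₀))) size≤) (≤-reflexive (sym (∑-suc (λ i → χ (P i)))))
    ; element   = element′
    ; injective = injective′ _ _
    ; member    = member′
    ; index     = index′
    ; found     = found′
    }
    where
    open Enumeration E
    element′ : Fin (suc size) → Fin (suc n)
    element′ zero    = zero
    element′ (suc i) = suc (element i)
    injective′ : ∀ i j → element′ i ≡ element′ j → i ≡ j
    injective′ zero    zero    e = refl
    injective′ (suc i) (suc j) e = cong suc (injective (Fin.suc-injective e))
    member′ : ∀ i → P (element′ i)
    member′ zero    = p₀
    member′ (suc i) = member i
    index′ : ∀ v → P v → Fin (suc size)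
    index′ zero    p = zero
    index′ (suc v) p = suc (index v p)
    found′ : ∀ v p → element′ (index′ v p) ≡ v
    found′ zero    p = refl
    found′ (suc v) p = cong suc (found v p)

  least : ∀ {n} (P : Fin n → Set) → ∃ P → ∃[ i ] P i × ∀ j → j Fin.< i → ¬ P j
  least {suc n} P (i , p) with em {P zero}
  ... | yes p₀ = zero , p₀ , λ j ()
  least {suc n} P (zero  , p) | no ¬p₀ = ⊥-elim (¬p₀ p)
  least {suc n} P (suc i , p) | no ¬p₀ with least (P ∘ suc) (i , p)
  ... | j , q , minimal = suc j , q , λ where
    zero    _         → ¬p₀
    (suc l) (s≤s l<j) → minimal l l<j

  module _ {n} (G : SimpleGraph (Fin n)) (ρ : ℕ) (x : Fin n) where

    in-ball : (u : BallVertex G ρ x) → Within G ρ x (value u)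
    in-ball (u , [ p ]) = recompute em p

    module Shape (d : ℕ) (degrees : ∀ v → degree G v ≤ d) where
      open Enumeration (enumeration (Within G ρ x))

      numbering : BallVertex G ρ x ↔ Fin size
      numbering = mk↔ₛ′ (λ u → index (value u) (in-ball u)) (λ i → element i , [ member i ])
        (λ i → injective (found _ _)) (λ u → value-injective (found (value u) (in-ball u)))

      shape-root : Fin size
      shape-root = Inverse.to numbering (ballRoot G ρ x)

      size≢0 : NonZero size
      size≢0 = nonempty shape-root
        where
        nonempty : ∀ {m} → Fin m → NonZero m
        nonempty {suc m} _ = _

      shape-graph : SimpleGraph (Fin size)
      shape-graph = pullback element G

      shape-walk : ∀ {s r u v} (ball-u : Within G ρ x u) (ball-v : Within G ρ x v) → s + r ≤ ρ → Within G s x u → Within G r u v →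
                   Within shape-graph r (index u ball-u) (index v ball-v)
      shape-walk ball-u ball-v s+r≤ρ xu here = subst (Within shape-graph _ _) (injective (trans (found _ ball-u) (sym (found _ ball-v)))) here
      shape-walk {s} {suc r} ball-u ball-v s+r≤ρ xu (step {v = w} e p) = step
        (subst T (sym (cong₂ (adj G) (found _ ball-u) (found _ ball-w))) e) (shape-walk ball-w ball-v 1+s+r≤ρ (Within-step xu e) p)
        where
        1+s+r≤ρ : suc s + r ≤ ρ
        1+s+r≤ρ = ≤-trans (≤-reflexive (sym (+-suc s r))) s+r≤ρ
        ball-w : Within G ρ x w
        ball-w = Within-mono (≤-trans (m≤m+n (suc s) r) 1+s+r≤ρ) (Within-step xu e)

      shape-radius : ∀ i → Within shape-graph ρ shape-root i
      shape-radius i = subst (Within shape-graph ρ shape-root) (injective (found _ _))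
        (shape-walk (in-ball (ballRoot G ρ x)) (member i) ≤-refl (here {r = 0}) (member i))

      ball-type : U ρ d
      ball-type = record
        { shape = ⟨_⟩ {{size≢0}} shape-graph
        ; root      = shape-root
        ; bounded   = λ i → ≤-trans (≤-reflexive (degree≡# shape-graph i))
            (≤-trans (#-injection (λ j _ → element j) (λ j e → e) (λ j j′ _ _ → injective))
            (≤-trans (≤-reflexive (sym (degree≡# G (element i)))) (degrees (element i))))
        ; connected = λ i j → ρ + ρ , Within-trans (Within-sym (shape-radius i)) (shape-radius j)
        ; radius    = shape-radius
        }

      ball-type-iso : RootedIso (ball G ρ x) (ballRoot G ρ x) (graph (shape ball-type)) (root ball-type)
      ball-type-iso = record { bijection = numbering ; preserves = λ u v → cong₂ (adj G) (found _ _) (found _ _) } , refl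

      order-ball-type : order (shape ball-type) ≤ # (Within G ρ x)
      order-ball-type = size≤

  module _ {n n′} {G : SimpleGraph (Fin n)} {G′ : SimpleGraph (Fin n′)} {ρ : ℕ} {x : Fin n} {x′ : Fin n′} where

    private
      module Direction {m m′} {H : SimpleGraph (Fin m)} {H′ : SimpleGraph (Fin m′)} {y : Fin m} {y′ : Fin m′}
                       (φ : ball H ρ y ≅ ball H′ ρ y′) where
        forward : Fin m → Fin m′
        forward u with em {Within H ρ y u}
        ... | yes p = value (Inverse.to (bijection φ) (u , [ p ]))
        ... | no _  = y′

        forward-≡ : ∀ {u} (p : Within H ρ y u) → forward u ≡ value (Inverse.to (bijection φ) (u , [ p ]))
        forward-≡ {u} p with em {Within H ρ y u}
        ... | yes _ = refl
        ... | no ¬p = ⊥-elim (¬p p)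

        forward-ball : ∀ {u} → Within H ρ y u → Within H′ ρ y′ (forward u)
        forward-ball p = subst (Within H′ ρ y′) (sym (forward-≡ p)) (in-ball H′ ρ y′ (Inverse.to (bijection φ) (_ , [ p ])))

    fromRootedIso : RootedIso (ball G ρ x) (ballRoot G ρ x) (ball G′ ρ x′) (ballRoot G′ ρ x′) → LocalIso ρ G x G′ x′
    fromRootedIso (φ , e) = record
      { to        = F.forward
      ; from      = B.forward
      ; to-root   = trans (F.forward-≡ here) (cong value e)
      ; to-ball   = F.forward-ball
      ; from-ball = B.forward-ball
      ; from-to   = λ p → trans (B.forward-≡ (F.forward-ball p)) (cong value (trans
          (cong (Inverse.from (bijection φ)) (value-injective (F.forward-≡ p))) (Inverse.strictlyInverseʳ (bijection φ) (_ , [ p ]))))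
      ; to-from   = λ p → trans (F.forward-≡ (B.forward-ball p)) (cong value (trans
          (cong (Inverse.to (bijection φ)) (value-injective (B.forward-≡ p))) (Inverse.strictlyInverseˡ (bijection φ) (_ , [ p ]))))
      ; to-adj    = λ p p′ → trans (cong₂ (adj G′) (F.forward-≡ p) (F.forward-≡ p′)) (preserves φ (_ , [ p ]) (_ , [ p′ ]))
      }
      where
      module F = Direction φ
      module B = Direction (≅-sym φ)

  module _ (b : ℕ) where

    private
      bit : Bool → Fin 2
      bit false = zero
      bit true  = suc zero

      bit-injective : ∀ {p q} → bit p ≡ bit q → p ≡ q
      bit-injective {false} {false} e = refl
      bit-injective {true}  {true}  e = refl

      T-injective : ∀ {p q} → (T p → T q) → (T q → T p) → p ≡ q
      T-injective {false} {false} f g = refl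
      T-injective {true}  {true}  f g = refl
      T-injective {true}  {false} f g = ⊥-elim (f _)
      T-injective {false} {true}  f g = ⊥-elim (g _)

    codes : ℕ
    codes = suc b * ((2 ^ b) ^ b * b)

    padded : ∀ {m} → m ≤ b → SimpleGraph (Fin m) → Fin b → Fin b → Bool
    padded m≤b G i j = does (em {∃[ u ] ∃[ v ] inject≤ u m≤b ≡ i × inject≤ v m≤b ≡ j × T (adj G u v)})

    padded-adj : ∀ {m} (m≤b : m ≤ b) (G : SimpleGraph (Fin m)) u v → padded m≤b G (inject≤ u m≤b) (inject≤ v m≤b) ≡ adj G u v
    padded-adj m≤b G u v = T-injective
      (λ t → edge (from-does t)) (λ e → to-does (u , v , refl , refl , e))
      where
      edge : ∃[ u′ ] ∃[ v′ ] inject≤ u′ m≤b ≡ inject≤ u m≤b × inject≤ v′ m≤b ≡ inject≤ v m≤b × T (adj G u′ v′) → T (adj G u v)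
      edge (u′ , v′ , e , e′ , a) = subst₂ (λ u v → T (adj G u v)) (Fin.inject≤-injective m≤b m≤b u′ u e) (Fin.inject≤-injective m≤b m≤b v′ v e′) a

    encode : ∀ {m} → m ≤ b → SimpleGraph (Fin m) → Fin m → Fin codes
    encode m≤b G r = combine (fromℕ< (s≤s m≤b)) (combine (funToFin (λ i → funToFin (λ j → bit (padded m≤b G i j)))) (inject≤ r m≤b))

    encode-injective : ∀ {m m′} (m≤b : m ≤ b) (m′≤b : m′ ≤ b) (G : SimpleGraph (Fin m)) r (G′ : SimpleGraph (Fin m′)) r′ →
                       encode m≤b G r ≡ encode m′≤b G′ r′ → RootedIso G r G′ r′
    encode-injective {m} {m′} m≤b m′≤b G r G′ r′ eq with Fin.combine-injective (fromℕ< (s≤s m≤b)) _ (fromℕ< (s≤s m′≤b)) _ eq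
    ... | order-eq , rest with Fin.fromℕ<-injective m m′ (s≤s m≤b) (s≤s m′≤b) order-eq
    ... | refl with Fin.combine-injective (funToFin (λ i → funToFin (λ j → bit (padded m≤b G i j)))) _ (funToFin (λ i → funToFin (λ j → bit (padded m≤b G′ i j)))) _ rest
    ... | matrix-eq , root-eq = record
      { bijection = mk↔ₛ′ (λ u → u) (λ u → u) (λ _ → refl) (λ _ → refl)
      ; preserves = λ u v → trans (sym (padded-adj m≤b G′ u v)) (trans (sym (entries (inject≤ u m≤b) (inject≤ v m≤b))) (padded-adj m≤b G u v))
      } , Fin.inject≤-injective m≤b m≤b r r′ root-eq
      where
      funToFin-injective : ∀ {k l} {f g : Fin k → Fin l} → funToFin f ≡ funToFin g → ∀ i → f i ≡ g i
      funToFin-injective {f = f} {g} e i = trans (sym (Fin.finToFun-funToFin f i)) (trans (cong (λ c → finToFun c i) e) (Fin.finToFun-funToFin g i))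
      entries : ∀ i j → padded m≤b G i j ≡ padded m≤b G′ i j
      entries i j = bit-injective (funToFin-injective (funToFin-injective matrix-eq i) j)

    module _ (ρ d : ℕ) where

      HasCode : Fin codes → U ρ d → Set
      HasCode i α = Σ[ small ∈ order (shape α) ≤ b ] encode small (graph (shape α)) (root α) ≡ i

      representative : Fin codes → Maybe (U ρ d)
      representative i with em {∃ (HasCode i)}
      ... | yes (α , _) = just α
      ... | no _        = nothing

      Represents : ∀ {V : Set} → SimpleGraph V → V → Fin codes → Set
      Represents H y i = ∃[ α ] representative i ≡ just α × RootedIso H y (graph (shape α)) (root α)

      represented : (β : U ρ d) → order (shape β) ≤ b → ∃ (Represents (graph (shape β)) (root β))
      represented β small = i , has-code
        where
        i = encode small (graph (shape β)) (root β)
        has-code : Represents (graph (shape β)) (root β) i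
        has-code with em {∃ (HasCode i)}
        ... | yes (α , small′ , eq) = α , refl , encode-injective small small′ _ _ _ _ (sym eq)
        ... | no none = ⊥-elim (none (β , small , refl))

      BallHasCode : ∀ {n} → SimpleGraph (Fin n) → Fin n → Fin codes → Set
      BallHasCode G x = Represents (ball G ρ x) (ballRoot G ρ x)

      module Classify {n} (G : SimpleGraph (Fin n)) (degrees : ∀ v → degree G v ≤ d) (small : ∀ v → # (Within G ρ v) ≤ b) where

        abstract
          classified : ∀ x → ∃[ i ] BallHasCode G x i × ∀ j → j Fin.< i → ¬ BallHasCode G x j
          classified x = least (BallHasCode G x) (extend (represented ball-type (≤-trans order-ball-type (small x))))
            where
            open Shape G ρ x d degrees
            extend : ∃ (Represents (graph (shape ball-type)) (root ball-type)) → ∃ (BallHasCode G x)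
            extend (i , α , e , iso) = i , α , e , RootedIso-trans {H = graph (shape ball-type)} ball-type-iso iso

        ball-code : Fin n → Fin codes
        ball-code x = proj₁ (classified x)

      -- Different numberings of a ball have different codes; only the least one counts.
      Canonical : Fin codes → U ρ d → Set
      Canonical i α = representative i ≡ just α × ∀ j → j Fin.< i → ¬ Represents (graph (shape α)) (root α) j

      module _ {n} {G : SimpleGraph (Fin n)} (degrees : ∀ v → degree G v ≤ d) (small : ∀ v → # (Within G ρ v) ≤ b) where
        open Classify G degrees small

        private
          at-code : ∀ {x i} → ball-code x ≡ i → BallHasCode G x i × ∀ j → j Fin.< i → ¬ BallHasCode G x j
          at-code {x} refl = proj₂ (classified x)

        code-canonical : ∀ {i α} → Canonical i α → ∀ x →
          (ball-code x ≡ i → RootedIso (ball G ρ x) (ballRoot G ρ x) (graph (shape α)) (root α)) ×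
          (RootedIso (ball G ρ x) (ballRoot G ρ x) (graph (shape α)) (root α) → ball-code x ≡ i)
        code-canonical {i} {α} (rep , minimal) x = forward , backward
          where
          forward : ball-code x ≡ i → RootedIso (ball G ρ x) (ballRoot G ρ x) (graph (shape α)) (root α)
          forward e with at-code e
          ... | (β , rep′ , iso) , _ with just-injective (trans (sym rep) rep′)
          ... | refl = iso
          backward : RootedIso (ball G ρ x) (ballRoot G ρ x) (graph (shape α)) (root α) → ball-code x ≡ i
          backward iso with Fin.<-cmp (ball-code x) i | at-code {x} refl
          ... | tri≈ _ e _ | _ = e
          ... | tri> _ _ i<c | _ , none = ⊥-elim (none i i<c (α , rep , iso))
          ... | tri< c<i _ _ | (β , rep′ , iso′) , _ = ⊥-elim (minimal _ c<i (β , rep′ , RootedIso-trans {H = ball G ρ x} (RootedIso-sym iso) iso′))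

        code-noncanonical : ∀ {i} → ¬ ∃ (Canonical i) → ∀ x → ball-code x ≢ i
        code-noncanonical {i} none x e with at-code e
        ... | (α , rep , iso) , least-code = none (α , rep , λ j j<i (β , rep′ , iso′) →
          least-code j j<i (β , rep′ , RootedIso-trans {H = graph (shape α)} iso iso′))

      same-code : ∀ {n n′} {G : SimpleGraph (Fin n)} {G′ : SimpleGraph (Fin n′)}
        (degrees : ∀ v → degree G v ≤ d) (small : ∀ v → # (Within G ρ v) ≤ b)
        (degrees′ : ∀ v → degree G′ v ≤ d) (small′ : ∀ v → # (Within G′ ρ v) ≤ b) → ∀ {x x′} →
        Classify.ball-code G degrees small x ≡ Classify.ball-code G′ degrees′ small′ x′ → LocalIso ρ G′ x′ G x
      same-code {G = G} {G′} degrees small degrees′ small′ {x} {x′} e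
        with Classify.classified G degrees small x | Classify.classified G′ degrees′ small′ x′
      ... | i , (α , rep , iso) , _ | i′ , (α′ , rep′ , iso′) , _ with e
      ... | refl with just-injective (trans (sym rep) rep′)
      ... | refl = fromRootedIso (RootedIso-trans {H = graph (shape α)} iso′ (RootedIso-sym iso))

∣-∣≤⇒≤ : ∀ {p q r} → ℚ.∣ p ℚ.- q ∣ ℚ.≤ r → p ℚ.≤ q ℚ.+ r
∣-∣≤⇒≤ {p} {q} {r} le = begin
  p ≡⟨ sym (trans (cong (q ℚ.+_) (ℚ.+-comm p (ℚ.- q))) (trans (sym (ℚ.+-assoc q (ℚ.- q) p))
                                (trans (cong (ℚ._+ p) (ℚ.+-inverseʳ q)) (ℚ.+-identityˡ p)))) ⟩
  q ℚ.+ (p ℚ.- q) ≤⟨ ℚ.+-monoʳ-≤ q (ℚ.≤-trans p≤∣p∣ le) ⟩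
  q ℚ.+ r ∎
  where
  open ℚ.≤-Reasoning
  p≤∣p∣ : ∀ {x} → x ℚ.≤ ℚ.∣ x ∣
  p≤∣p∣ {x} with ℚ.≤-total 0ℚ x
  ... | inj₁ 0≤x = ℚ.≤-reflexive (sym (ℚ.0≤p⇒∣p∣≡p 0≤x))
  ... | inj₂ x≤0 = ℚ.≤-trans x≤0 (ℚ.0≤∣p∣ x)

∣-∣-sym : ∀ p q → ℚ.∣ p ℚ.- q ∣ ≡ ℚ.∣ q ℚ.- p ∣
∣-∣-sym p q = trans (sym (ℚ.∣-p∣≡∣p∣ (p ℚ.- q))) (cong ℚ.∣_∣ (trans (ℚ.neg-distrib-+ p (ℚ.- q))
  (trans (ℚ.+-comm (ℚ.- p) (ℚ.- (ℚ.- q))) (cong (ℚ._- p) (ℚ-Group.⁻¹-involutive q)))))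

≤⇒-≤ : ∀ {p q r} → p ℚ.≤ q ℚ.+ r → p ℚ.- q ℚ.≤ r
≤⇒-≤ {p} {q} {r} p≤q+r = begin
  p ℚ.- q ≤⟨ ℚ.+-monoˡ-≤ (ℚ.- q) p≤q+r ⟩
  (q ℚ.+ r) ℚ.- q ≡⟨ trans (cong (ℚ._- q) (ℚ.+-comm q r)) (trans (ℚ.+-assoc r q (ℚ.- q)) (trans (cong (r ℚ.+_) (ℚ.+-inverseʳ q)) (ℚ.+-identityʳ r))) ⟩
  r ∎
  where open ℚ.≤-Reasoning

≤⇒∣-∣≤ : ∀ {p q r} → p ℚ.≤ q ℚ.+ r → q ℚ.≤ p ℚ.+ r → ℚ.∣ p ℚ.- q ∣ ℚ.≤ r
≤⇒∣-∣≤ {p} {q} {r} p≤q+r q≤p+r with ℚ.≤-total 0ℚ (p ℚ.- q)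
... | inj₁ 0≤ = subst (ℚ._≤ r) (sym (ℚ.0≤p⇒∣p∣≡p 0≤)) (≤⇒-≤ p≤q+r)
... | inj₂ ≤0 = subst (ℚ._≤ r) (sym (trans (∣-∣-sym p q) (ℚ.0≤p⇒∣p∣≡p 0≤′))) (≤⇒-≤ q≤p+r)
  where
  0≤′ : 0ℚ ℚ.≤ q ℚ.- p
  0≤′ = begin
    0ℚ ≡⟨ sym (ℚ.+-inverseʳ p) ⟩
    p ℚ.- p ≤⟨ ℚ.+-monoˡ-≤ (ℚ.- p) p≤q ⟩
    q ℚ.- p ∎
    where
    open ℚ.≤-Reasoning
    p≤q : p ℚ.≤ q
    p≤q = begin
      p ≡⟨ sym (trans (ℚ.+-assoc p (ℚ.- q) q) (trans (cong (p ℚ.+_) (ℚ.+-inverseˡ q)) (ℚ.+-identityʳ p))) ⟩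
      (p ℚ.- q) ℚ.+ q ≤⟨ ℚ.+-monoˡ-≤ q ≤0 ⟩
      0ℚ ℚ.+ q ≡⟨ ℚ.+-identityˡ q ⟩
      q ∎

Cauchy : (ℕ → ℚ) → Set
Cauchy a = ∀ h → ∃[ N ] ∀ m n → N ≤ m → N ≤ n → a m ℚ.≤ a n ℚ.+ + 1 ℚ./ suc h

limit⇒Cauchy : ∀ {a} → HasLimit (fromℚ ∘ a) → Cauchy a
limit⇒Cauchy {a} (L , lim) h with lim (+ 1 ℚ./ (4 * suc h)) (unit-fraction-positive (h + 3 * suc h))
... | N , close = N , λ m n N≤m N≤n → begin
  a m ≤⟨ ∣-∣≤⇒≤ {a m} {approx L j} (close m N≤m j) ⟩
  approx L j ℚ.+ ε ≤⟨ ℚ.+-monoˡ-≤ ε (∣-∣≤⇒≤ {approx L j} {a n} (subst (ℚ._≤ ε) (∣-∣-sym (a n) (approx L j)) (close n N≤n j))) ⟩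
  a n ℚ.+ ε ℚ.+ ε ≡⟨ ℚ.+-assoc (a n) ε ε ⟩
  a n ℚ.+ (ε ℚ.+ ε) ≡⟨ cong (a n ℚ.+_) ε+ε ⟩
  a n ℚ.+ + 1 ℚ./ suc h ∎
  where
  open ℚ.≤-Reasoning
  j = 7 + 8 * h
  ε = + 1 ℚ./ (4 * suc h) ℚ.+ + 2 ℚ./ suc j
  ε≡ : ε ≡ + 1 ℚ./ (2 * suc h)
  ε≡ = trans (/-+ 1 (4 * suc h) 2 (suc j)) (/-cong-≡ (1 * suc j + 2 * (4 * suc h)) (4 * suc h * suc j) 1 (2 * suc h) {{m*n≢0 (4 * suc h) (suc j)}} (arith h))
    where
    arith : ∀ h → (1 * (1 + (7 + 8 * h)) + 2 * (4 * (1 + h))) * (2 * (1 + h)) ≡ 1 * (4 * (1 + h) * (1 + (7 + 8 * h)))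
    arith = solve-∀
  ε+ε : ε ℚ.+ ε ≡ + 1 ℚ./ suc h
  ε+ε = trans (cong₂ ℚ._+_ ε≡ ε≡) (trans (/-+ 1 (2 * suc h) 1 (2 * suc h))
    (/-cong-≡ (1 * (2 * suc h) + 1 * (2 * suc h)) (2 * suc h * (2 * suc h)) 1 (suc h) {{m*n≢0 (2 * suc h) (2 * suc h)}} (arith h)))
    where
    arith : ∀ h → (1 * (2 * (1 + h)) + 1 * (2 * (1 + h))) * (1 + h) ≡ 1 * (2 * (1 + h) * (2 * (1 + h)))
    arith = solve-∀

Cauchy⇒limit : ∀ {a} → Cauchy a → HasLimit (fromℚ ∘ a)
Cauchy⇒limit {a} cauchy = L , lim
  where
  N : ℕ → ℕ
  N k = proj₁ (cauchy k)

  close : ∀ h j n → N h ≤ n → a n ℚ.≤ a (N j) ℚ.+ (+ 1 ℚ./ suc h ℚ.+ + 1 ℚ./ suc j)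
  close h j n Nh≤n = begin
    a n ≤⟨ proj₂ (cauchy h) n p Nh≤n (m≤m⊔n (N h) (N j)) ⟩
    a p ℚ.+ + 1 ℚ./ suc h ≤⟨ ℚ.+-monoˡ-≤ (+ 1 ℚ./ suc h) (proj₂ (cauchy j) p (N j) (m≤n⊔m (N h) (N j)) ≤-refl) ⟩
    a (N j) ℚ.+ + 1 ℚ./ suc j ℚ.+ + 1 ℚ./ suc h ≡⟨ trans (ℚ.+-assoc (a (N j)) _ _) (cong (a (N j) ℚ.+_) (ℚ.+-comm (+ 1 ℚ./ suc j) (+ 1 ℚ./ suc h))) ⟩
    a (N j) ℚ.+ (+ 1 ℚ./ suc h ℚ.+ + 1 ℚ./ suc j) ∎
    where
    open ℚ.≤-Reasoning
    p = N h ⊔ N j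

  close′ : ∀ h j n → N h ≤ n → a (N j) ℚ.≤ a n ℚ.+ (+ 1 ℚ./ suc h ℚ.+ + 1 ℚ./ suc j)
  close′ h j n Nh≤n = begin
    a (N j) ≤⟨ proj₂ (cauchy j) (N j) p ≤-refl (m≤n⊔m (N h) (N j)) ⟩
    a p ℚ.+ + 1 ℚ./ suc j ≤⟨ ℚ.+-monoˡ-≤ (+ 1 ℚ./ suc j) (proj₂ (cauchy h) p n (m≤m⊔n (N h) (N j)) Nh≤n) ⟩
    a n ℚ.+ + 1 ℚ./ suc h ℚ.+ + 1 ℚ./ suc j ≡⟨ ℚ.+-assoc (a n) _ _ ⟩
    a n ℚ.+ (+ 1 ℚ./ suc h ℚ.+ + 1 ℚ./ suc j) ∎
    where
    open ℚ.≤-Reasoning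
    p = N h ⊔ N j

  L : ℝ
  L .approx k = a (N k)
  L .regular m n = ≤⇒∣-∣≤ (close m n (N m) ≤-refl) (close′ m n (N m) ≤-refl)

  lim : IsLimit (fromℚ ∘ a) L
  lim ε ε>0 with unit-fraction-≤ ε ε>0
  ... | h , 1/h≤ε = N h , λ n Nh≤n j →
    ℚ.≤-trans (≤⇒∣-∣≤ (close h j n Nh≤n) (close′ h j n Nh≤n))
      (ℚ.+-mono-≤ 1/h≤ε (/-mono-≤ 1 (suc j) 2 (suc j) (*-monoˡ-≤ (suc j) (s≤s (z≤n {1})))))

module Minima (em : ExcludedMiddle 0ℓ) where

  least-natural : (Q : ℕ → Set) → ∃ Q → ∃[ k ] Q k × ∀ j → Q j → k ≤ j
  least-natural Q (k , q) = <-rec (λ k → Q k → ∃[ k ] Q k × ∀ j → Q j → k ≤ j) descend k q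
    where
    descend : ∀ k → (∀ {j} → j < k → Q j → ∃[ k ] Q k × ∀ j → Q j → k ≤ j) → Q k → ∃[ k ] Q k × ∀ j → Q j → k ≤ j
    descend k smaller q with em {∃[ j ] j < k × Q j}
    ... | yes (j , j<k , qj) = smaller j<k qj
    ... | no none = k , q , λ j qj → ≮⇒≥ (λ j<k → none (j , j<k , qj))

  -- The terms eventually stay within 1/e of the least multiple of 1/e that bounds some
  -- late term.
  almost-decreasing⇒Cauchy : (x o : ℕ → ℕ) .(o≢0 : ∀ n → NonZero (o n)) →
    (∀ e → 1 ≤ e → ∃[ N ] ∀ n → N ≤ n → ∃[ M ] ∀ m → M ≤ m → e * (x m * o n) ≤ e * (x n * o m) + o n * o m) →
    Cauchy (λ n → (+ x n ℚ./ o n) {{o≢0 n}})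
  almost-decreasing⇒Cauchy x o o≢0 decreasing h with decreasing (2 * suc h) (s≤s z≤n)
  ... | N , late with least-natural (λ k → ∃[ n ] N ≤ n × 2 * suc h * x n ≤ k * o n) (2 * suc h * x N , N , ≤-refl , m≤m*n _ (o N) {{o≢0 N}})
  ... | k , (n₀ , N≤n₀ , below) , minimal with late n₀ N≤n₀
  ... | M , after = N ⊔ M , λ m n ≤m ≤n → subst ((+ x m ℚ./ o m) {{o≢0 m}} ℚ.≤_) (sym (/-+ (x n) (o n) 1 (suc h) {{o≢0 n}}))
    (/-mono-≤ (x m) (o m) (x n * suc h + 1 * o n) (o n * suc h) {{o≢0 m}} {{m*n≢0 (o n) (suc h) {{o≢0 n}}}}
      (close m n (≤-trans (m≤m⊔n N M) ≤m) (≤-trans (m≤n⊔m N M) ≤m) (≤-trans (m≤m⊔n N M) ≤n)))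
    where
    open ≤-Reasoning
    e = 2 * suc h
    upper : ∀ m → M ≤ m → e * x m ≤ suc k * o m
    upper m M≤m = *-cancelʳ-≤ _ _ (o n₀) {{o≢0 n₀}} (begin
      e * x m * o n₀ ≡⟨ *-assoc e (x m) (o n₀) ⟩
      e * (x m * o n₀) ≤⟨ after m M≤m ⟩
      e * (x n₀ * o m) + o n₀ * o m ≡⟨ cong (_+ o n₀ * o m) (sym (*-assoc e (x n₀) (o m))) ⟩
      e * x n₀ * o m + o n₀ * o m ≤⟨ +-monoˡ-≤ (o n₀ * o m) (*-monoˡ-≤ (o m) below) ⟩
      k * o n₀ * o m + o n₀ * o m ≡⟨ rearrange k (o n₀) (o m) ⟩
      suc k * o m * o n₀ ∎)
      where
      rearrange : ∀ k a b → k * a * b + a * b ≡ (1 + k) * b * a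
      rearrange = solve-∀
    lower : ∀ n → N ≤ n → k * o n ≤ e * x n + o n
    lower n N≤n = below-by k minimal
      where
      below-by : ∀ k → (∀ j → ∃[ n ] N ≤ n × e * x n ≤ j * o n → k ≤ j) → k * o n ≤ e * x n + o n
      below-by zero    _       = z≤n
      below-by (suc k) minimal = ≤-trans (≤-reflexive (+-comm (o n) (k * o n)))
        (+-monoˡ-≤ (o n) (<⇒≤ (≰⇒> (λ le → <⇒≱ ≤-refl (minimal k (n , N≤n , le))))))
    close : ∀ m n → N ≤ m → M ≤ m → N ≤ n → x m * (o n * suc h) ≤ (x n * suc h + 1 * o n) * o m
    close m n N≤m M≤m N≤n = *-cancelˡ-≤ 2 (begin
      2 * (x m * (o n * suc h)) ≡⟨ rearrange₁ (x m) (o n) h ⟩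
      e * x m * o n ≤⟨ *-monoˡ-≤ (o n) (upper m M≤m) ⟩
      suc k * o m * o n ≡⟨ rearrange₂ k (o m) (o n) ⟩
      (k * o n + o n) * o m ≤⟨ *-monoˡ-≤ (o m) (+-monoˡ-≤ (o n) (lower n N≤n)) ⟩
      (e * x n + o n + o n) * o m ≡⟨ rearrange₃ (x n) (o n) (o m) h ⟩
      2 * ((x n * suc h + 1 * o n) * o m) ∎)
      where
      rearrange₁ : ∀ x o h → 2 * (x * (o * (1 + h))) ≡ 2 * (1 + h) * x * o
      rearrange₁ = solve-∀
      rearrange₂ : ∀ k a b → (1 + k) * a * b ≡ (k * b + b) * a
      rearrange₂ = solve-∀
      rearrange₃ : ∀ x b a h → (2 * (1 + h) * x + b + b) * a ≡ 2 * ((x * (1 + h) + 1 * b) * a)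
      rearrange₃ = solve-∀

fromℚ-mono-≤ : ∀ {p q} → p ℚ.≤ q → fromℚ p ≤ᴿ fromℚ q
fromℚ-mono-≤ {p} {q} p≤q n = ℚ.≤-trans p≤q (≤-+ (+ 2 ℚ./ suc n) {{ℚ.normalize-nonNeg 2 (suc n)}})
  where
  ≤-+ : ∀ r .{{_ : ℚ.NonNegative r}} → q ℚ.≤ q ℚ.+ r
  ≤-+ r = ℚ.≤-trans (ℚ.≤-reflexive (sym (ℚ.+-identityʳ q))) (ℚ.+-monoʳ-≤ q (ℚ.nonNegative⁻¹ r))

↔⇒≤ : ∀ {m n} → Fin m ↔ Fin n → m ≤ n
↔⇒≤ π = Fin.injective⇒≤ (to-injective π)

common-bound : ∀ {c} (Q : Fin c → ℕ → ℕ → Set) →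
               (∀ i → ∃[ N ] ∀ m n → N ≤ m → N ≤ n → Q i m n) → ∃[ N ] ∀ i m n → N ≤ m → N ≤ n → Q i m n
common-bound {zero}  Q bounds = 0 , λ ()
common-bound {suc c} Q bounds with bounds zero | common-bound (Q ∘ suc) (bounds ∘ suc)
... | N , q | N′ , q′ = N ⊔ N′ , λ where
  zero    m n ≤m ≤n → q m n (≤-trans (m≤m⊔n N N′) ≤m) (≤-trans (m≤m⊔n N N′) ≤n)
  (suc i) m n ≤m ≤n → q′ i m n (≤-trans (m≤n⊔m N N′) ≤m) (≤-trans (m≤n⊔m N N′) ≤n)

-- The field order≢0 is irrelevant, so it has no projection.
order-nonZero : ∀ G → NonZero (order G)
order-nonZero (⟨_⟩ {n} g) = >-nonZero (>-nonZero⁻¹ n)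

module Distance (em : ExcludedMiddle 0ℓ) (d : ℕ) (P : Pred FinGraph 0ℓ) (P-closed : IsUnionClosedMonotone d P) where
  open Pairs em
  open Minima em
  open IsUnionClosedMonotone P-closed

  Attained : FinGraph → ℕ → Set
  Attained G k = Σ[ H ∈ SimpleGraph (Vertex G) ] P ⟨ H ⟩ × ∣E graph G △E H ∣ ≡ k

  abstract
    closest : ∀ G → ∃[ k ] Attained G k × ∀ j → Attained G j → k ≤ j
    closest G = least-natural (Attained G)
      (_ , edgeless-graph , edgeless ⟨ edgeless-graph ⟩ (no-pairs (λ (_ _ : Vertex G) → false) (λ _ _ ())) , refl)

  distance : FinGraph → ℕ
  distance G = proj₁ (closest G)

  distance-≤ : ∀ G (H : SimpleGraph (Vertex G)) → P ⟨ H ⟩ → distance G ≤ ∣E graph G △E H ∣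
  distance-≤ G H PH = proj₂ (proj₂ (closest G)) _ (H , PH , refl)

  ζ : FinGraph → ℝ
  ζ G = fromℚ (+ distance G ℚ./ order G)

  ζ-infimum : ∀ G → IsEditDistanceFrom P G (ζ G)
  ζ-infimum G = lower-bound , greatest (proj₁ (proj₂ (closest G)))
    where
    lower-bound : ((H , _) : Σ[ H ∈ SimpleGraph (Vertex G) ] P ⟨ H ⟩) → ζ G ≤ᴿ fromℚ (editDistance (graph G) H)
    lower-bound (H , PH) = fromℚ-mono-≤ (/-mono-≤ (distance G) (order G) ∣E graph G △E H ∣ (order G) (*-monoˡ-≤ (order G) (distance-≤ G H PH)))
    greatest : Attained G (distance G) → ∀ z → ((i : Σ[ H ∈ SimpleGraph (Vertex G) ] P ⟨ H ⟩) → z ≤ᴿ fromℚ (editDistance (graph G) (proj₁ i))) → z ≤ᴿ ζ G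
    greatest (H , PH , eq) z lower = subst (λ e → z ≤ᴿ fromℚ (+ e ℚ./ order G)) eq (lower (H , PH))

  △-pullback : ∀ {m n} (π : Fin m ↔ Fin n) (G : SimpleGraph (Fin m)) (G′ H : SimpleGraph (Fin n)) →
    (∀ u v → adj G′ (Inverse.to π u) (Inverse.to π v) ≡ adj G u v) →
    ∣E G △E pullback (Inverse.to π) H ∣ ≡ ∣E G′ △E H ∣
  △-pullback π G G′ H iso = halve (begin
    ∣E G △E H₁ ∣ + ∣E G △E H₁ ∣
      ≡⟨ double-△ G H₁ ⟩
    ∑ (λ u → ∑ (λ v → χ (T (adj G u v xor adj H (to u) (to v)))))
      ≡⟨ ∑-cong (λ u → ∑-cong (λ v → cong (λ b → χ (T (b xor adj H (to u) (to v)))) (sym (iso u v)))) ⟩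
    ∑ (λ u → ∑ (λ v → χ (T (adj G′ (to u) (to v) xor adj H (to u) (to v)))))
      ≡⟨ ∑-cong (λ u → sym (∑-permute (λ v → χ (T (adj G′ (to u) v xor adj H (to u) v))) π)) ⟩
    ∑ (λ u → ∑ (λ v → χ (T (adj G′ (to u) v xor adj H (to u) v))))
      ≡⟨ sym (∑-permute (λ u → ∑ (λ v → χ (T (adj G′ u v xor adj H u v)))) π) ⟩
    ∑ (λ u → ∑ (λ v → χ (T (adj G′ u v xor adj H u v))))
      ≡⟨ sym (double-△ G′ H) ⟩
    ∣E G′ △E H ∣ + ∣E G′ △E H ∣
      ∎)
    where
    open ≡-Reasoning
    open Indicators em
    open Inverse π using (to)
    H₁ = pullback to H
    halve : ∀ {a b} → a + a ≡ b + b → a ≡ b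
    halve {a} {b} e = *-cancelˡ-≡ a b 2 (trans (cong (_+_ a) (+-identityʳ a)) (trans e (cong (_+_ b) (sym (+-identityʳ b)))))

  distance-mono : ∀ G H → graph G ≅ graph H → distance G ≤ distance H
  distance-mono G H φ = pull (proj₁ (proj₂ (closest H)))
    where
    π = bijection φ
    pull : Attained H (distance H) → distance G ≤ distance H
    pull (H₁ , PH₁ , eq) = ≤-trans
      (distance-≤ G (pullback (Inverse.to π) H₁) (resp-≅ {⟨ H₁ ⟩} {⟨ pullback (Inverse.to π) H₁ ⟩} (≅-sym (pullback-≅ π H₁)) PH₁))
      (≤-reflexive (trans (△-pullback π (graph G) (graph H) H₁ (preserves φ)) eq))

  ζ-invariant : IsGraphParameter ζ
  ζ-invariant G H φ = half G H φ , half H G (≅-sym φ)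
    where
    half : ∀ G H → graph G ≅ graph H → ζ G ≤ᴿ ζ H
    half G H φ = fromℚ-mono-≤ (/-mono-≤ (distance G) (order G) (distance H) (order H)
      (*-mono-≤ (distance-mono G H φ) (↔⇒≤ (↔-sym (bijection φ)))))

module Continuity (em : ExcludedMiddle 0ℓ) (d : ℕ) (1≤d : 1 ≤ d) (f : ℕ → ℕ) (sub : Subexponential f)
                  (P : Pred FinGraph 0ℓ) (P-closed : IsUnionClosedMonotone d P) where
  open Indicators em
  open BallTypes em
  open Comparisons em
  open Minima em
  open Distance em d P P-closed

  module _ (G : ℕ → FinGraph) (class : ∀ n → (Classical.Graph[_]^_ em d f) (G n)) (convergent : Classical.WeaklyConvergent em d G) where
    open Classical.WeaklyConvergent convergent

    private instance
      order-nonZeroᴳ : ∀ {n} → NonZero (order (G n))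
      order-nonZeroᴳ {n} = order-nonZero (G n)

    balls : ∀ n → BoundedBalls f (graph (G n))
    balls n u r 1≤r = ≤-trans (≤-reflexive (sym (card≡# (Within (graph (G n)) r u)))) (proj₂ (class n) u r 1≤r)

    degrees : ∀ n v → degree (graph (G n)) v ≤ d
    degrees n = proj₁ (class n)

    module _ (e : ℕ) (1≤e : 1 ≤ e) where
      open Compare d 1≤d f sub P P-closed e 1≤e using (ρ; R; 1≤R; h; Similar; threshold; comparison)

      private
        1≤ρ : 1 ≤ ρ
        1≤ρ = ≤-trans 1≤R (≤-trans (m≤m+n R _) (≤-trans (m≤m+n _ _) (m≤m+n _ _)))

        b = f ρ
        c = codes b

      small : ∀ n v → # (Within (graph (G n)) ρ v) ≤ b
      small n v = balls n v ρ 1≤ρ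

      τ : ∀ n → Vertex (G n) → Fin c
      τ n = Classify.ball-code b ρ d (graph (G n)) (degrees n) (small n)

      frequency : Fin c → ℕ → ℕ
      frequency i n = # (λ x → τ n x ≡ i)

      Close : Fin c → ℕ → ℕ → Set
      Close i m n = h c * (frequency i m * order (G n)) ≤ h c * (frequency i n * order (G m)) + order (G n) * order (G m)

      similar : ∃[ N ] ∀ i m n → N ≤ m → N ≤ n → Close i m n
      similar = common-bound Close (λ i → each i em)
        where
        each : ∀ i → Dec (∃ (Canonical b ρ d i)) → ∃[ N ] ∀ m n → N ≤ m → N ≤ n → Close i m n
        each i (no none) = 0 , λ m n _ _ → ≤-trans (≤-reflexive (trans
          (cong (λ z → h c * (z * order (G n))) (#-none (code-noncanonical b ρ d (degrees m) (small m) none))) (*-zeroʳ (h c)))) z≤n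
        each i (yes (α , canonical)) = proj₁ cauchy , λ m n N≤m N≤n → begin
          h c * (frequency i m * order (G n)) ≡⟨ rearrange₁ (h c) (frequency i m) (order (G n)) ⟩
          frequency i m * (order (G n) * h c) ≤⟨ integral m n (proj₂ cauchy m n N≤m N≤n) ⟩
          (frequency i n * h c + 1 * order (G n)) * order (G m) ≡⟨ rearrange₂ (h c) (frequency i n) (order (G n)) (order (G m)) ⟩
          h c * (frequency i n * order (G m)) + order (G n) * order (G m) ∎
          where
          open ≤-Reasoning
          cauchy : ∃[ N ] ∀ m n → N ≤ m → N ≤ n → Classical.p em (G m) α ℚ.≤ Classical.p em (G n) α ℚ.+ + 1 ℚ./ h c
          cauchy = limit⇒Cauchy (converges ρ 1≤ρ α) (pred (h c))
          rearrange₁ : ∀ h x n → h * (x * n) ≡ x * (n * h)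
          rearrange₁ = solve-∀
          rearrange₂ : ∀ h x n m → (x * h + 1 * n) * m ≡ h * (x * m) + n * m
          rearrange₂ = solve-∀
          p≡ : ∀ n → Classical.p em (G n) α ≡ + frequency i n ℚ./ order (G n)
          p≡ n = cong (λ z → + z ℚ./ order (G n)) (trans (card≡# _)
            (#-cong (λ x → proj₂ (code-canonical b ρ d (degrees n) (small n) canonical x))
                    (λ x → proj₁ (code-canonical b ρ d (degrees n) (small n) canonical x))))
          integral : ∀ m n → Classical.p em (G m) α ℚ.≤ Classical.p em (G n) α ℚ.+ + 1 ℚ./ h c →
                     frequency i m * (order (G n) * h c) ≤ (frequency i n * h c + 1 * order (G n)) * order (G m)
          integral m n le = /-cancel-≤ (frequency i m) (order (G m)) (frequency i n * h c + 1 * order (G n)) (order (G n) * h c) {{it}} {{m*n≢0 (order (G n)) (h c)}}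
            (subst₂ ℚ._≤_ (p≡ m) (trans (cong (ℚ._+ + 1 ℚ./ h c) (p≡ n)) (/-+ (frequency i n) (order (G n)) 1 (h c))) le)

      almost-decreasing : ∃[ N ] ∀ n → N ≤ n → ∃[ M ] ∀ m → M ≤ m →
        e * (distance (G m) * order (G n)) ≤ e * (distance (G n) * order (G m)) + order (G n) * order (G m)
      almost-decreasing = N , λ n N≤n → N ⊔ proj₁ (order→∞ (threshold c (order (G n)))) , λ m ≤m → compare-at n m N≤n
        (≤-trans (m≤m⊔n N _) ≤m) (proj₂ (order→∞ (threshold c (order (G n)))) m (≤-trans (m≤n⊔m N _) ≤m))
        where
        N = proj₁ similar
        close = proj₂ similar
        compare-at : ∀ n m → N ≤ n → N ≤ m → threshold c (order (G n)) ≤ order (G m) →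
          e * (distance (G m) * order (G n)) ≤ e * (distance (G n) * order (G m)) + order (G n) * order (G m)
        compare-at n m N≤n N≤m large =
          ≤-trans (*-monoʳ-≤ e (*-monoˡ-≤ (order (G n)) (distance-≤ (G m) (proj₁ compared) (proj₁ (proj₂ compared)))))
                  (≤-trans (proj₂ (proj₂ compared)) (≤-reflexive (cong (λ k → e * (k * order (G m)) + order (G n) * order (G m)) (proj₂ (proj₂ best)))))
          where
          best : Attained (G n) (distance (G n))
          best = proj₁ (proj₂ (closest (G n)))
          H = proj₁ best
          member : ∀ G {k} (best : Attained G k) → P (⟨_⟩ {{order-nonZero G}} (proj₁ best))
          member ⟨ g ⟩ (H , PH , _) = PH
          compared : Σ[ H′ ∈ SimpleGraph (Vertex (G m)) ] P ⟨ H′ ⟩ ×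
            e * (∣E graph (G m) △E H′ ∣ * order (G n)) ≤ e * (∣E graph (G n) △E H ∣ * order (G m)) + order (G n) * order (G m)
          compared = comparison c large (graph (G n)) (graph (G m)) (balls n) (balls m)
            (λ u → ≤-trans (≤-reflexive (sym (degree≡# (graph (G m)) u))) (degrees m u)) (τ n) (τ m)
            (same-code b ρ d (degrees n) (small n) (degrees m) (small m)) (λ i → close i m n N≤m N≤n) H (member (G n) best)

    ζ-converges : HasLimit (λ n → ζ (G n))
    ζ-converges = Cauchy⇒limit (almost-decreasing⇒Cauchy (λ n → distance (G n)) (λ n → order (G n)) (λ n → order-nonZero (G n)) almost-decreasing)

theorem2 : (em : ExcludedMiddle 0ℓ) →
    (d : ℕ) → 2 ≤ d →
    (f : ℕ → ℕ) → Subexponential f →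
    (P : Pred FinGraph 0ℓ) → IsUnionClosedMonotone d P →
    Σ[ ζ ∈ (FinGraph → ℝ) ]
    (∀ G → IsEditDistanceFrom P G (ζ G)) ×
    IsGraphParameter ζ ×
    Classical.ContinuousOn em d f ζ
theorem2 em d 2≤d f sub P P-closed = ζ , ζ-infimum , ζ-invariant , ζ-converges
  where
  open Distance em d P P-closed
  open Continuity em d (≤-trans (n≤1+n 1) 2≤d) f sub P P-closed
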